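{- For any programs $\Pi_1$ and $\Pi_2$ of mini-gringo with counting, the formula $\tau^*\Pi_1\leftrightarrow\tau^*\Pi_2$ is provable in the deductive system $\mathit{HT}_{\#}^{\omega}$ if and only if $\Pi_1$ and $\Pi_2$ are strongly equivalent.
   Context: Precomputed terms. Fix a totally ordered set of precomputed terms containing all numerals $\overline n$ (one for each integer $n$, in 1-1 correspondence with the integers), all symbolic constants, and possibly other symbols, such that numerals are contiguous (every precomputed term between two numerals is a numeral) and ordered as the integers. Programs (mini-gringo with counting). Program terms are built from precomputed terms and variables using unary $|\cdot|$ and binary $+,-,\times,/,\backslash,..$ (interval). An atom is a symbolic constant $p$ optionally followed by a parenthesized tuple of terms; a literal is an atom possibly preceded by one or two occurrences of $\mathit{not}$; a comparison is $t_1\prec t_2$ with $\prec$ one of $=,\neq,<,>,\le,\ge$. An aggregate element is $\mathbf X:\mathbf L$ with $\mathbf X$ a tuple of distinct variables and $\mathbf L$ a conjunction of literals and comparisons in which every member of $\mathbf X$ occurs. An aggregate atom is $\mathit{count}\{E\}\ge t$ or $\mathit{count}\{E\}\le t$, $E$ an aggregate element, $t$ a term without $..$. A rule is $\mathit{Head}\leftarrow\mathit{Body}$, $\mathit{Body}$ a (possibly empty) conjunction of literals, comparisons and aggregate atoms, $\mathit{Head}$ an atom (basic rule), an atom in braces (choice rule) or empty (constraint). A variable is local in a rule if all its occurrences are inside aggregate elements, global otherwise; a rule is pure if for every aggregate element $\mathbf X:\mathbf L$ in its body all members of $\mathbf X$ are local. A program is a finite set of pure rules. Semantics. A precomputed atom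 is $p(\mathbf t)$ with all members of $\mathbf t$ precomputed. The semantics (Lifschitz 2022) uses a translation $\tau$ mapping each pure rule $R$ to an infinitary propositional formula $\tau R$ built from precomputed atoms (e.g. $q\leftarrow\mathit{count}\{X:p(X)\}\le5$ becomes $(\bigwedge_{\Delta:|\Delta|>5}\neg\bigwedge_{x\in\Delta}p(x))\to q$, $\Delta$ over finite sets of precomputed terms); $\tau\Pi$ is the conjunction of $\tau R$, $R\in\Pi$. Stable models of $\Pi$ are those of $\tau\Pi$ in the sense of Truszczyński (2012). $\Pi_1,\Pi_2$ are strongly equivalent if for every set $\Phi$ of infinitary propositional formulas built from precomputed atoms, $\{\tau\Pi_1\}\cup\Phi$ and $\{\tau\Pi_2\}\cup\Phi$ have the same stable models. Signatures. Two sorts, general and its subsort integer; integer variables written $I,J,K,M,N$; program variables are general variables. $\sigma_0$: numerals as integer object constants; other precomputed terms as general object constants; $|\cdot|,+,-,\times$ as function constants on integers; predicate constants $p/n$ (written $p(\mathbf t)$) with general arguments; binary predicate constants $\neq,<,>,\le,\ge$ with general arguments ($=$ is logical equality). $\sigma_1$ adds, for disjoint lists $\mathbf X,\mathbf V$ of distinct general variables and any formula $F$ over $\sigma_0$ with free variables among $\mathbf X,\mathbf V$, predicate constants $\mathit{Atleast}^{\mathbf X;\mathbf V}_F,\mathit{Atmost}^{\mathbf X;\mathbf V}_F$ with $|\mathbf V|+1$ general arguments. Translation $\tau^*$. For a program term $t$ and general variable $Z$ not in $t$, $\mathit{val}_t(Z)$ over $\sigma_0$ is: $Z=t$ if $t$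 is a precomputed term or variable; $\exists I(\mathit{val}_{t_1}(I)\wedge Z=|I|)$ if $t=|t_1|$; $\exists IJ(\mathit{val}_{t_1}(I)\wedge\mathit{val}_{t_2}(J)\wedge Z=I\,op\,J)$ if $t=t_1\,op\,t_2$, $op\in\{+,-,\times\}$; for $t=t_1/t_2$: $\exists IJK(\mathit{val}_{t_1}(I)\wedge\mathit{val}_{t_2}(J)\wedge K\times|J|\le|I|<(K+\overline1)\times|J|\wedge((I\times J\ge\overline0\wedge Z=K)\vee(I\times J<\overline0\wedge Z=-K)))$; for $t_1\backslash t_2$ the same with $Z=I-K\times J$, $Z=I+K\times J$ replacing $Z=K$, $Z=-K$; for $t_1..t_2$: $\exists IJK(\mathit{val}_{t_1}(I)\wedge\mathit{val}_{t_2}(J)\wedge I\le K\le J\wedge Z=K)$ ($I,J,K$ fresh integer variables); tuples componentwise. With fresh general variables: $\tau^B(p(\mathbf t))=\exists\mathbf Z(\mathit{val}_{\mathbf t}(\mathbf Z)\wedge p(\mathbf Z))$, $\tau^B(\mathit{not}\,p(\mathbf t))=\exists\mathbf Z(\mathit{val}_{\mathbf t}(\mathbf Z)\wedge\neg p(\mathbf Z))$, $\tau^B(\mathit{not}\,\mathit{not}\,p(\mathbf t))=\exists\mathbf Z(\mathit{val}_{\mathbf t}(\mathbf Z)\wedge\neg\neg p(\mathbf Z))$, $\tau^B(t_1\prec t_2)=\exists Z_1Z_2(\mathit{val}_{t_1}(Z_1)\wedge\mathit{val}_{t_2}(Z_2)\wedge Z_1\prec Z_2)$, and $\tau^B$ of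 a conjunction is the conjunction of $\tau^B$ of its members. For a body element $B$: $B^*=\tau^B(B)$ for literals and comparisons; for $\mathit{count}\{\mathbf X:\mathbf L\}\ge t$, $B^*=\exists C(\mathit{val}_t(C)\wedge\mathit{Atleast}^{\mathbf X;\mathbf V}_{\exists\mathbf W\tau^B(\mathbf L)}(\mathbf V,C))$, and for $\le$ the same with $\mathit{Atmost}$, where $C$ is fresh, $\mathbf V$ lists the global variables in $\mathbf L$ and $\mathbf W$ the local variables in $\mathbf L$ not in $\mathbf X$. $\tau^*$ of $H\leftarrow B_1\wedge\dots\wedge B_n$ is the universal closure of $B_1^*\wedge\dots\wedge B_n^*\wedge\mathit{val}_{\mathbf t}(\mathbf Z)\to p(\mathbf Z)$ if $H=p(\mathbf t)$; of $B_1^*\wedge\dots\wedge B_n^*\wedge\mathit{val}_{\mathbf t}(\mathbf Z)\to p(\mathbf Z)\vee\neg p(\mathbf Z)$ if $H=\{p(\mathbf t)\}$; of $\neg(B_1^*\wedge\dots\wedge B_n^*)$ if $H$ is empty. $\tau^*\Pi$ is the conjunction over the rules. System $\mathit{HT}_{\#}^{\omega}$. $F^X_t$ denotes substitution. A standard interpretation of $\sigma_0$ has general domain the precomputed terms, integer domain the numerals, object constants denoting themselves, arithmetic symbols with their usual meaning and $\neq,<,>,\le,\ge$ given by the order on precomputed terms; $\mathit{Std}$ is the set of sentences over $\sigma_0$ without symbols $p/n$ satisfied by standard interpretations. For a precomputed term $r$, tuple $\mathbf X$ and formula $F$ over $\sigma_0$: $\exists_{\ge r}\mathbf X\,F$ is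 $\exists\mathbf X_1\cdots\mathbf X_n(\bigwedge_{i=1}^nF^{\mathbf X}_{\mathbf X_i}\wedge\bigwedge_{i<j}\neg(\mathbf X_i=\mathbf X_j))$ if $r=\overline n>\overline0$, $\top$ if $r\le\overline0$, $\bot$ if $r>\overline n$ for all $n$; $\exists_{\le r}\mathbf X\,F$ is $\forall\mathbf X_1\cdots\mathbf X_{n+1}(\bigwedge_{i=1}^{n+1}F^{\mathbf X}_{\mathbf X_i}\to\bigvee_{i<j}\mathbf X_i=\mathbf X_j)$ if $r=\overline n\ge\overline0$, $\bot$ if $r<\overline0$, $\top$ if $r>\overline n$ for all $n$ (fresh disjoint tuples $\mathbf X_i$; tuple equality componentwise). $\mathit{Defs}$ is the set of all sentences $\forall\mathbf V(\mathit{Atleast}^{\mathbf X;\mathbf V}_F(\mathbf V,r)\leftrightarrow\exists_{\ge r}\mathbf XF)$ and $\forall\mathbf V(\mathit{Atmost}^{\mathbf X;\mathbf V}_F(\mathbf V,r)\leftrightarrow\exists_{\le r}\mathbf XF)$. $\mathit{HT}_{\#}^{\omega}$ is the natural deduction system for first-order intuitionistic logic with equality over the two-sorted signature $\sigma_1$, whose derivable objects are sequents $\Gamma\Rightarrow F$ ($\Gamma$ a finite set of formulas over $\sigma_1$; $\Rightarrow F$ identified with $F$), extended by all formulas $F\vee(F\to G)\vee\neg G$ and $\exists X(F\to\forall XF)$ ($F,G$ over $\sigma_1$), the axioms $\mathit{Std}$ and $\mathit{Defs}$, and the $\omega$-rules: from $\Gamma\Rightarrow F^X_t$ for all precomputed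 terms $t$ infer $\Gamma\Rightarrow\forall XF$ ($X$ general), and from $\Gamma\Rightarrow F^N_{\overline n}$ for all integers $n$ infer $\Gamma\Rightarrow\forall NF$ ($N$ integer).
   Formalization: The set of precomputed terms (symbolic constants and other symbols) is additionally assumed to be countable; over an uncountable set the ω-system is incomplete and the equivalence fails. -}

module Defs where

open import Axiom.ExcludedMiddle using (ExcludedMiddle)
open import Data.Bool.Base using (Bool; true; false)
open import Data.Empty using (⊥)
open import Data.Fin.Base as Fin using (Fin; zero; suc; _↑ˡ_; _↑ʳ_; splitAt; combine)
open import Data.Fin.Patterns using (0F; 1F; 2F)
open import Data.Fin.Properties using (_<?_)
open import Data.Integer.Base as ℤ using (ℤ; +_; +[1+_]; 0ℤ; 1ℤ; ∣_∣; sign; _◃_)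
open import Data.List.Base
  using (List; []; _∷_; _++_; map; concatMap; filter; deduplicate; foldr; length; lookup;
         allFin; cartesianProduct)
open import Data.List.Membership.Propositional using (_∈_; _∉_)
open import Data.List.Relation.Binary.Pointwise using (Pointwise)
open import Data.List.Relation.Unary.All using (All)
open import Data.List.Relation.Unary.Any using (index)
open import Data.List.Relation.Unary.Unique.Propositional using (Unique)
open import Data.Nat.Base as ℕ using (ℕ; zero; suc; _+_; _*_)
open import Data.Nat.Properties using (_≟_)
open import Data.List.Membership.DecPropositional _≟_ using (_∈?_)
open import Data.Product.Base using (Σ; ∃; ∃-syntax; Σ-syntax; _×_; _,_; proj₁; proj₂)
open import Data.Sign.Base as Sign using ()
open import Data.Sum.Base using (_⊎_; [_,_]′)
open import Data.Unit.Base using (⊤)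
open import Data.Vec.Base as Vec using (Vec; []; _∷_; fromList; toList; tabulate)
open import Function.Base using (_∘_)
open import Function.Bundles using (_⇔_; _↣_)
open import Level using (0ℓ) renaming (suc to lsuc)
open import Relation.Binary.Core using (Rel)
open import Relation.Binary.PropositionalEquality.Core using (_≡_; _≢_)
open import Relation.Binary.Structures using (IsTotalOrder)
open import Relation.Nullary.Decidable.Core using (yes; no; ¬?; _×-dec_)
open import Relation.Unary using (Pred; _⊆_; _∪_; ｛_｝)

data Precomputed (Constant : Set) : Set where
  numeral  : ℤ → Precomputed Constant
  constant : Constant → Precomputed Constant

-- The numerals are the integers; the other precomputed terms are the symbolic
-- constants (Symbol) and possibly more (Other).
record PrecomputedTerms : Set₁ where
  field
    Symbol Other : Set
    _≤_          : Rel (Precomputed (Symbol ⊎ Other)) 0ℓ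
    isTotalOrder : IsTotalOrder _≡_ _≤_
    numeral-≤    : ∀ m n → (m ℤ.≤ n) ⇔ (numeral m ≤ numeral n)
    contiguous   : ∀ m n r → numeral m ≤ r → r ≤ numeral n → ∃[ k ] r ≡ numeral k
    -- There are countably many precomputed terms, as for strings over an
    -- alphabet.  With uncountably many of them the ω-rules are incomplete.
    Symbol-countable : Symbol ↣ ℕ
    Other-countable  : Other ↣ ℕ

infixr 5 _⇒ⁱ_

data InfFormula (A : Set) : Set₁ where
  atomⁱ : A → InfFormula A
  ⊥ⁱ    : InfFormula A
  ⋀ ⋁   : {I : Set} → (I → InfFormula A) → InfFormula A
  _⇒ⁱ_  : InfFormula A → InfFormula A → InfFormula A

module _ {A : Set} where

  infix 20 ¬ⁱ_
  infixr 19 _∨ⁱ_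

  ⊤ⁱ : InfFormula A
  ⊤ⁱ = ⋀ {I = ⊥} λ ()

  ¬ⁱ_ : InfFormula A → InfFormula A
  ¬ⁱ F = F ⇒ⁱ ⊥ⁱ

  _∨ⁱ_ : InfFormula A → InfFormula A → InfFormula A
  F ∨ⁱ G = ⋁ {I = Bool} λ { true → F ; false → G }

  ⋀ᴸ : {B : Set} → (B → InfFormula A) → List B → InfFormula A
  ⋀ᴸ f xs = ⋀ λ k → f (lookup xs k)

  infix 4 _⊨ⁱ_

  _⊨ⁱ_ : Pred A 0ℓ → InfFormula A → Set
  I ⊨ⁱ atomⁱ a  = I a
  I ⊨ⁱ ⊥ⁱ       = ⊥
  I ⊨ⁱ ⋀ F      = ∀ k → I ⊨ⁱ F k
  I ⊨ⁱ ⋁ F      = ∃[ k ] I ⊨ⁱ F k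
  I ⊨ⁱ (F ⇒ⁱ G) = I ⊨ⁱ F → I ⊨ⁱ G

  Theory : Set₂
  Theory = Pred (InfFormula A) (lsuc 0ℓ)

  -- Excluded middle decides which subformulas hold in I.
  module _ (em : ExcludedMiddle 0ℓ) where

    reduct : Pred A 0ℓ → InfFormula A → InfFormula A
    reduct I (atomⁱ a) with em {I a}
    ... | yes _ = atomⁱ a
    ... | no  _ = ⊥ⁱ
    reduct I ⊥ⁱ    = ⊥ⁱ
    reduct I (⋀ F) = ⋀ λ k → reduct I (F k)
    reduct I (⋁ F) = ⋁ λ k → reduct I (F k)
    reduct I (F ⇒ⁱ G) with em {I ⊨ⁱ (F ⇒ⁱ G)}
    ... | yes _ = reduct I F ⇒ⁱ reduct I G
    ... | no  _ = ⊥ⁱ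

    ModelsReduct : Pred A 0ℓ → Theory → Pred A 0ℓ → Set₁
    ModelsReduct I T J = ∀ F → T F → J ⊨ⁱ reduct I F

    Stable : Theory → Pred A 0ℓ → Set₁
    Stable T I = ModelsReduct I T I × (∀ J → J ⊆ I → ModelsReduct I T J → I ⊆ J)

    SameStableModels : Theory → Theory → Set₁
    SameStableModels T₁ T₂ = ∀ I → Stable T₁ I ⇔ Stable T₂ I

data ArithOp : Set where
  add sub mul : ArithOp

data DivOp : Set where
  quo rem : DivOp

data Relation : Set where
  neq lt gt le ge : Relation

data Bound : Set where
  atLeast atMost : Bound

⟦_⟧ᵃ : ArithOp → ℤ → ℤ → ℤ
⟦ add ⟧ᵃ m n = m ℤ.+ n
⟦ sub ⟧ᵃ m n = m ℤ.- n
⟦ mul ⟧ᵃ m n = m ℤ.* n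

-- Division truncates toward zero, unlike the division of Data.Integer.
quotient : ∀ m n → .{{ℤ.NonZero n}} → ℤ
quotient m n = (sign m Sign.* sign n) ◃ (∣ m ∣ ℕ./ ∣ n ∣)

remainder : ∀ m n → .{{ℤ.NonZero n}} → ℤ
remainder m n = m ℤ.- n ℤ.* quotient m n

module Language (P : PrecomputedTerms) where

  open PrecomputedTerms P public
  open import Relation.Binary.Construct.NonStrictToStrict _≡_ _≤_ public using (_<_)

  Constant : Set
  Constant = Symbol ⊎ Other

  Pre : Set
  Pre = Precomputed Constant

  PreAtom : Set
  PreAtom = Symbol × List Pre

  compare : Relation → Pre → Pre → Set
  compare neq r s = r ≢ s
  compare lt  r s = r < s
  compare gt  r s = s < r
  compare le  r s = r ≤ s
  compare ge  r s = s ≤ r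

  Var : Set
  Var = ℕ

  data BinOp : Set where
    arith : ArithOp → BinOp
    div   : DivOp → BinOp
    dots  : BinOp

  data Term : Set where
    pre : Pre → Term
    var : Var → Term
    abs : Term → Term
    bin : BinOp → Term → Term → Term

  data IntervalFree : Term → Set where
    pre : ∀ r → IntervalFree (pre r)
    var : ∀ x → IntervalFree (var x)
    abs : ∀ {t} → IntervalFree t → IntervalFree (abs t)
    bin : ∀ {op t u} → op ≢ dots → IntervalFree t → IntervalFree u → IntervalFree (bin op t u)

  Atom : Set
  Atom = Symbol × List Term

  data Comparator : Set where
    eq  : Comparator
    rel : Relation → Comparator

  data Condition : Set where
    pos not notnot : Atom → Condition
    cmp            : Comparator → Term → Term → Condition

  termVars : Term → List Var
  termVars (pre r)      = []
  termVars (var x)      = x ∷ []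
  termVars (abs t)      = termVars t
  termVars (bin op t u) = termVars t ++ termVars u

  atomVars : Atom → List Var
  atomVars (p , ts) = concatMap termVars ts

  conditionVars : Condition → List Var
  conditionVars (pos A)     = atomVars A
  conditionVars (not A)     = atomVars A
  conditionVars (notnot A)  = atomVars A
  conditionVars (cmp c t u) = termVars t ++ termVars u

  record Element : Set where
    field
      X          : List Var
      L          : List Condition
      X-distinct : Unique X
      X-occurs   : All (_∈ concatMap conditionVars L) X

  data BodyElement : Set where
    cond  : Condition → BodyElement
    count : Bound → Element → (t : Term) → IntervalFree t → BodyElement

  data Head : Set where
    basic choice : Atom → Head
    constraint   : Head

  record Rule : Set where
    constructor _←_
    field
      head : Head
      body : List BodyElement

  headVars : Head → List Var
  headVars (basic A)  = atomVars A
  headVars (choice A) = atomVars A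
  headVars constraint = []

  outerVars : BodyElement → List Var
  outerVars (cond K)        = conditionVars K
  outerVars (count b E t _) = termVars t

  globals : Rule → List Var
  globals (H ← B) = deduplicate _≟_ (headVars H ++ concatMap outerVars B)

  data PureIn (gs : List Var) : BodyElement → Set where
    cond  : ∀ K → PureIn gs (cond K)
    count : ∀ {b E t f} → All (_∉ gs) (Element.X E) → PureIn gs (count b E t f)

  Pure : Rule → Set
  Pure R = All (PureIn (globals R)) (Rule.body R)

  Program : Set
  Program = List (Σ Rule Pure)

  elementVars : Element → List Var
  elementVars E = deduplicate _≟_ (concatMap conditionVars (Element.L E))

  globalsIn : List Var → Element → List Var
  globalsIn gs E = filter (_∈? gs) (elementVars E)

  localsIn : List Var → Element → List Var
  localsIn gs E = filter (λ x → ¬? (x ∈? gs) ×-dec ¬? (x ∈? Element.X E)) (elementVars E)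

  -- Substituting precomputed terms for variables is represented by carrying
  -- an assignment θ.

  Assignment : Set
  Assignment = Var → Pre

  assign : (xs : List Var) → Vec Pre (length xs) → Assignment → Assignment
  assign xs rs θ y with y ∈? xs
  ... | yes y∈xs = Vec.lookup rs (index y∈xs)
  ... | no  _    = θ y

  BinValue : BinOp → ℤ → ℤ → Pred Pre 0ℓ
  BinValue (arith op) m n r = r ≡ numeral (⟦ op ⟧ᵃ m n)
  BinValue (div quo)  m n r = Σ[ nz ∈ ℤ.NonZero n ] r ≡ numeral (quotient m n {{nz}})
  BinValue (div rem)  m n r = Σ[ nz ∈ ℤ.NonZero n ] r ≡ numeral (remainder m n {{nz}})
  BinValue dots       m n r = ∃[ k ] m ℤ.≤ k × k ℤ.≤ n × r ≡ numeral k

  -- Value t θ is the set [t] of values of the instance of t under θ.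
  Value : Term → Assignment → Pred Pre 0ℓ
  Value (pre c)      θ r = r ≡ c
  Value (var x)      θ r = r ≡ θ x
  Value (abs t)      θ r = ∃[ n ] Value t θ (numeral n) × r ≡ numeral (+ ∣ n ∣)
  Value (bin op t u) θ r =
    ∃[ m ] ∃[ n ] Value t θ (numeral m) × Value u θ (numeral n) × BinValue op m n r

  Values : List Term → Assignment → Pred (List Pre) 0ℓ
  Values ts θ rs = Pointwise (λ t r → Value t θ r) ts rs

  compareᶜ : Comparator → Pre → Pre → Set
  compareᶜ eq      r s = r ≡ s
  compareᶜ (rel c) r s = compare c r s

  τ-condition : Assignment → Condition → InfFormula PreAtom
  τ-condition θ (pos (p , ts))    = ⋁ {I = ∃ (Values ts θ)} λ (rs , _) → atomⁱ (p , rs)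
  τ-condition θ (not (p , ts))    = ⋁ {I = ∃ (Values ts θ)} λ (rs , _) → ¬ⁱ atomⁱ (p , rs)
  τ-condition θ (notnot (p , ts)) = ⋁ {I = ∃ (Values ts θ)} λ (rs , _) → ¬ⁱ ¬ⁱ atomⁱ (p , rs)
  -- ⊤ or ⊥, according to whether some values are in the relation
  τ-condition θ (cmp c t u) =
    ⋁ {I = ∃[ r ] ∃[ s ] Value t θ r × Value u θ s × compareᶜ c r s} λ _ → ⊤ⁱ

  τ-member : (gs : List Var) → Assignment → (E : Element) →
             Vec Pre (length (Element.X E)) → InfFormula PreAtom
  τ-member gs θ E xs = ⋁ λ (ws : Vec Pre (length (localsIn gs E))) →
    ⋀ᴸ (τ-condition (assign (localsIn gs E) ws (assign X xs θ))) L
    where open Element E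

  -- A finite set Δ of tuples is represented by its repetition-free
  -- enumerations.  As t is interval-free, it has at most one value; without
  -- a value, the aggregate atom is false.
  τ-body : List Var → Assignment → BodyElement → InfFormula PreAtom
  τ-body gs θ (cond K) = τ-condition θ K
  τ-body gs θ (count atLeast E t _) =
    ⋁ {I = ∃ (Value t θ)} λ (r , _) →
    ⋁ {I = Σ[ Δ ∈ List (Vec Pre (length (Element.X E))) ]
           Unique Δ × r ≤ numeral (+ length Δ)} λ (Δ , _) →
    ⋀ᴸ (τ-member gs θ E) Δ
  τ-body gs θ (count atMost E t _) =
    ⋁ {I = ∃ (Value t θ)} λ (r , _) →
    ⋀ {I = Σ[ Δ ∈ List (Vec Pre (length (Element.X E))) ]
           Unique Δ × r < numeral (+ length Δ)} λ (Δ , _) →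
    ¬ⁱ ⋀ᴸ (τ-member gs θ E) Δ

  τ-head : Assignment → Head → InfFormula PreAtom
  τ-head θ (basic (p , ts))  = ⋀ {I = ∃ (Values ts θ)} λ (rs , _) → atomⁱ (p , rs)
  τ-head θ (choice (p , ts)) =
    ⋀ {I = ∃ (Values ts θ)} λ (rs , _) → atomⁱ (p , rs) ∨ⁱ ¬ⁱ atomⁱ (p , rs)
  τ-head θ constraint        = ⊥ⁱ

  -- θ also assigns values to variables that are not global in R; these
  -- are overwritten at every occurrence of a local variable.
  τ-rule : Rule → InfFormula PreAtom
  τ-rule R@(H ← B) = ⋀ λ (θ : Assignment) → ⋀ᴸ (τ-body (globals R) θ) B ⇒ⁱ τ-head θ H

  τ : Program → InfFormula PreAtom
  τ Π = ⋀ᴸ (τ-rule ∘ proj₁) Π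

  StronglyEquivalent : ExcludedMiddle 0ℓ → Program → Program → Set₂
  StronglyEquivalent em Π₁ Π₂ =
    (Φ : Theory) → SameStableModels em (｛ τ Π₁ ｝ ∪ Φ) (｛ τ Π₂ ｝ ∪ Φ)

  -- Variables of first-order formulas are de Bruijn indices, so that formulas
  -- are identified up to renaming of bound variables.  A context counts the
  -- general and the integer variables in scope.

  data Sort : Set where
    gen int : Sort

  Ctx : Set
  Ctx = ℕ × ℕ

  ∅ : Ctx
  ∅ = 0 , 0

  dim : Ctx → Sort → ℕ
  dim Γ gen = proj₁ Γ
  dim Γ int = proj₂ Γ

  infixl 6 _▸_ _▸*_

  _▸_ : Ctx → Sort → Ctx
  Γ ▸ gen = suc (proj₁ Γ) , proj₂ Γ
  Γ ▸ int = proj₁ Γ , suc (proj₂ Γ)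

  _▸*_ : Ctx → ℕ → Ctx
  Γ ▸* k = k + proj₁ Γ , proj₂ Γ

  data Tm (Γ : Ctx) : Sort → Set where
    var   : ∀ {s} → Fin (dim Γ s) → Tm Γ s
    con   : Constant → Tm Γ gen
    int   : Tm Γ int → Tm Γ gen      -- integer is a subsort of general
    num   : ℤ → Tm Γ int
    abs   : Tm Γ int → Tm Γ int
    arith : ArithOp → Tm Γ int → Tm Γ int → Tm Γ int

  ⌈_⌉ : ∀ {Γ s} → Tm Γ s → Tm Γ gen
  ⌈_⌉ {s = gen} t = t
  ⌈_⌉ {s = int} t = int t

  preTm : ∀ {Γ} → Pre → Tm Γ gen
  preTm (numeral n)  = int (num n)
  preTm (constant c) = con c

  data Signature : Set where
    σ₀ σ₁ : Signature

  infix  22 _≈_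
  infixr 20 _∧_
  infixr 19 _∨_
  infixr 18 _⇒_

  -- count atLeast x F vs r is Atleast^{X;V}_F(vs, r), with |X| = x, |V| = v
  -- and F a formula over σ₀ whose free variables are among X, V.  The most
  -- recently bound variables of F are those of X.
  data Formula : Signature → Ctx → Set where
    pred  : ∀ {σ Γ} → Symbol → List (Tm Γ gen) → Formula σ Γ
    rel   : ∀ {σ Γ} → Relation → Tm Γ gen → Tm Γ gen → Formula σ Γ
    _≈_   : ∀ {σ Γ} → Tm Γ gen → Tm Γ gen → Formula σ Γ
    count : ∀ {Γ} → Bound → ∀ x {v} → Formula σ₀ (∅ ▸* v ▸* x) →
            Vec (Tm Γ gen) v → Tm Γ gen → Formula σ₁ Γ
    ⊥ᶠ    : ∀ {σ Γ} → Formula σ Γ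
    _∧_ _∨_ _⇒_ : ∀ {σ Γ} → Formula σ Γ → Formula σ Γ → Formula σ Γ
    all ex      : ∀ {σ Γ} s → Formula σ (Γ ▸ s) → Formula σ Γ

  module _ {σ : Signature} {Γ : Ctx} where

    infix  21 ¬_
    infixr 17 _⟺_

    ⊤ᶠ : Formula σ Γ
    ⊤ᶠ = ⊥ᶠ ⇒ ⊥ᶠ

    ¬_ : Formula σ Γ → Formula σ Γ
    ¬ F = F ⇒ ⊥ᶠ

    _⟺_ : Formula σ Γ → Formula σ Γ → Formula σ Γ
    F ⟺ G = (F ⇒ G) ∧ (G ⇒ F)

    conj disj : List (Formula σ Γ) → Formula σ Γ
    conj = foldr _∧_ ⊤ᶠ
    disj = foldr _∨_ ⊥ᶠ

  all* ex* : ∀ {σ Γ} k → Formula σ (Γ ▸* k) → Formula σ Γ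
  all* zero    F = F
  all* (suc k) F = all* k (all gen F)
  ex* zero    F = F
  ex* (suc k) F = ex* k (ex gen F)

  Ren Sub : Ctx → Ctx → Set
  Ren Γ Δ = ∀ s → Fin (dim Γ s) → Fin (dim Δ s)
  Sub Γ Δ = ∀ s → Fin (dim Γ s) → Tm Δ s

  wk : ∀ {Γ} s → Ren Γ (Γ ▸ s)
  wk gen gen = suc
  wk gen int = λ k → k
  wk int gen = λ k → k
  wk int int = suc

  wk* : ∀ {Γ} n → Ren Γ (Γ ▸* n)
  wk* n gen = n ↑ʳ_
  wk* n int = λ k → k

  ∅-ren : ∀ {Γ} → Ren ∅ Γ
  ∅-ren gen ()
  ∅-ren int ()

  liftRen : ∀ {Γ Δ} s → Ren Γ Δ → Ren (Γ ▸ s) (Δ ▸ s)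
  liftRen gen ρ gen = Fin.lift 1 (ρ gen)
  liftRen gen ρ int = ρ int
  liftRen int ρ gen = ρ gen
  liftRen int ρ int = Fin.lift 1 (ρ int)

  renTm : ∀ {Γ Δ s} → Ren Γ Δ → Tm Γ s → Tm Δ s
  renTm ρ (var {s} k)    = var {s = s} (ρ s k)
  renTm ρ (con c)        = con c
  renTm ρ (int t)        = int (renTm ρ t)
  renTm ρ (num n)        = num n
  renTm ρ (abs t)        = abs (renTm ρ t)
  renTm ρ (arith op t u) = arith op (renTm ρ t) (renTm ρ u)

  ren : ∀ {σ Γ Δ} → Ren Γ Δ → Formula σ Γ → Formula σ Δ
  ren ρ (pred p ts)        = pred p (map (renTm ρ) ts)
  ren ρ (rel c t u)        = rel c (renTm ρ t) (renTm ρ u)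
  ren ρ (t ≈ u)            = renTm ρ t ≈ renTm ρ u
  ren ρ (count b x F vs r) = count b x F (Vec.map (renTm ρ) vs) (renTm ρ r)
  ren ρ ⊥ᶠ                 = ⊥ᶠ
  ren ρ (F ∧ G)            = ren ρ F ∧ ren ρ G
  ren ρ (F ∨ G)            = ren ρ F ∨ ren ρ G
  ren ρ (F ⇒ G)            = ren ρ F ⇒ ren ρ G
  ren ρ (all s F)          = all s (ren (liftRen s ρ) F)
  ren ρ (ex s F)           = ex s (ren (liftRen s ρ) F)

  extendSub : ∀ {Γ Δ} s → Sub Γ Δ → Tm Δ s → Sub (Γ ▸ s) Δ
  extendSub gen θ t gen zero    = t
  extendSub gen θ t gen (suc k) = θ gen k
  extendSub gen θ t int k       = θ int k
  extendSub int θ t gen k       = θ gen k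
  extendSub int θ t int zero    = t
  extendSub int θ t int (suc k) = θ int k

  zeroVar : ∀ {Γ} s → Tm (Γ ▸ s) s
  zeroVar gen = var zero
  zeroVar int = var zero

  liftSub : ∀ {Γ Δ} s → Sub Γ Δ → Sub (Γ ▸ s) (Δ ▸ s)
  liftSub s θ = extendSub s (λ s′ k → renTm (wk s) (θ s′ k)) (zeroVar s)

  subTm : ∀ {Γ Δ s} → Sub Γ Δ → Tm Γ s → Tm Δ s
  subTm θ (var {s} k)    = θ s k
  subTm θ (con c)        = con c
  subTm θ (int t)        = int (subTm θ t)
  subTm θ (num n)        = num n
  subTm θ (abs t)        = abs (subTm θ t)
  subTm θ (arith op t u) = arith op (subTm θ t) (subTm θ u)

  subst : ∀ {σ Γ Δ} → Sub Γ Δ → Formula σ Γ → Formula σ Δ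
  subst θ (pred p ts)        = pred p (map (subTm θ) ts)
  subst θ (rel c t u)        = rel c (subTm θ t) (subTm θ u)
  subst θ (t ≈ u)            = subTm θ t ≈ subTm θ u
  subst θ (count b x F vs r) = count b x F (Vec.map (subTm θ) vs) (subTm θ r)
  subst θ ⊥ᶠ                 = ⊥ᶠ
  subst θ (F ∧ G)            = subst θ F ∧ subst θ G
  subst θ (F ∨ G)            = subst θ F ∨ subst θ G
  subst θ (F ⇒ G)            = subst θ F ⇒ subst θ G
  subst θ (all s F)          = all s (subst (liftSub s θ) F)
  subst θ (ex s F)           = ex s (subst (liftSub s θ) F)

  infix 30 _[_]

  _[_] : ∀ {σ Γ s} → Formula σ (Γ ▸ s) → Tm Γ s → Formula σ Γ
  F [ t ] = subst (extendSub _ (λ _ → var) t) F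

  embed : ∀ {Γ} → Formula σ₀ Γ → Formula σ₁ Γ
  embed (pred p ts) = pred p ts
  embed (rel c t u) = rel c t u
  embed (t ≈ u)     = t ≈ u
  embed ⊥ᶠ          = ⊥ᶠ
  embed (F ∧ G)     = embed F ∧ embed G
  embed (F ∨ G)     = embed F ∨ embed G
  embed (F ⇒ G)     = embed F ⇒ embed G
  embed (all s F)   = all s (embed F)
  embed (ex s F)    = ex s (embed F)

  Env : Ctx → Set
  Env Γ = Var → Tm Γ gen

  wkEnv : ∀ {Γ} s → Env Γ → Env (Γ ▸ s)
  wkEnv s ρ = renTm (wk s) ∘ ρ

  wkEnv* : ∀ {Γ} n → Env Γ → Env (Γ ▸* n)
  wkEnv* n ρ = renTm (wk* n) ∘ ρ

  -- Every variable that occurs is bound before it is looked up, so that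
  -- the value here is immaterial.
  emptyEnv : Env ∅
  emptyEnv _ = int (num 0ℤ)

  bind : ∀ {Γ} (xs : List Var) → Env Γ → Env (Γ ▸* length xs)
  bind {Γ} xs ρ y with y ∈? xs
  ... | yes y∈xs = var (index y∈xs ↑ˡ proj₁ Γ)
  ... | no  _    = wkEnv* (length xs) ρ y

  freshVars : ∀ {Γ} n → Vec (Tm (Γ ▸* n) gen) n
  freshVars {Γ} n = tabulate λ k → var (k ↑ˡ proj₁ Γ)

  -- K is the quotient of |I| by |J|; the result z is u or v, depending on
  -- the sign of I × J.
  division : ∀ {σ Γ} (I J K : Tm Γ int) (z : Tm Γ gen) (u v : Tm Γ int) → Formula σ Γ
  division I J K z u v =
    (rel le (int (arith mul K (abs J))) (int (abs I)) ∧
     rel lt (int (abs I)) (int (arith mul (arith add K (num 1ℤ)) (abs J)))) ∧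
    ((rel ge (int (arith mul I J)) (int (num 0ℤ)) ∧ z ≈ int u) ∨
     (rel lt (int (arith mul I J)) (int (num 0ℤ)) ∧ z ≈ int v))

  val : ∀ {σ Γ} → Term → Env Γ → Tm Γ gen → Formula σ Γ
  val (pre r) ρ z = z ≈ preTm r
  val (var x) ρ z = z ≈ ρ x
  val (abs t) ρ z = ex int (val t (wkEnv int ρ) (int I) ∧ renTm (wk int) z ≈ int (abs I))
    where I = var 0F
  val (bin (arith op) t u) ρ z =
    ex int (ex int (val t ρ′ (int I) ∧ val u ρ′ (int J) ∧ z′ ≈ int (arith op I J)))
    where
    I  = var 1F
    J  = var 0F
    ρ′ = wkEnv int (wkEnv int ρ)
    z′ = renTm (wk int) (renTm (wk int) z)
  val {σ} {Γ} (bin (div op) t u) ρ z =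
    ex int (ex int (ex int (val t ρ′ (int I) ∧ val u ρ′ (int J) ∧ result op)))
    where
    Γ′ = Γ ▸ int ▸ int ▸ int
    I J K : Tm Γ′ int
    I  = var 2F
    J  = var 1F
    K  = var 0F
    ρ′ = wkEnv int (wkEnv int (wkEnv int ρ))
    z′ = renTm (wk int) (renTm (wk int) (renTm (wk int) z))
    -- σ₀ has no unary minus; -K is 0 - K.
    result : DivOp → Formula σ Γ′
    result quo = division I J K z′ K (arith sub (num 0ℤ) K)
    result rem = division I J K z′ (arith sub I (arith mul K J)) (arith add I (arith mul K J))
  val (bin dots t u) ρ z =
    ex int (ex int (ex int (val t ρ′ (int I) ∧ val u ρ′ (int J) ∧
      (rel le (int I) (int K) ∧ rel le (int K) (int J)) ∧ z′ ≈ int K)))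
    where
    I  = var 2F
    J  = var 1F
    K  = var 0F
    ρ′ = wkEnv int (wkEnv int (wkEnv int ρ))
    z′ = renTm (wk int) (renTm (wk int) (renTm (wk int) z))

  vals : ∀ {σ Γ} (ts : List Term) → Env Γ → Vec (Tm Γ gen) (length ts) → Formula σ Γ
  vals []       ρ []       = ⊤ᶠ
  vals (t ∷ ts) ρ (z ∷ zs) = val t ρ z ∧ vals ts ρ zs

  comparison : ∀ {σ Γ} → Comparator → Tm Γ gen → Tm Γ gen → Formula σ Γ
  comparison eq      t u = t ≈ u
  comparison (rel c) t u = rel c t u

  withValues : ∀ {σ Γ} (ts : List Term) → Env Γ →
               (List (Tm (Γ ▸* length ts) gen) → Formula σ (Γ ▸* length ts)) → Formula σ Γ
  withValues ts ρ F = ex* n (vals ts (wkEnv* n ρ) (freshVars n) ∧ F (toList (freshVars n)))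
    where n = length ts

  τᴮ : ∀ {σ Γ} → Env Γ → Condition → Formula σ Γ
  τᴮ ρ (pos (p , ts))    = withValues ts ρ λ zs → pred p zs
  τᴮ ρ (not (p , ts))    = withValues ts ρ λ zs → ¬ pred p zs
  τᴮ ρ (notnot (p , ts)) = withValues ts ρ λ zs → ¬ ¬ pred p zs
  τᴮ ρ (cmp c t u)       =
    ex gen (ex gen (val t ρ′ z₁ ∧ val u ρ′ z₂ ∧ comparison c z₁ z₂))
    where
    z₁ = var 1F
    z₂ = var 0F
    ρ′ = wkEnv gen (wkEnv gen ρ)

  body* : ∀ {Γ} → List Var → Env Γ → BodyElement → Formula σ₁ Γ
  body* gs ρ (cond K)        = τᴮ ρ K
  body* gs ρ (count b E t _) =
    ex gen (val t (wkEnv gen ρ) C ∧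
            count b (length X) F (Vec.map (wkEnv gen ρ) (fromList V)) C)
    where
    open Element E
    C = var 0F
    V = globalsIn gs E
    W = localsIn gs E
    F = ex* (length W) (conj (map (τᴮ (bind W (bind X (bind V emptyEnv)))) L))

  rule* : Rule → Formula σ₁ ∅
  rule* R@(H ← B) = all* (length (globals R)) (closed H)
    where
    Γ : Ctx
    Γ = ∅ ▸* length (globals R)
    ρ : Env Γ
    ρ = bind (globals R) emptyEnv
    bodies : ∀ {Δ} → Env Δ → Formula σ₁ Δ
    bodies ρ′ = conj (map (body* (globals R) ρ′) B)
    headed : (ts : List Term) →
             (List (Tm (Γ ▸* length ts) gen) → Formula σ₁ (Γ ▸* length ts)) → Formula σ₁ Γ
    headed ts G = all* n
      (bodies (wkEnv* n ρ) ∧ vals ts (wkEnv* n ρ) (freshVars n) ⇒ G (toList (freshVars n)))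
      where n = length ts
    closed : Head → Formula σ₁ Γ
    closed (basic (p , ts))  = headed ts λ zs → pred p zs
    closed (choice (p , ts)) = headed ts λ zs → pred p zs ∨ ¬ pred p zs
    closed constraint        = ¬ bodies ρ

  τ* : Program → Formula σ₁ ∅
  τ* Π = conj (map (rule* ∘ proj₁) Π)

  Dom : Sort → Set
  Dom gen = Pre
  Dom int = ℤ

  Valuation : Ctx → Set
  Valuation Γ = ∀ s → Fin (dim Γ s) → Dom s

  emptyValuation : Valuation ∅
  emptyValuation gen ()
  emptyValuation int ()

  extend : ∀ {Γ} s → Valuation Γ → Dom s → Valuation (Γ ▸ s)
  extend gen η d gen zero    = d
  extend gen η d gen (suc k) = η gen k
  extend gen η d int k       = η int k
  extend int η d gen k       = η gen k
  extend int η d int zero    = d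
  extend int η d int (suc k) = η int k

  ⟦_⟧ : ∀ {Γ s} → Tm Γ s → Valuation Γ → Dom s
  ⟦ var {s} k ⟧    η = η s k
  ⟦ con c ⟧        η = constant c
  ⟦ int t ⟧        η = numeral (⟦ t ⟧ η)
  ⟦ num n ⟧        η = n
  ⟦ abs t ⟧        η = + ∣ ⟦ t ⟧ η ∣
  ⟦ arith op t u ⟧ η = ⟦ op ⟧ᵃ (⟦ t ⟧ η) (⟦ u ⟧ η)

  -- Satisfaction in the standard interpretation that interprets the
  -- symbols p/n by I.
  Sat : ∀ {Γ} → Pred PreAtom 0ℓ → Formula σ₀ Γ → Valuation Γ → Set
  Sat I (pred p ts) η = I (p , map (λ t → ⟦ t ⟧ η) ts)
  Sat I (rel c t u) η = compare c (⟦ t ⟧ η) (⟦ u ⟧ η)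
  Sat I (t ≈ u)     η = ⟦ t ⟧ η ≡ ⟦ u ⟧ η
  Sat I ⊥ᶠ          η = ⊥
  Sat I (F ∧ G)     η = Sat I F η × Sat I G η
  Sat I (F ∨ G)     η = Sat I F η ⊎ Sat I G η
  Sat I (F ⇒ G)     η = Sat I F η → Sat I G η
  Sat I (all s F)   η = ∀ d → Sat I F (extend s η d)
  Sat I (ex s F)    η = ∃[ d ] Sat I F (extend s η d)

  NoPred : ∀ {Γ} → Formula σ₀ Γ → Set
  NoPred (pred p ts) = ⊥
  NoPred (rel c t u) = ⊤
  NoPred (t ≈ u)     = ⊤
  NoPred ⊥ᶠ          = ⊤
  NoPred (F ∧ G)     = NoPred F × NoPred G
  NoPred (F ∨ G)     = NoPred F × NoPred G
  NoPred (F ⇒ G)     = NoPred F × NoPred G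
  NoPred (all s F)   = NoPred F
  NoPred (ex s F)    = NoPred F

  Std : Pred (Formula σ₀ ∅) (lsuc 0ℓ)
  Std F = NoPred F × (∀ I → Sat I F emptyValuation)

  -- The j-th variable of the i-th of n disjoint tuples of x variables.
  copyVar : ∀ {Γ n x} → Fin n → Fin x → Fin (dim (Γ ▸* (n * x)) gen)
  copyVar {Γ} i j = combine i j ↑ˡ proj₁ Γ

  copyRen : ∀ {Γ n} x → Fin n → Ren (Γ ▸* x) (Γ ▸* (n * x))
  copyRen {Γ} {n} x i gen k = [ copyVar {Γ} i , (n * x) ↑ʳ_ ]′ (splitAt x k)
  copyRen         x i int k = k

  copies : ∀ {Γ} n x → Formula σ₀ (Γ ▸* x) → Formula σ₀ (Γ ▸* (n * x))
  copies n x F = conj (map (λ i → ren (copyRen x i) F) (allFin n))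

  sameTuple : ∀ {Γ} n x → Fin n × Fin n → Formula σ₀ (Γ ▸* (n * x))
  sameTuple {Γ} n x (i , j) =
    conj (map (λ k → var (copyVar {Γ} i k) ≈ var (copyVar {Γ} j k)) (allFin x))

  pairs : ∀ n → List (Fin n × Fin n)
  pairs n = filter (λ (i , j) → i <? j) (cartesianProduct (allFin n) (allFin n))

  atLeastF : ∀ {Γ} n x → Formula σ₀ (Γ ▸* x) → Formula σ₀ Γ
  atLeastF n x F = ex* (n * x) (copies n x F ∧ conj (map (λ p → ¬ sameTuple n x p) (pairs n)))

  atMostF : ∀ {Γ} n x → Formula σ₀ (Γ ▸* x) → Formula σ₀ Γ
  atMostF n x F =
    all* (suc n * x) (copies (suc n) x F ⇒ disj (map (sameTuple (suc n) x) (pairs (suc n))))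

  AboveNumerals : Pred Pre 0ℓ
  AboveNumerals r = ∀ n → numeral n < r

  -- CountDef b x F r G: G is the formula ∃_{≥r} X F (if b = atLeast) or
  -- ∃_{≤r} X F (if b = atMost).
  data CountDef {Γ : Ctx} : (b : Bound) (x : ℕ) → Formula σ₀ (Γ ▸* x) → Pre → Formula σ₀ Γ → Set where
    ≥-positive    : ∀ {x F} n → CountDef atLeast x F (numeral +[1+ n ]) (atLeastF (suc n) x F)
    ≥-nonpositive : ∀ {x F r} → r ≤ numeral 0ℤ → CountDef atLeast x F r ⊤ᶠ
    ≥-above       : ∀ {x F r} → AboveNumerals r → CountDef atLeast x F r ⊥ᶠ
    ≤-nonnegative : ∀ {x F} n → CountDef atMost x F (numeral (+ n)) (atMostF n x F)
    ≤-negative    : ∀ {x F r} → r < numeral 0ℤ → CountDef atMost x F r ⊥ᶠ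
    ≤-above       : ∀ {x F r} → AboveNumerals r → CountDef atMost x F r ⊤ᶠ

  data Defs : Pred (Formula σ₁ ∅) 0ℓ where
    def : ∀ {b x v F r G} → CountDef {∅ ▸* v} b x F r G →
          Defs (all* v (count b x F (freshVars v) (preTm r) ⟺ embed G))

  -- Only membership in the list on the left of a sequent matters, so that
  -- lists stand for finite sets.

  infix 3 _⊢_

  data _⊢_ : ∀ {Γ} → List (Formula σ₁ Γ) → Formula σ₁ Γ → Set₁ where
    assume : ∀ {Γ} {Θ : List (Formula σ₁ Γ)} {F} → F ∈ Θ → Θ ⊢ F
    ⊥E     : ∀ {Γ} {Θ : List (Formula σ₁ Γ)} {F} → Θ ⊢ ⊥ᶠ → Θ ⊢ F
    ∧I     : ∀ {Γ} {Θ : List (Formula σ₁ Γ)} {F G} → Θ ⊢ F → Θ ⊢ G → Θ ⊢ F ∧ G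
    ∧E₁    : ∀ {Γ} {Θ : List (Formula σ₁ Γ)} {F G} → Θ ⊢ F ∧ G → Θ ⊢ F
    ∧E₂    : ∀ {Γ} {Θ : List (Formula σ₁ Γ)} {F G} → Θ ⊢ F ∧ G → Θ ⊢ G
    ∨I₁    : ∀ {Γ} {Θ : List (Formula σ₁ Γ)} {F G} → Θ ⊢ F → Θ ⊢ F ∨ G
    ∨I₂    : ∀ {Γ} {Θ : List (Formula σ₁ Γ)} {F G} → Θ ⊢ G → Θ ⊢ F ∨ G
    ∨E     : ∀ {Γ} {Θ : List (Formula σ₁ Γ)} {F G H} →
             Θ ⊢ F ∨ G → F ∷ Θ ⊢ H → G ∷ Θ ⊢ H → Θ ⊢ H
    ⇒I     : ∀ {Γ} {Θ : List (Formula σ₁ Γ)} {F G} → F ∷ Θ ⊢ G → Θ ⊢ F ⇒ G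
    ⇒E     : ∀ {Γ} {Θ : List (Formula σ₁ Γ)} {F G} → Θ ⊢ F ⇒ G → Θ ⊢ F → Θ ⊢ G
    ∀I     : ∀ {Γ} {Θ : List (Formula σ₁ Γ)} s {F} → map (ren (wk s)) Θ ⊢ F → Θ ⊢ all s F
    ∀E     : ∀ {Γ} {Θ : List (Formula σ₁ Γ)} {s F} → Θ ⊢ all s F → ∀ t → Θ ⊢ F [ t ]
    ∃I     : ∀ {Γ} {Θ : List (Formula σ₁ Γ)} {s F} t → Θ ⊢ F [ t ] → Θ ⊢ ex s F
    ∃E     : ∀ {Γ} {Θ : List (Formula σ₁ Γ)} {s F G} →
             Θ ⊢ ex s F → F ∷ map (ren (wk s)) Θ ⊢ ren (wk s) G → Θ ⊢ G
    ≈I     : ∀ {Γ} {Θ : List (Formula σ₁ Γ)} t → Θ ⊢ t ≈ t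
    ≈E     : ∀ {Γ} {Θ : List (Formula σ₁ Γ)} {s} (F : Formula σ₁ (Γ ▸ s)) {t u : Tm Γ s} →
             Θ ⊢ ⌈ t ⌉ ≈ ⌈ u ⌉ → Θ ⊢ F [ t ] → Θ ⊢ F [ u ]

    hosoi  : ∀ {Γ} {Θ : List (Formula σ₁ Γ)} F G → Θ ⊢ F ∨ (F ⇒ G) ∨ ¬ G
    sqht   : ∀ {Γ} {Θ : List (Formula σ₁ Γ)} s F →
             Θ ⊢ ex s (F ⇒ ren (wk s) (all s F))
    std    : ∀ {Γ} {Θ : List (Formula σ₁ Γ)} F → Std F → Θ ⊢ ren ∅-ren (embed F)
    defs   : ∀ {Γ} {Θ : List (Formula σ₁ Γ)} F → Defs F → Θ ⊢ ren ∅-ren F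

    ω-gen  : ∀ {Γ} {Θ : List (Formula σ₁ Γ)} {F} →
             (∀ r → Θ ⊢ F [ preTm r ]) → Θ ⊢ all gen F
    ω-int  : ∀ {Γ} {Θ : List (Formula σ₁ Γ)} {F} →
             (∀ n → Θ ⊢ F [ num n ]) → Θ ⊢ all int F

  Provable : Formula σ₁ ∅ → Set₁
  Provable F = [] ⊢ F

{-# OPTIONS --safe #-}

-- Both sides of the equivalence say that the two programs have the same
-- here-and-there models over the standard domains.
--
-- For strong equivalence: (J , I) is a here-and-there model of F if and only
-- if J satisfies the reduct of F by I.  If (J , I) is a model of the first
-- program only, then a set of atoms and of implications between atoms
-- separates the programs.
--
-- For provability: the calculus is sound for these models.  Conversely, if F₀
-- is not provable, go through the countably many sentences G and add to the
-- axioms, as long as F₀ remains unprovable, either G (with an instance, if G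
-- is existential) or, if G entails F₀ and G = ∀x A, an implication A(d) → F₀.
-- The ω-rules and the axiom ∃x(A → ∀x A) guarantee that this is possible.  In
-- the limit T, the atoms of T and the atoms whose negation is not in T form a
-- here-and-there model of T in which F₀ fails.

module Submission where

open import Defs
open import Axiom.ExcludedMiddle using (ExcludedMiddle)
open import Data.Bool.Base using (true; false)
open import Data.Empty using (⊥; ⊥-elim)
open import Data.Fin.Base as Fin using (Fin; zero; suc; _↑ˡ_)
import Data.Fin.Properties as Fin
open import Data.Integer.Base as ℤ using (ℤ; +_; +[1+_]; -[1+_]; 0ℤ; 1ℤ; ∣_∣; sign; _◃_)
import Data.Integer.Properties as ℤ
open import Data.List.Base as List
  using (List; []; _∷_; _++_; concatMap; length; lookup; map; allFin)
open import Data.List.Membership.Propositional using (_∈_; _∉_; lose)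
open import Data.List.Membership.Propositional.Properties
  using (∈-lookup; ∈-allFin; ∈-filter⁺; ∈-filter⁻; ∈-cartesianProduct⁺; ∈-++⁺ˡ; ∈-++⁺ʳ;
         ∈-concatMap⁺; ∈-deduplicate⁺)
import Data.List.Properties as List
open import Data.List.Relation.Binary.Pointwise using ([]; _∷_)
open import Data.List.Relation.Binary.Subset.Propositional using () renaming (_⊆_ to _⊆ᴸ_)
open import Data.List.Relation.Binary.Subset.Propositional.Properties using (map⁺; ∷⁺ʳ)
open import Data.List.Relation.Unary.All as All using (All; []; _∷_)
import Data.List.Relation.Unary.All.Properties as All
open import Data.List.Relation.Unary.AllPairs using (AllPairs; []; _∷_)
import Data.List.Relation.Unary.AllPairs.Properties as AllPairs
open import Data.List.Relation.Unary.Any using (here; there; index)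
open import Data.List.Relation.Unary.Any.Properties using (lookup-index)
open import Data.List.Relation.Unary.Unique.Propositional using (Unique)
open import Data.Nat.Base as ℕ using (ℕ; zero; suc; _⊔_)
import Data.Nat.DivMod as ℕ
import Data.Nat.Properties as ℕ
open import Data.List.Membership.DecPropositional ℕ._≟_ using (_∈?_)
open import Data.Product.Base using (Σ; ∃; ∃-syntax; Σ-syntax; _×_; _,_; proj₁; proj₂; uncurry)
open import Data.Product.Function.NonDependent.Propositional using (_×-⇔_)
open import Data.Sign.Base as Sign using ()
open import Data.Sum.Base using (_⊎_; inj₁; inj₂)
open import Data.Sum.Function.Propositional using (_⊎-⇔_)
open import Data.Unit.Base using (tt)
import Data.Unit.Polymorphic.Base as Polymorphic
open import Data.Vec.Base as Vec using (Vec; []; _∷_; toList; fromList)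
import Data.Vec.Properties as Vec
open import Function.Base using (_∘_; id)
open import Function.Bundles using (_⇔_; mk⇔; Equivalence; Injection)
open import Function.Construct.Composition using (_⇔-∘_)
open import Function.Construct.Identity using (⇔-id)
open import Function.Construct.Symmetry using (⇔-sym)
open import Function.Definitions using (StrictlySurjective)
open import Level using (Level; 0ℓ)
open import Relation.Binary.Core using (Rel)
open import Relation.Binary.PropositionalEquality
  using (_≡_; _≢_; refl; sym; trans; cong; cong₂; module ≡-Reasoning)
  renaming (subst to transport)
open import Relation.Binary.Structures using (IsTotalOrder)
open import Relation.Nullary.Decidable.Core
  using (Dec; yes; no; ¬?; _×-dec_; decidable-stable; True; toWitness; fromWitness)
open import Relation.Nullary.Negation.Core using () renaming (¬_ to Not)
open import Relation.Unary using (Pred; _⊆_; _∪_; ｛_｝)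

open Equivalence using (to; from)

-- The ω-rules have infinitely many premises, so the calculus is not compact: `F₀` may follow from
-- the union of a chain of lists none of which proves it. Hence each stage is a finite list, and `T`
-- contains only what some stage proves. Countability of the language lets every sentence be handled
-- at a finite stage.
--
-- Rejection by `G → F₀` instead of `¬ G` is due to intuitionistic logic: a sentence that cannot be
-- added need not be refutable. It makes `T` prime and keeps `F₀` out, but says little about the
-- upper world. That world consists of the sentences whose negation is outside `T`; the Hosoi axiom
-- makes them a classical theory and ties the two worlds together.
--
-- Count formulas obstruct the induction in the truth lemma, because their definitions are not
-- subformulas. Since the counted formulas are over `σ₀`, which has no count symbols, the induction
-- can be run for those definitions before it is run for all formulas.

private variable
  ℓ₁ ℓ₂ ℓ₃ ℓ₄ : Level

-- Equivalences and list membership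

Π-⇔ : {A : Set ℓ₁} {B : A → Set ℓ₂} {C : A → Set ℓ₃} → (∀ x → B x ⇔ C x) → (∀ x → B x) ⇔ (∀ x → C x)
Π-⇔ e = mk⇔ (λ f x → to (e x) (f x)) (λ f x → from (e x) (f x))

∃-⇔ : {A : Set ℓ₁} {B : A → Set ℓ₂} {C : A → Set ℓ₃} → (∀ x → B x ⇔ C x) → ∃ B ⇔ ∃ C
∃-⇔ e = mk⇔ (λ (x , y) → x , to (e x) y) (λ (x , y) → x , from (e x) y)

≡⇒⇔ : {A B : Set ℓ₁} → A ≡ B → A ⇔ B
≡⇒⇔ refl = ⇔-id _

→-⇔ : {A : Set ℓ₁} {B : Set ℓ₂} {C : Set ℓ₃} {D : Set ℓ₄} → A ⇔ B → C ⇔ D → (A → C) ⇔ (B → D)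
→-⇔ e f = mk⇔ (λ h x → to f (h (from e x))) (λ h x → from f (h (to e x)))

-- The translations of division and intervals quantify the third integer variable outside the
-- operands, whose values do not depend on it; `Value` confines it to the result.
∃-×-⇔ : ∀ {D : Set} {A B C : D → Set} {A′ B′ C′ : Set} →
        (∀ d → A d ⇔ A′) → (∀ d → B d ⇔ B′) → ∃ C ⇔ C′ →
        (∃[ d ] A d × B d × C d) ⇔ (A′ × B′ × C′)
∃-×-⇔ e f g = mk⇔
  (λ (d , a , b , c) → to (e d) a , to (f d) b , to g (d , c))
  (λ (a , b , c) → let d , c′ = from g c in d , from (e d) a , from (f d) b , c′)

-- Conjunctions are unfolded by membership for `conj` and by position for `⋀ᴸ`; this passes between
-- the two.
∀∈⇔∀lookup : {A : Set} {xs : List A} {B : A → Set} →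
             (∀ {x} → x ∈ xs → B x) ⇔ (∀ k → B (lookup xs k))
∀∈⇔∀lookup {B = B} =
  mk⇔ (λ h k → h (∈-lookup k))
    (λ h {_} x∈xs → transport B (sym (lookup-index x∈xs)) (h (index x∈xs)))

lookup-fromList : {A : Set} (xs : List A) (k : Fin (length xs)) →
                  Vec.lookup (fromList xs) k ≡ lookup xs k
lookup-fromList (x ∷ xs) zero    = refl
lookup-fromList (x ∷ xs) (suc k) = lookup-fromList xs k

∈-concatMap : {A B : Set} (f : A → List B) {x : A} {xs : List A} {y : B} → x ∈ xs → y ∈ f x →
              y ∈ concatMap f xs
∈-concatMap f x∈xs y∈fx = ∈-concatMap⁺ f (lose x∈xs y∈fx)

-- The frame of two worlds

data World : Set where
  here there : World

infix 4 _≼_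

data _≼_ : Rel World 0ℓ where
  ≼-refl     : ∀ {w} → w ≼ w
  here≼there : here ≼ there

≼-trans : ∀ {u v w} → u ≼ v → v ≼ w → u ≼ w
≼-trans ≼-refl     v≼w    = v≼w
≼-trans here≼there ≼-refl = here≼there

≼-there : ∀ {w} → w ≼ there
≼-there {here}  = here≼there
≼-there {there} = ≼-refl

Upwards : (World → Set ℓ₁) → World → Set ℓ₁
Upwards A w = ∀ {v} → w ≼ v → A v

Upwards-⇔ : {A : World → Set ℓ₁} {B : World → Set ℓ₂} → (∀ v → A v ⇔ B v) →
            ∀ w → Upwards A w ⇔ Upwards B w
Upwards-⇔ e w = mk⇔ (λ f {v} w≼v → to (e v) (f w≼v)) (λ f {v} w≼v → from (e v) (f w≼v))

⇒-⇔ : {A : World → Set ℓ₁} {A′ : World → Set ℓ₂} {B : World → Set ℓ₃} {B′ : World → Set ℓ₄} →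
      (∀ v → A v ⇔ A′ v) → (∀ v → B v ⇔ B′ v) →
      ∀ w → Upwards (λ v → A v → B v) w ⇔ Upwards (λ v → A′ v → B′ v) w
⇒-⇔ e f = Upwards-⇔ (λ v → →-⇔ (e v) (f v))

-- Encoding m tuples of length x as one tuple of length m * x

tuple : ∀ {A : Set} {m x} → Vec A (m ℕ.* x) → Fin m → Vec A x
tuple ds i = Vec.tabulate λ j → Vec.lookup ds (Fin.combine i j)

untuple : ∀ {A : Set} {m x} → (Fin m → Vec A x) → Vec A (m ℕ.* x)
untuple {m = m} {x} f = Vec.tabulate λ k → uncurry (λ i → Vec.lookup (f i)) (Fin.remQuot {m} x k)

tuple-untuple : ∀ {A : Set} {m x} (f : Fin m → Vec A x) i → tuple (untuple f) i ≡ f i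
tuple-untuple {m = m} {x} f i = trans
  (Vec.tabulate-cong λ j → trans (Vec.lookup∘tabulate _ (Fin.combine i j))
    (cong (uncurry λ i → Vec.lookup (f i)) (Fin.remQuot-combine i j)))
  (Vec.tabulate∘lookup (f i))

-- Only positions `i < j` are compared, as in `pairs` and in `AllPairs`, so that no symmetry
-- argument is needed.
Distinct : ∀ {A : Set} {m} → (Fin m → A) → Set
Distinct f = ∀ {i j} → i Fin.< j → f i ≢ f j

AllPairs-lookup : ∀ {A : Set} {R : Rel A 0ℓ} {xs} → AllPairs R xs →
                  ∀ {i j} → i Fin.< j → R (lookup xs i) (lookup xs j)
AllPairs-lookup (px ∷ pxs) {zero}  {suc j} i<j = All.lookup px (∈-lookup j)
AllPairs-lookup (px ∷ pxs) {suc i} {suc j} i<j = AllPairs-lookup pxs (ℕ.s<s⁻¹ i<j)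

list-of-family : ∀ {A : Set} {S : A → Set} {m} {f : Fin m → A} → Distinct f → (∀ i → S (f i)) →
                 ∃[ Δ ] Unique Δ × length Δ ≡ m × (∀ k → S (lookup Δ k))
list-of-family {S = S} {f = f} distinct holds =
  List.tabulate f , AllPairs.tabulate⁺-< distinct , List.length-tabulate f ,
  λ k → All.lookup {P = S} (All.tabulate⁺ holds) (∈-lookup {xs = List.tabulate f} k)

-- The definition of `Atleast` mentions exactly `m` tuples, while a list that witnesses the bound
-- may be longer: its first `m` members suffice.
tuples-of-list : ∀ {A : Set} {x m} {S : Vec A x → Set} {Δ} → Unique Δ → m ℕ.≤ length Δ →
                 (∀ k → S (lookup Δ k)) →
                 ∃[ ds ] Distinct (tuple {m = m} ds) × (∀ i → S (tuple {m = m} ds i))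
tuples-of-list {m = m} {S} {Δ} unique m≤ holds =
  untuple f , distinct , λ i → transport S (sym (tuple-untuple f i)) (holds _)
  where
  f : Fin m → _
  f i = lookup Δ (Fin.inject≤ i m≤)
  distinct : Distinct (tuple {m = m} (untuple f))
  distinct {i} {j} i<j e = AllPairs-lookup unique
    (transport id (cong₂ ℕ._<_ (sym (Fin.toℕ-inject≤ i m≤)) (sym (Fin.toℕ-inject≤ j m≤))) i<j)
    (trans (sym (tuple-untuple f i)) (trans e (tuple-untuple f j)))

-- Integer division

-- The bounds exclude division by zero on their own: for `b = 0` the upper one reads `a < 0`. They
-- also exclude a negative `k`, for which the upper bound would be at most 0. Otherwise they
-- characterize the integer part of `a / b`.
quotient-bounds : ∀ {a b k} → k ℤ.* + b ℤ.≤ + a → + a ℤ.< (k ℤ.+ 1ℤ) ℤ.* + b →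
                  Σ[ nz ∈ ℕ.NonZero b ] k ≡ + ((a ℕ./ b) {{nz}})
quotient-bounds {a} {b} {+ q} lower upper = nonZero , cong +_ (ℕ.≤-antisym q≤ ≤q)
  where
  lower′ : q ℕ.* b ℕ.≤ a
  lower′ = ℤ.drop‿+≤+ (transport (ℤ._≤ + a) (sym (ℤ.pos-* q b)) lower)
  upper′ : a ℕ.< (q ℕ.+ 1) ℕ.* b
  upper′ = ℤ.drop‿+<+ (transport (+ a ℤ.<_) (sym (ℤ.pos-* (q ℕ.+ 1) b)) upper)
  nonZero : ℕ.NonZero b
  nonZero = ℕ.≢-nonZero λ { refl → ℕ.n≮0 (transport (a ℕ.<_) (ℕ.*-zeroʳ (q ℕ.+ 1)) upper′) }
  instance _ = nonZero
  q≤ : q ℕ.≤ a ℕ./ b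
  q≤ = transport (ℕ._≤ a ℕ./ b) (ℕ.m*n/n≡m q b) (ℕ./-monoˡ-≤ b lower′)
  ≤q : a ℕ./ b ℕ.≤ q
  ≤q = ℕ.s≤s⁻¹ (transport (a ℕ./ b ℕ.<_) (ℕ.+-comm q 1) (ℕ.m<n*o⇒m/o<n upper′))
quotient-bounds {a} {b} { -[1+ j ]} lower upper =
  ⊥-elim (ℤ.<⇒≱ (ℤ.<-≤-trans upper (k+1≤0 j)) (ℤ.+≤+ ℕ.z≤n))
  where
  k+1≤0 : ∀ j → (-[1+ j ] ℤ.+ 1ℤ) ℤ.* + b ℤ.≤ 0ℤ
  k+1≤0 zero    = ℤ.≤-reflexive (ℤ.*-zeroˡ (+ b))
  k+1≤0 (suc j) =
    ℤ.≤-trans (ℤ.*-monoʳ-≤-nonNeg (+ b) (ℤ.-≤+ { j} {0})) (ℤ.≤-reflexive (ℤ.*-zeroˡ (+ b)))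

quotient-bounds⁻ : ∀ a b .{{_ : ℕ.NonZero b}} →
                   (+ (a ℕ./ b) ℤ.* + b ℤ.≤ + a) × (+ a ℤ.< (+ (a ℕ./ b) ℤ.+ 1ℤ) ℤ.* + b)
quotient-bounds⁻ a b =
  transport (ℤ._≤ + a) (ℤ.pos-* q b) (ℤ.+≤+ (ℕ.m/n*n≤m a b)) ,
  transport (+ a ℤ.<_) (ℤ.pos-* (q ℕ.+ 1) b) (ℤ.+<+ upper)
  where
  q = a ℕ./ b
  upper : a ℕ.< (q ℕ.+ 1) ℕ.* b
  upper = begin-strict
    a                      ≡⟨ ℕ.m≡m%n+[m/n]*n a b ⟩
    a ℕ.% b ℕ.+ q ℕ.* b    <⟨ ℕ.+-monoˡ-< (q ℕ.* b) (ℕ.m%n<n a b) ⟩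
    suc q ℕ.* b            ≡⟨ cong (ℕ._* b) (ℕ.+-comm 1 q) ⟩
    (q ℕ.+ 1) ℕ.* b        ∎
    where open ℕ.≤-Reasoning

-- Product and quotient carry the same sign by definition, hence the generalization to a sign `s`
-- and absolute values. A negative sign is compatible with a nonnegative product only if `a` is
-- zero, as `b` is not.
quotient-nonNeg : ∀ m n .{{_ : ℤ.NonZero n}} → 0ℤ ℤ.≤ m ℤ.* n → quotient m n ≡ + (∣ m ∣ ℕ./ ∣ n ∣)
quotient-nonNeg m n = lemma (sign m Sign.* sign n) ∣ m ∣ ∣ n ∣
  where
  lemma : ∀ s a b .{{_ : ℕ.NonZero b}} → 0ℤ ℤ.≤ s ◃ (a ℕ.* b) → s ◃ (a ℕ./ b) ≡ + (a ℕ./ b)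
  lemma Sign.+ a       b       _ = ℤ.+◃n≡+n _
  lemma Sign.- zero    b       _ = trans (cong (Sign.- ◃_) (ℕ.0/n≡0 b)) (cong +_ (sym (ℕ.0/n≡0 b)))
  lemma Sign.- (suc a) (suc b) ()

quotient-neg : ∀ m n .{{_ : ℤ.NonZero n}} → m ℤ.* n ℤ.< 0ℤ → quotient m n ≡ ℤ.- + (∣ m ∣ ℕ./ ∣ n ∣)
quotient-neg m n = lemma (sign m Sign.* sign n) ∣ m ∣ ∣ n ∣
  where
  lemma : ∀ s a b .{{_ : ℕ.NonZero b}} → s ◃ (a ℕ.* b) ℤ.< 0ℤ → s ◃ (a ℕ./ b) ≡ ℤ.- + (a ℕ./ b)
  lemma Sign.+ a b h =
    ⊥-elim (ℤ.<⇒≱ h (transport (0ℤ ℤ.≤_) (sym (ℤ.+◃n≡+n (a ℕ.* b))) (ℤ.+≤+ ℕ.z≤n)))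
  lemma Sign.- a b _ = ℤ.-◃n≡-n _

-- Countability

next : ℕ × ℕ → ℕ × ℕ
next (zero  , b) = suc b , zero
next (suc a , b) = a , suc b

-- Cantor's enumeration, along the antidiagonals
unpair : ℕ → ℕ × ℕ
unpair zero    = zero , zero
unpair (suc n) = next (unpair n)

unpair-surjective : StrictlySurjective _≡_ unpair
unpair-surjective (a , b) = reach (a ℕ.+ b) a b refl
  where
  -- Recursion is on the antidiagonal `s`, then on `b`: `(suc a , b)` precedes `(a , suc b)`, and
  -- the predecessor of `(suc a , 0)` is the end `(0 , a)` of the previous antidiagonal.
  reach : ∀ s a b → a ℕ.+ b ≡ s → ∃[ n ] unpair n ≡ (a , b)
  reach s       a       (suc b) e =
    let n , h = reach s (suc a) b (trans (sym (ℕ.+-suc a b)) e) in suc n , cong next h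
  reach zero    zero    zero    e = zero , refl
  reach (suc s) (suc a) zero    e =
    let n , h = reach s zero s refl
    in suc n , trans (cong next h) (cong (λ k → k , zero)
                 (trans (sym e) (cong suc (ℕ.+-identityʳ a))))

-- Syntax is decoded from trees and not directly from numbers: the decoders are then structurally
-- recursive, and only this type has to be enumerated by hand.
data Tree : Set where
  leaf : ℕ → Tree
  _∙_  : Tree → Tree → Tree

branch : (ℕ → Tree) → ℕ × ℕ → Tree
branch f (zero  , n) = leaf n
branch f (suc _ , n) = f (proj₁ (unpair n)) ∙ f (proj₂ (unpair n))

-- The bound on the depth is the fuel of the recursion, and `tree` reads it off the code itself. In
-- `branch` the tag zero announces a leaf, any other tag a node.
treeOfDepth : ℕ → ℕ → Tree
treeOfDepth zero    n = leaf n
treeOfDepth (suc k) n = branch (treeOfDepth k) (unpair n)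

depth : Tree → ℕ
depth (leaf n) = zero
depth (t ∙ u)  = suc (depth t ⊔ depth u)

treeOfDepth-surjective : ∀ t k → depth t ℕ.≤ k → ∃[ n ] treeOfDepth k n ≡ t
treeOfDepth-surjective (leaf n) zero    _ = n , refl
treeOfDepth-surjective (leaf n) (suc k) _ =
  let m , h = unpair-surjective (0 , n) in m , cong (branch (treeOfDepth k)) h
treeOfDepth-surjective (t ∙ u) (suc k) (ℕ.s≤s d) =
  let i , hi = treeOfDepth-surjective t k (ℕ.m⊔n≤o⇒m≤o (depth t) (depth u) d)
      j , hj = treeOfDepth-surjective u k (ℕ.m⊔n≤o⇒n≤o (depth t) (depth u) d)
      m , hm = unpair-surjective (i , j)
      n , hn = unpair-surjective (1 , m)
  in n , trans (cong (branch (treeOfDepth k)) hn)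
               (cong₂ _∙_ (trans (cong (treeOfDepth k ∘ proj₁) hm) hi)
                          (trans (cong (treeOfDepth k ∘ proj₂) hm) hj))

tree : ℕ → Tree
tree = uncurry treeOfDepth ∘ unpair

tree-surjective : StrictlySurjective _≡_ tree
tree-surjective t =
  let n , hn = treeOfDepth-surjective t (depth t) ℕ.≤-refl
      m , hm = unpair-surjective (depth t , n)
  in m , trans (cong (uncurry treeOfDepth) hm) hn

decodeList : {A : Set} → (Tree → A) → Tree → List A
decodeList f (leaf _) = []
decodeList f (t ∙ u)  = f t ∷ decodeList f u

decodeList-surjective : {A : Set} {f : Tree → A} → StrictlySurjective _≡_ f →
                        StrictlySurjective _≡_ (decodeList f)
decodeList-surjective c []       = leaf 0 , refl
decodeList-surjective c (x ∷ xs) =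
  let t , h = c x ; u , k = decodeList-surjective c xs in t ∙ u , cong₂ _∷_ h k

decodeVec : {A : Set} → (Tree → A) → ∀ n → Tree → Vec A n
decodeVec f zero    _        = []
-- A junk value; `f` supplies the inhabitant of `A` that totality requires.
decodeVec f (suc n) (leaf m) = Vec.replicate (suc n) (f (leaf m))
decodeVec f (suc n) (t ∙ u)  = f t ∷ decodeVec f n u

decodeVec-surjective : {A : Set} {f : Tree → A} → StrictlySurjective _≡_ f → ∀ {n} →
                       StrictlySurjective _≡_ (decodeVec f n)
decodeVec-surjective c []       = leaf 0 , refl
decodeVec-surjective c (x ∷ xs) =
  let t , h = c x ; u , k = decodeVec-surjective c xs in t ∙ u , cong₂ _∷_ h k

decodeOp : ℕ → ArithOp
decodeOp 0 = add
decodeOp 1 = sub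
decodeOp _ = mul

decodeOp-surjective : StrictlySurjective _≡_ decodeOp
decodeOp-surjective add = 0 , refl
decodeOp-surjective sub = 1 , refl
decodeOp-surjective mul = 2 , refl

decodeRelation : ℕ → Relation
decodeRelation 0 = neq
decodeRelation 1 = lt
decodeRelation 2 = gt
decodeRelation 3 = le
decodeRelation _ = ge

decodeRelation-surjective : StrictlySurjective _≡_ decodeRelation
decodeRelation-surjective neq = 0 , refl
decodeRelation-surjective lt  = 1 , refl
decodeRelation-surjective gt  = 2 , refl
decodeRelation-surjective le  = 3 , refl
decodeRelation-surjective ge  = 4 , refl

decodeBound : ℕ → Bound
decodeBound 0 = atLeast
decodeBound _ = atMost

decodeBound-surjective : StrictlySurjective _≡_ decodeBound
decodeBound-surjective atLeast = 0 , refl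
decodeBound-surjective atMost  = 1 , refl

module _ (em : ∀ {ℓ} → ExcludedMiddle ℓ) (P : PrecomputedTerms) where

  open Language P

  private variable
    σ : Signature
    Γ Δ Ξ : Ctx
    s : Sort
    n : ℕ
    Θ Θ′ : List (Formula σ₁ Γ)
    A B C : Formula σ₁ Γ

  -- Terms under substitutions and valuations

  -- Renamings are treated as substitutions of variables, so that composition and evaluation are
  -- proved by induction only for substitutions.
  renTm-as-subTm : {ρ : Ren Γ Δ} {θ : Sub Γ Δ} → (∀ s k → θ s k ≡ var (ρ s k)) →
                   (t : Tm Γ s) → renTm ρ t ≡ subTm θ t
  renTm-as-subTm h (var k)        = sym (h _ k)
  renTm-as-subTm h (con c)        = refl
  renTm-as-subTm h (int t)        = cong int (renTm-as-subTm h t)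
  renTm-as-subTm h (num n)        = refl
  renTm-as-subTm h (abs t)        = cong abs (renTm-as-subTm h t)
  renTm-as-subTm h (arith op t u) = cong₂ (arith op) (renTm-as-subTm h t) (renTm-as-subTm h u)

  subTm-id : {θ : Sub Γ Γ} → (∀ s k → θ s k ≡ var k) → (t : Tm Γ s) → subTm θ t ≡ t
  subTm-id h (var k)        = h _ k
  subTm-id h (con c)        = refl
  subTm-id h (int t)        = cong int (subTm-id h t)
  subTm-id h (num n)        = refl
  subTm-id h (abs t)        = cong abs (subTm-id h t)
  subTm-id h (arith op t u) = cong₂ (arith op) (subTm-id h t) (subTm-id h u)

  -- The composite enters as a third substitution with a pointwise equation: under a binder the
  -- lifted composite and the composite of the lifted substitutions agree only pointwise, and
  -- function extensionality is not assumed.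
  subTm-subTm : {θ : Sub Γ Δ} {θ′ : Sub Δ Ξ} {υ : Sub Γ Ξ} →
                (∀ s k → subTm θ′ (θ s k) ≡ υ s k) →
                (t : Tm Γ s) → subTm θ′ (subTm θ t) ≡ subTm υ t
  subTm-subTm h (var k)        = h _ k
  subTm-subTm h (con c)        = refl
  subTm-subTm h (int t)        = cong int (subTm-subTm h t)
  subTm-subTm h (num n)        = refl
  subTm-subTm h (abs t)        = cong abs (subTm-subTm h t)
  subTm-subTm h (arith op t u) = cong₂ (arith op) (subTm-subTm h t) (subTm-subTm h u)

  subTm-renTm : {ρ : Ren Γ Δ} {θ : Sub Δ Ξ} {υ : Sub Γ Ξ} →
                (∀ s k → θ s (ρ s k) ≡ υ s k) →
                (t : Tm Γ s) → subTm θ (renTm ρ t) ≡ subTm υ t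
  subTm-renTm {ρ = ρ} {θ} {υ} h t = begin
    subTm θ (renTm ρ t)                      ≡⟨ cong (subTm θ) (renTm-as-subTm (λ _ _ → refl) t) ⟩
    subTm θ (subTm (λ s k → var (ρ s k)) t)  ≡⟨ subTm-subTm h t ⟩
    subTm υ t                                ∎
    where open ≡-Reasoning

  renTm-subTm : {θ : Sub Γ Δ} {ρ : Ren Δ Ξ} {υ : Sub Γ Ξ} →
                (∀ s k → renTm ρ (θ s k) ≡ υ s k) →
                (t : Tm Γ s) → renTm ρ (subTm θ t) ≡ subTm υ t
  renTm-subTm {θ = θ} {ρ} h t =
    trans (renTm-as-subTm {θ = λ s k → var (ρ s k)} (λ _ _ → refl) (subTm θ t))
    (subTm-subTm (λ s k → trans (sym (renTm-as-subTm (λ _ _ → refl) (θ s k))) (h s k)) t)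

  ⟦⟧-subTm : {θ : Sub Γ Δ} {η : Valuation Δ} {η′ : Valuation Γ} →
             (∀ s k → ⟦ θ s k ⟧ η ≡ η′ s k) → (t : Tm Γ s) → ⟦ subTm θ t ⟧ η ≡ ⟦ t ⟧ η′
  ⟦⟧-subTm h (var k)        = h _ k
  ⟦⟧-subTm h (con c)        = refl
  ⟦⟧-subTm h (int t)        = cong numeral (⟦⟧-subTm h t)
  ⟦⟧-subTm h (num n)        = refl
  ⟦⟧-subTm h (abs t)        = cong (λ n → + ∣ n ∣) (⟦⟧-subTm h t)
  ⟦⟧-subTm h (arith op t u) = cong₂ ⟦ op ⟧ᵃ (⟦⟧-subTm h t) (⟦⟧-subTm h u)

  ⟦⟧-renTm : {ρ : Ren Γ Δ} {η : Valuation Δ} {η′ : Valuation Γ} →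
             (∀ s k → η s (ρ s k) ≡ η′ s k) → (t : Tm Γ s) → ⟦ renTm ρ t ⟧ η ≡ ⟦ t ⟧ η′
  ⟦⟧-renTm {η = η} h t =
    trans (cong (λ t → ⟦ t ⟧ η) (renTm-as-subTm (λ _ _ → refl) t)) (⟦⟧-subTm h t)

  extend-wk : ∀ s {η : Valuation Γ} {d} s′ k → extend s η d s′ (wk s s′ k) ≡ η s′ k
  extend-wk gen gen k = refl
  extend-wk gen int k = refl
  extend-wk int gen k = refl
  extend-wk int int k = refl

  ⟦⟧-wk : ∀ {Γ s′} s {η : Valuation Γ} {d} (t : Tm Γ s′) →
          ⟦ renTm (wk s) t ⟧ (extend s η d) ≡ ⟦ t ⟧ η
  ⟦⟧-wk {Γ} s = ⟦⟧-renTm {ρ = wk s} (extend-wk {Γ} s)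

  ⟦⟧-preTm : ∀ r {η : Valuation Γ} → ⟦ preTm r ⟧ η ≡ r
  ⟦⟧-preTm (numeral n)  = refl
  ⟦⟧-preTm (constant c) = refl

  -- Formulas under substitutions

  liftRen-var : ∀ s {ρ : Ren Γ Δ} {θ : Sub Γ Δ} → (∀ s k → θ s k ≡ var (ρ s k)) →
                ∀ s′ k → liftSub s θ s′ k ≡ var (liftRen s ρ s′ k)
  liftRen-var gen h gen zero    = refl
  liftRen-var gen h gen (suc k) = cong (renTm (wk gen)) (h gen k)
  liftRen-var gen h int k       = cong (renTm (wk gen)) (h int k)
  liftRen-var int h gen k       = cong (renTm (wk int)) (h gen k)
  liftRen-var int h int zero    = refl
  liftRen-var int h int (suc k) = cong (renTm (wk int)) (h int k)

  liftSub-id : ∀ s {θ : Sub Γ Γ} → (∀ s k → θ s k ≡ var k) → ∀ s′ k → liftSub s θ s′ k ≡ var k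
  liftSub-id gen h gen zero    = refl
  liftSub-id gen h gen (suc k) = cong (renTm (wk gen)) (h gen k)
  liftSub-id gen h int k       = cong (renTm (wk gen)) (h int k)
  liftSub-id int h gen k       = cong (renTm (wk int)) (h gen k)
  liftSub-id int h int zero    = refl
  liftSub-id int h int (suc k) = cong (renTm (wk int)) (h int k)

  extendSub-wk : ∀ s {θ : Sub Γ Δ} {t} s′ k → extendSub s θ t s′ (wk s s′ k) ≡ θ s′ k
  extendSub-wk gen gen k = refl
  extendSub-wk gen int k = refl
  extendSub-wk int gen k = refl
  extendSub-wk int int k = refl

  extendSub-zero : ∀ s {θ : Sub Γ Δ} {t} → subTm (extendSub s θ t) (zeroVar s) ≡ t
  extendSub-zero gen = refl
  extendSub-zero int = refl

  subTm-extendSub : ∀ s {θ : Sub Γ Δ} {t s′} (u : Tm Γ s′) →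
                    subTm (extendSub s θ t) (renTm (wk s) u) ≡ subTm θ u
  subTm-extendSub {Γ} s = subTm-renTm {ρ = wk s} (extendSub-wk {Γ} s)

  extendSub-cong : ∀ s {θ : Sub Γ Δ} {t : Tm Δ s} {θ′ : Sub Δ Ξ} {υ : Sub Γ Ξ} {u : Tm Ξ s} →
                   subTm θ′ t ≡ u → (∀ s′ k → subTm θ′ (θ s′ k) ≡ υ s′ k) →
                   ∀ s′ k → subTm θ′ (extendSub s θ t s′ k) ≡ extendSub s υ u s′ k
  extendSub-cong gen e h gen zero    = e
  extendSub-cong gen e h gen (suc k) = h gen k
  extendSub-cong gen e h int k       = h int k
  extendSub-cong int e h gen k       = h gen k
  extendSub-cong int e h int zero    = e
  extendSub-cong int e h int (suc k) = h int k

  liftSub-liftSub : ∀ s {θ : Sub Γ Δ} {θ′ : Sub Δ Ξ} {υ : Sub Γ Ξ} →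
                    (∀ s k → subTm θ′ (θ s k) ≡ υ s k) →
                    ∀ s′ k → subTm (liftSub s θ′) (liftSub s θ s′ k) ≡ liftSub s υ s′ k
  liftSub-liftSub s {θ} {θ′} {υ} h = extendSub-cong s (extendSub-zero s) λ s′ k →
    trans (subTm-extendSub s (θ s′ k))
          (trans (sym (renTm-subTm (λ _ _ → refl) (θ s′ k))) (cong (renTm (wk s)) (h s′ k)))

  ren-as-subst : {ρ : Ren Γ Δ} {θ : Sub Γ Δ} → (∀ s k → θ s k ≡ var (ρ s k)) →
                 (F : Formula σ Γ) → ren ρ F ≡ subst θ F
  ren-as-subst h (pred p ts)        = cong (pred p) (List.map-cong (renTm-as-subTm h) ts)
  ren-as-subst h (rel c t u)        = cong₂ (rel c) (renTm-as-subTm h t) (renTm-as-subTm h u)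
  ren-as-subst h (t ≈ u)            = cong₂ _≈_ (renTm-as-subTm h t) (renTm-as-subTm h u)
  ren-as-subst h (count b x F vs r) =
    cong₂ (count b x F) (Vec.map-cong (renTm-as-subTm h) vs) (renTm-as-subTm h r)
  ren-as-subst h ⊥ᶠ                 = refl
  ren-as-subst h (F ∧ G)            = cong₂ _∧_ (ren-as-subst h F) (ren-as-subst h G)
  ren-as-subst h (F ∨ G)            = cong₂ _∨_ (ren-as-subst h F) (ren-as-subst h G)
  ren-as-subst h (F ⇒ G)            = cong₂ _⇒_ (ren-as-subst h F) (ren-as-subst h G)
  ren-as-subst h (all s F)          = cong (all s) (ren-as-subst (liftRen-var s h) F)
  ren-as-subst h (ex s F)           = cong (ex s) (ren-as-subst (liftRen-var s h) F)

  subst-id : {θ : Sub Γ Γ} → (∀ s k → θ s k ≡ var k) → (F : Formula σ Γ) → subst θ F ≡ F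
  subst-id h (pred p ts)        =
    cong (pred p) (trans (List.map-cong (subTm-id h) ts) (List.map-id ts))
  subst-id h (rel c t u)        = cong₂ (rel c) (subTm-id h t) (subTm-id h u)
  subst-id h (t ≈ u)            = cong₂ _≈_ (subTm-id h t) (subTm-id h u)
  subst-id h (count b x F vs r) =
    cong₂ (count b x F) (trans (Vec.map-cong (subTm-id h) vs) (Vec.map-id vs)) (subTm-id h r)
  subst-id h ⊥ᶠ                 = refl
  subst-id h (F ∧ G)            = cong₂ _∧_ (subst-id h F) (subst-id h G)
  subst-id h (F ∨ G)            = cong₂ _∨_ (subst-id h F) (subst-id h G)
  subst-id h (F ⇒ G)            = cong₂ _⇒_ (subst-id h F) (subst-id h G)
  subst-id h (all s F)          = cong (all s) (subst-id (liftSub-id s h) F)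
  subst-id h (ex s F)           = cong (ex s) (subst-id (liftSub-id s h) F)

  subst-subst : {θ : Sub Γ Δ} {θ′ : Sub Δ Ξ} {υ : Sub Γ Ξ} →
                (∀ s k → subTm θ′ (θ s k) ≡ υ s k) →
                (F : Formula σ Γ) → subst θ′ (subst θ F) ≡ subst υ F
  subst-subst h (pred p ts)        =
    cong (pred p) (trans (sym (List.map-∘ ts)) (List.map-cong (subTm-subTm h) ts))
  subst-subst h (rel c t u)        = cong₂ (rel c) (subTm-subTm h t) (subTm-subTm h u)
  subst-subst h (t ≈ u)            = cong₂ _≈_ (subTm-subTm h t) (subTm-subTm h u)
  subst-subst h (count b x F vs r) =
    cong₂ (count b x F) (trans (sym (Vec.map-∘ _ _ vs)) (Vec.map-cong (subTm-subTm h) vs))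
                        (subTm-subTm h r)
  subst-subst h ⊥ᶠ                 = refl
  subst-subst h (F ∧ G)            = cong₂ _∧_ (subst-subst h F) (subst-subst h G)
  subst-subst h (F ∨ G)            = cong₂ _∨_ (subst-subst h F) (subst-subst h G)
  subst-subst h (F ⇒ G)            = cong₂ _⇒_ (subst-subst h F) (subst-subst h G)
  subst-subst h (all s F)          = cong (all s) (subst-subst (liftSub-liftSub s h) F)
  subst-subst h (ex s F)           = cong (ex s) (subst-subst (liftSub-liftSub s h) F)

  ren-closed : {ρ : Ren ∅ ∅} (F : Formula σ ∅) → ren ρ F ≡ F
  ren-closed F =
    trans (ren-as-subst {θ = λ _ → var} (λ { gen () ; int () }) F) (subst-id (λ _ _ → refl) F)

  instantiate-lift : ∀ {s} {θ : Sub Γ Δ} {t} {υ : Sub (Γ ▸ s) Δ} →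
                     (∀ s′ k → extendSub s θ t s′ k ≡ υ s′ k) →
                     (F : Formula σ (Γ ▸ s)) → subst (liftSub s θ) F [ t ] ≡ subst υ F
  instantiate-lift {s = s} {θ} {t} h = subst-subst λ s′ k →
    trans (extendSub-cong s (extendSub-zero s)
            (λ s′ k → trans (subTm-extendSub s (θ s′ k)) (subTm-id (λ _ _ → refl) (θ s′ k))) s′ k)
          (h s′ k)

  -- Here-and-there semantics

  extend* : Vec Pre n → Valuation Γ → Valuation (Γ ▸* n)
  extend*         []       η = η
  extend* {Γ = Γ} (d ∷ ds) η = extend gen (extend* {Γ = Γ} ds η) d

  tuples : ∀ {v x} → Vec Pre v → Vec Pre x → Valuation (∅ ▸* v ▸* x)
  tuples {v} ds xs = extend* {Γ = ∅ ▸* v} xs (extend* {Γ = ∅} ds emptyValuation)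

  -- Tuples are counted as in τ-body: forcing a count formula and forcing its
  -- translation then have the same shape.
  Count : Bound → (World → Vec Pre n → Set) → Pre → World → Set
  Count {n} atLeast S r w =
    ∃ λ ((Δ , _) : Σ[ Δ ∈ List (Vec Pre n) ] Unique Δ × r ≤ numeral (+ length Δ)) →
    ∀ k → S w (lookup Δ k)
  Count {n} atMost  S r w =
    ∀ ((Δ , _) : Σ[ Δ ∈ List (Vec Pre n) ] Unique Δ × r < numeral (+ length Δ)) →
    Upwards (λ v → (∀ k → S v (lookup Δ k)) → ⊥) w

  Count-⇔ : ∀ b {S S′ : World → Vec Pre n → Set} {r} → (∀ v xs → S v xs ⇔ S′ v xs) →
            ∀ w → Count b S r w ⇔ Count b S′ r w
  Count-⇔ atLeast e w = ∃-⇔ λ (Δ , _) → Π-⇔ λ k → e w (lookup Δ k)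
  Count-⇔ atMost  e w = Π-⇔ λ (Δ , _) →
    ⇒-⇔ (λ v → Π-⇔ λ k → e v (lookup Δ k)) (λ _ → ⇔-id _) w

  Count-mono : ∀ b {S : World → Vec Pre n → Set} {r} → (∀ {v w xs} → v ≼ w → S v xs → S w xs) →
               ∀ {v w} → v ≼ w → Count b S r v → Count b S r w
  Count-mono atLeast m v≼w (Δ , h)     = Δ , λ k → m v≼w (h k)
  Count-mono atMost  m v≼w h Δ w≼u     = h Δ (≼-trans v≼w w≼u)

  record Interpretation : Set₁ where
    field
      H I : Pred PreAtom 0ℓ
      H⊆I : H ⊆ I

    at : World → Pred PreAtom 0ℓ
    at here  = H
    at there = I

    at-mono : ∀ {v w} → v ≼ w → at v ⊆ at w
    at-mono ≼-refl     a = a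
    at-mono here≼there a = H⊆I a

    infix 4 _⊩_

    _⊩_ : World → InfFormula PreAtom → Set
    w ⊩ atomⁱ a  = at w a
    w ⊩ ⊥ⁱ       = ⊥
    w ⊩ ⋀ F      = ∀ k → w ⊩ F k
    w ⊩ ⋁ F      = ∃[ k ] w ⊩ F k
    w ⊩ (F ⇒ⁱ G) = Upwards (λ v → v ⊩ F → v ⊩ G) w

    ⊩-mono : ∀ F {v w} → v ≼ w → v ⊩ F → w ⊩ F
    ⊩-mono (atomⁱ a) v≼w h         = at-mono v≼w h
    ⊩-mono (⋀ F)     v≼w h k       = ⊩-mono (F k) v≼w (h k)
    ⊩-mono (⋁ F)     v≼w (k , h)   = k , ⊩-mono (F k) v≼w h
    ⊩-mono (F ⇒ⁱ G)  v≼w h w≼u     = h (≼-trans v≼w w≼u)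

    Force : Formula σ Γ → Valuation Γ → World → Set
    Force (pred p ts) η w = at w (p , map (λ t → ⟦ t ⟧ η) ts)
    Force (rel c t u) η w = compare c (⟦ t ⟧ η) (⟦ u ⟧ η)
    Force (t ≈ u)     η w = ⟦ t ⟧ η ≡ ⟦ u ⟧ η
    Force (count b x F vs r) η w =
      Count b (λ v xs → Force F (tuples (Vec.map (λ t → ⟦ t ⟧ η) vs) xs) v) (⟦ r ⟧ η) w
    Force ⊥ᶠ          η w = ⊥
    Force (F ∧ G)     η w = Force F η w × Force G η w
    Force (F ∨ G)     η w = Force F η w ⊎ Force G η w
    Force (F ⇒ G)     η w = Upwards (λ v → Force F η v → Force G η v) w
    Force (all s F)   η w = ∀ d → Force F (extend s η d) w
    Force (ex s F)    η w = ∃[ d ] Force F (extend s η d) w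

    Force-mono : (F : Formula σ Γ) {η : Valuation Γ} → ∀ {v w} → v ≼ w → Force F η v → Force F η w
    Force-mono (pred p ts)        v≼w h        = at-mono v≼w h
    Force-mono (rel c t u)        v≼w h        = h
    Force-mono (t ≈ u)            v≼w h        = h
    Force-mono (count b x F vs r) {η} v≼w h    = Count-mono b
      {S = λ v xs → Force F (tuples (Vec.map (λ t → ⟦ t ⟧ η) vs) xs) v} (Force-mono F) v≼w h
    Force-mono (F ∧ G)            v≼w (h , k)  = Force-mono F v≼w h , Force-mono G v≼w k
    Force-mono (F ∨ G)            v≼w (inj₁ h) = inj₁ (Force-mono F v≼w h)
    Force-mono (F ∨ G)            v≼w (inj₂ h) = inj₂ (Force-mono G v≼w h)
    Force-mono (F ⇒ G)            v≼w h w≼u    = h (≼-trans v≼w w≼u)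
    Force-mono (all s F)          v≼w h d      = Force-mono F v≼w (h d)
    Force-mono (ex s F)           v≼w (d , h)  = d , Force-mono F v≼w h

    extend-liftSub : ∀ s {θ : Sub Γ Δ} {η : Valuation Δ} {η′ : Valuation Γ} {d} →
                     (∀ s k → ⟦ θ s k ⟧ η ≡ η′ s k) →
                     ∀ s′ k → ⟦ liftSub s θ s′ k ⟧ (extend s η d) ≡ extend s η′ d s′ k
    extend-liftSub gen         h gen zero    = refl
    extend-liftSub gen {θ = θ} h gen (suc k) = trans (⟦⟧-wk gen (θ gen k)) (h gen k)
    extend-liftSub gen {θ = θ} h int k       = trans (⟦⟧-wk gen (θ int k)) (h int k)
    extend-liftSub int {θ = θ} h gen k       = trans (⟦⟧-wk int (θ gen k)) (h gen k)
    extend-liftSub int         h int zero    = refl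
    extend-liftSub int {θ = θ} h int (suc k) = trans (⟦⟧-wk int (θ int k)) (h int k)

    Force-subst : (F : Formula σ Γ) {θ : Sub Γ Δ} {η : Valuation Δ} {η′ : Valuation Γ} →
                  (∀ s k → ⟦ θ s k ⟧ η ≡ η′ s k) → ∀ w → Force (subst θ F) η w ⇔ Force F η′ w
    Force-subst (pred p ts) h w = ≡⇒⇔ (cong (λ rs → at w (p , rs))
      (trans (sym (List.map-∘ ts)) (List.map-cong (⟦⟧-subTm h) ts)))
    Force-subst (rel c t u) h w = ≡⇒⇔ (cong₂ (compare c) (⟦⟧-subTm h t) (⟦⟧-subTm h u))
    Force-subst (t ≈ u)     h w = ≡⇒⇔ (cong₂ _≡_ (⟦⟧-subTm h t) (⟦⟧-subTm h u))
    Force-subst (count b x F vs r) {θ} {η} h w = ≡⇒⇔ (cong₂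
      (λ ds c → Count b (λ v (xs : Vec Pre x) → Force F (tuples ds xs) v) c w)
      (trans (sym (Vec.map-∘ (λ t → ⟦ t ⟧ η) (subTm θ) vs)) (Vec.map-cong (⟦⟧-subTm h) vs))
      (⟦⟧-subTm h r))
    Force-subst ⊥ᶠ          h w = ⇔-id _
    Force-subst (F ∧ G)     h w = Force-subst F h w ×-⇔ Force-subst G h w
    Force-subst (F ∨ G)     h w = Force-subst F h w ⊎-⇔ Force-subst G h w
    Force-subst (F ⇒ G)     h w = ⇒-⇔ (Force-subst F h) (Force-subst G h) w
    Force-subst (all s F)   h w = Π-⇔ λ d → Force-subst F (extend-liftSub s h) w
    Force-subst (ex s F)    h w = ∃-⇔ λ d → Force-subst F (extend-liftSub s h) w

    Force-ren : (F : Formula σ Γ) {ρ : Ren Γ Δ} {η : Valuation Δ} {η′ : Valuation Γ} →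
                (∀ s k → η s (ρ s k) ≡ η′ s k) → ∀ w → Force (ren ρ F) η w ⇔ Force F η′ w
    Force-ren F {ρ} {η} h w =
      Force-subst F h w ⇔-∘ ≡⇒⇔ (cong (λ F → Force F η w) (ren-as-subst {ρ = ρ} (λ _ _ → refl) F))

    Force-embed : (F : Formula σ₀ Γ) {η : Valuation Γ} → ∀ w → Force (embed F) η w ⇔ Force F η w
    Force-embed (pred p ts) w = ⇔-id _
    Force-embed (rel c t u) w = ⇔-id _
    Force-embed (t ≈ u)     w = ⇔-id _
    Force-embed ⊥ᶠ          w = ⇔-id _
    Force-embed (F ∧ G)     w = Force-embed F w ×-⇔ Force-embed G w
    Force-embed (F ∨ G)     w = Force-embed F w ⊎-⇔ Force-embed G w
    Force-embed (F ⇒ G)     w = ⇒-⇔ (Force-embed F) (Force-embed G) w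
    Force-embed (all s F)   w = Π-⇔ λ d → Force-embed F w
    Force-embed (ex s F)    w = ∃-⇔ λ d → Force-embed F w

  -- The order on precomputed terms and the bounds of counting

  module ≤ = IsTotalOrder isTotalOrder

  numeral-injective : ∀ {i j} → numeral i ≡ numeral {Constant} j → i ≡ j
  numeral-injective refl = refl

  numeral-< : ∀ i j → (i ℤ.< j) ⇔ (numeral i < numeral j)
  numeral-< i j = mk⇔
    (λ i<j → to (numeral-≤ i j) (ℤ.<⇒≤ i<j) , λ e → ℤ.<⇒≢ i<j (numeral-injective e))
    (λ (i≤j , i≢j) → ℤ.≤∧≢⇒< (from (numeral-≤ i j) i≤j) (i≢j ∘ cong numeral))

  numeral-≤ⁿ : ∀ m n → (numeral (+ m) ≤ numeral (+ n)) ⇔ (m ℕ.≤ n)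
  numeral-≤ⁿ m n =
    mk⇔ (ℤ.drop‿+≤+ ∘ from (numeral-≤ (+ m) (+ n))) (to (numeral-≤ (+ m) (+ n)) ∘ ℤ.+≤+)

  numeral-<ⁿ : ∀ m n → (numeral (+ m) < numeral (+ n)) ⇔ (m ℕ.< n)
  numeral-<ⁿ m n =
    mk⇔ (ℤ.drop‿+<+ ∘ from (numeral-< (+ m) (+ n))) (to (numeral-< (+ m) (+ n)) ∘ ℤ.+<+)

  above-≰ : ∀ {r} → AboveNumerals r → ∀ n → r ≤ numeral n → ⊥
  above-≰ above n r≤n with above n
  ... | n≤r , n≢r = n≢r (≤.antisym n≤r r≤n)

  -- By `contiguous`, a constant above 0 cannot lie below a numeral. Every bound therefore falls
  -- under a clause of `CountDef`; excluded middle tells which.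
  constant-position : ∀ c → constant c < numeral 0ℤ ⊎ AboveNumerals (constant c)
  constant-position c with em {P = AboveNumerals (constant c)}
  ... | yes above = inj₂ above
  ... | no ¬above with ≤.total (constant c) (numeral 0ℤ)
  ...   | inj₁ c≤0 = inj₁ (c≤0 , λ ())
  ...   | inj₂ 0≤c = ⊥-elim (¬above λ n → n≤c n , λ ())
    where
    n≤c : ∀ n → numeral n ≤ constant c
    n≤c n with ≤.total (numeral n) (constant c)
    ... | inj₁ n≤c = n≤c
    ... | inj₂ c≤n with contiguous 0ℤ n (constant c) 0≤c c≤n
    ...   | _ , ()

  countDef : ∀ b x (F : Formula σ₀ (Γ ▸* x)) r → ∃ (CountDef b x F r)
  countDef atLeast x F (numeral +[1+ n ]) = _ , ≥-positive n
  countDef atLeast x F (numeral (+ 0))    = _ , ≥-nonpositive ≤.refl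
  countDef atLeast x F (numeral -[1+ n ]) = _ , ≥-nonpositive (to (numeral-≤ _ _) ℤ.-≤+)
  countDef atLeast x F (constant c) with constant-position c
  ... | inj₁ (c≤0 , _) = _ , ≥-nonpositive c≤0
  ... | inj₂ above     = _ , ≥-above above
  countDef atMost x F (numeral (+ n))    = _ , ≤-nonnegative n
  countDef atMost x F (numeral -[1+ n ]) = _ , ≤-negative (to (numeral-< _ _) ℤ.-<+)
  countDef atMost x F (constant c) with constant-position c
  ... | inj₁ c<0   = _ , ≤-negative c<0
  ... | inj₂ above = _ , ≤-above above

  -- Tuples of variables

  extend*-new : ∀ {Γ n} (ds : Vec Pre n) (η : Valuation Γ) k →
                extend* {Γ = Γ} ds η gen (k ↑ˡ proj₁ Γ) ≡ Vec.lookup ds k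
  extend*-new         (d ∷ ds) η zero    = refl
  extend*-new {Γ = Γ} (d ∷ ds) η (suc k) = extend*-new {Γ} ds η k

  extend*-wk* : ∀ {Γ n} (ds : Vec Pre n) (η : Valuation Γ) s k →
                extend* {Γ = Γ} ds η s (wk* {Γ} n s k) ≡ η s k
  extend*-wk*     []       η gen k = refl
  extend*-wk*     []       η int k = refl
  extend*-wk* {Γ} (d ∷ ds) η gen k = extend*-wk* {Γ} ds η gen k
  extend*-wk* {Γ} (d ∷ ds) η int k = extend*-wk* {Γ} ds η int k

  freshVars-value : ∀ {Γ n} (ds : Vec Pre n) (η : Valuation Γ) →
                    Vec.map (λ t → ⟦ t ⟧ (extend* {Γ = Γ} ds η)) (freshVars {Γ} n) ≡ ds
  freshVars-value {Γ} ds η = trans (sym (Vec.tabulate-∘ _ _))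
    (trans (Vec.tabulate-cong (extend*-new {Γ} ds η)) (Vec.tabulate∘lookup ds))

  extend*-copyRen : ∀ {Γ m x} (ds : Vec Pre (m ℕ.* x)) (η : Valuation Γ) i s k →
                    extend* {Γ = Γ} ds η s (copyRen {Γ} {m} x i s k) ≡
                    extend* {Γ = Γ} (tuple {m = m} ds i) η s k
  extend*-copyRen {Γ} {m} {x} ds η i gen k with Fin.splitAt x {proj₁ Γ} k in eq
  ... | inj₁ j = begin
    extend* {Γ = Γ} ds η gen (Fin.combine i j ↑ˡ proj₁ Γ)
      ≡⟨ extend*-new {Γ} ds η (Fin.combine i j) ⟩
    Vec.lookup ds (Fin.combine i j)                             ≡⟨ Vec.lookup∘tabulate _ j ⟨
    Vec.lookup (tuple {m = m} ds i) j
      ≡⟨ extend*-new {Γ} (tuple {m = m} ds i) η j ⟨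
    extend* {Γ = Γ} (tuple {m = m} ds i) η gen (j ↑ˡ proj₁ Γ)
      ≡⟨ cong (extend* {Γ = Γ} (tuple {m = m} ds i) η gen) (Fin.splitAt⁻¹-↑ˡ eq) ⟩
    extend* {Γ = Γ} (tuple {m = m} ds i) η gen k                ∎
    where open ≡-Reasoning
  ... | inj₂ j =
    trans (extend*-wk* {Γ} ds η gen j) (trans (sym (extend*-wk* {Γ} (tuple {m = m} ds i) η gen j))
    (cong (extend* {Γ = Γ} (tuple {m = m} ds i) η gen) (Fin.splitAt⁻¹-↑ʳ {x} eq)))
  extend*-copyRen {Γ} {m} ds η i int k =
    trans (extend*-wk* {Γ} ds η int k) (sym (extend*-wk* {Γ} (tuple {m = m} ds i) η int k))

  ∈-pairs : ∀ {m} {i j : Fin m} → ((i , j) ∈ pairs m) ⇔ (i Fin.< j)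
  ∈-pairs {m} {i} {j} = mk⇔
    (λ p∈ → proj₂ (∈-filter⁻ ordered? {xs = List.cartesianProduct (allFin m) (allFin m)} p∈))
    (λ i<j → ∈-filter⁺ ordered? (∈-cartesianProduct⁺ (∈-allFin i) (∈-allFin j)) i<j)
    where
    ordered? : ∀ ((i , j) : Fin m × Fin m) → Dec (i Fin.< j)
    ordered? (i , j) = i Fin.<? j

  -- Forcing of the counting definitions

  module _ (M : Interpretation) where

    open Interpretation M

    Force-ex* : ∀ n (F : Formula σ (Γ ▸* n)) (η : Valuation Γ) w →
                Force (ex* n F) η w ⇔ ∃ λ ds → Force F (extend* {Γ = Γ} ds η) w
    Force-ex* zero    F η w = mk⇔ (λ h → [] , h) (λ { ([] , h) → h })
    Force-ex* (suc n) F η w =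
      mk⇔ (λ (ds , d , h) → d ∷ ds , h) (λ { (d ∷ ds , h) → ds , d , h })
        ⇔-∘ Force-ex* n (ex gen F) η w

    Force-all* : ∀ n (F : Formula σ (Γ ▸* n)) (η : Valuation Γ) w →
                 Force (all* n F) η w ⇔ (∀ ds → Force F (extend* {Γ = Γ} ds η) w)
    Force-all* zero    F η w = mk⇔ (λ { h [] → h }) (λ h → h [])
    Force-all* (suc n) F η w =
      mk⇔ (λ { h (d ∷ ds) → h ds d }) (λ h ds d → h (d ∷ ds)) ⇔-∘ Force-all* n (all gen F) η w

    Force-conj : {A : Set} (f : A → Formula σ Γ) (xs : List A) (η : Valuation Γ) (w : World) →
                 Force (conj (map f xs)) η w ⇔ (∀ {x} → x ∈ xs → Force (f x) η w)
    Force-conj f []       η w = mk⇔ (λ { _ {_} () }) (λ _ {_} _ → id)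
    Force-conj f (x ∷ xs) η w = mk⇔
      (λ { (h , _) {_} (here refl) → h ; (_ , h) {_} (there x∈xs) →
        to (Force-conj f xs η w) h x∈xs })
      (λ h → h (here refl) , from (Force-conj f xs η w) (λ x∈xs → h (there x∈xs)))

    Force-disj : {A : Set} (f : A → Formula σ Γ) (xs : List A) (η : Valuation Γ) (w : World) →
                 Force (disj (map f xs)) η w ⇔ (∃[ x ] x ∈ xs × Force (f x) η w)
    Force-disj f []       η w = mk⇔ (λ ()) (λ { (_ , () , _) })
    Force-disj f (x ∷ xs) η w = mk⇔
      (λ { (inj₁ h) → x , here refl , h
         ; (inj₂ h) → let y , y∈xs , k = to (Force-disj f xs η w) h in y , there y∈xs , k })
      (λ { (y , here refl , h)   → inj₁ h
         ; (y , there y∈xs , h)  → inj₂ (from (Force-disj f xs η w) (y , y∈xs , h)) })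

    module Copies {Γ : Ctx} {x : ℕ} (m : ℕ) (ds : Vec Pre (m ℕ.* x)) (η : Valuation Γ) where

      η* : Valuation (Γ ▸* (m ℕ.* x))
      η* = extend* {Γ = Γ} ds η

      Force-copies : ∀ w (F : Formula σ₀ (Γ ▸* x)) →
                     Force (copies {Γ} m x F) η* w ⇔
                     (∀ i → Force F (extend* {Γ = Γ} (tuple {m = m} ds i) η) w)
      Force-copies w F = mk⇔
        (λ h i → to (Force-copy i) (to (Force-conj copy (allFin m) η* w) h (∈-allFin i)))
        (λ h → from (Force-conj copy (allFin m) η* w) λ {i} _ → from (Force-copy i) (h i))
        where
        copy : Fin m → Formula σ₀ (Γ ▸* (m ℕ.* x))
        copy i = ren (copyRen {Γ} {m} x i) F
        Force-copy : ∀ i → Force (copy i) η* w ⇔ Force F (extend* {Γ = Γ} (tuple {m = m} ds i) η) w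
        Force-copy i = Force-ren F (extend*-copyRen {Γ} {m} ds η i) w

      Force-sameTuple : ∀ w i j → Force (sameTuple {Γ} m x (i , j)) η* w ⇔
                                tuple {m = m} ds i ≡ tuple {m = m} ds j
      Force-sameTuple w i j = mk⇔
        (λ h → Vec.tabulate-cong λ k → trans (sym (new i k))
                 (trans (to (Force-conj same (allFin x) η* w) h (∈-allFin k)) (new j k)))
        (λ e → from (Force-conj same (allFin x) η* w) λ {k} _ → trans (new i k)
                 (trans (trans (sym (Vec.lookup∘tabulate _ k))
                        (trans (cong (λ t → Vec.lookup t k) e) (Vec.lookup∘tabulate _ k)))
                        (sym (new j k))))
        where
        new : ∀ i k → η* gen (copyVar {Γ} i k) ≡ Vec.lookup ds (Fin.combine i k)
        new i k = extend*-new {Γ} ds η (Fin.combine i k)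
        same : Fin x → Formula σ₀ (Γ ▸* (m ℕ.* x))
        same k = var (copyVar {Γ} i k) ≈ var (copyVar {Γ} j k)

      -- Equality of tuples does not depend on the world, so the negated equalities amount to plain
      -- distinctness.
      Force-different : ∀ w → Force (conj (map (λ p → ¬ sameTuple {Γ} m x p) (pairs m))) η* w ⇔
                        Distinct (tuple {m = m} ds)
      Force-different w = mk⇔
        (λ h {i} {j} i<j e → to (Force-conj different (pairs m) η* w) h (from ∈-pairs i<j) ≼-refl
                               (from (Force-sameTuple w i j) e))
        (λ distinct → from (Force-conj different (pairs m) η* w) λ { {i , j} p∈ {v} w≼v h →
          distinct (to ∈-pairs p∈) (to (Force-sameTuple v i j) h) })
        where
        different : Fin m × Fin m → Formula σ₀ (Γ ▸* (m ℕ.* x))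
        different p = ¬ sameTuple {Γ} m x p

      Force-equal : ∀ w → Force (disj (map (sameTuple {Γ} m x) (pairs m))) η* w ⇔
                    (Distinct (tuple {m = m} ds) → ⊥)
      Force-equal w = mk⇔
        (λ h distinct → let (i , j) , p∈ , e = to (Force-disj (sameTuple {Γ} m x) (pairs m) η* w) h
                        in distinct (to ∈-pairs p∈) (to (Force-sameTuple w i j) e))
        (λ ¬distinct → decidable-stable em λ ¬h → ¬distinct λ {i} {j} i<j e →
          ¬h (from (Force-disj (sameTuple {Γ} m x) (pairs m) η* w)
               ((i , j) , from ∈-pairs i<j , from (Force-sameTuple w i j) e)))

    open Copies

    module _ {Γ : Ctx} {x : ℕ} (F : Formula σ₀ (Γ ▸* x)) (η : Valuation Γ) where

      private
        S : World → Vec Pre x → Set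
        S v xs = Force F (extend* {Γ = Γ} xs η) v

      Force-atLeastF : ∀ m w → Force (atLeastF {Γ} m x F) η w ⇔ Count atLeast S (numeral (+ m)) w
      Force-atLeastF m w = mk⇔
        (λ h →
          let ds , c , d = to (Force-ex* (m ℕ.* x) body η w) h
              Δ , unique , length≡ , holds =
                list-of-family {S = S w} (to (Force-different m ds η w) d)
                  (to (Force-copies m ds η w F) c)
          in (Δ , unique , from (numeral-≤ⁿ _ _) (ℕ.≤-reflexive (sym length≡))) , holds)
        (λ ((Δ , unique , r≤) , holds) →
          let ds , distinct , holds′ =
                tuples-of-list {S = S w} unique (to (numeral-≤ⁿ _ _) r≤) holds
          in from (Force-ex* (m ℕ.* x) body η w)
               (ds , from (Force-copies m ds η w F) holds′ ,
                 from (Force-different m ds η w) distinct))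
        where
        body : Formula σ₀ (Γ ▸* (m ℕ.* x))
        body = copies {Γ} m x F ∧ conj (map (λ p → ¬ sameTuple {Γ} m x p) (pairs m))

      -- `atMostF` concludes with a disjunction of equalities, `Count` with absurdity. As equality
      -- is the same at both worlds, the disjunction fails exactly for distinct tuples. The `suc m`
      -- tuples of the definition correspond to lists longer than `m`.
      Force-atMostF : ∀ m w → Force (atMostF {Γ} m x F) η w ⇔ Count atMost S (numeral (+ m)) w
      Force-atMostF m w = mk⇔
        (λ h (Δ , unique , r<) {v} w≼v holds →
          let ds , distinct , holds′ =
                tuples-of-list {S = S v} unique (to (numeral-<ⁿ _ _) r<) holds
          in to (Force-equal (suc m) ds η v) (to (Force-all* (suc m ℕ.* x) body η w) h ds w≼v
                                (from (Force-copies (suc m) ds η v F) holds′)) distinct)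
        (λ h → from (Force-all* (suc m ℕ.* x) body η w) λ ds {v} w≼v c →
          from (Force-equal (suc m) ds η v) λ distinct →
            let Δ , unique , length≡ , holds =
                  list-of-family {S = S v} distinct (to (Force-copies (suc m) ds η v F) c)
            in h (Δ , unique , from (numeral-<ⁿ _ _) (ℕ.≤-reflexive (sym length≡))) w≼v holds)
        where
        body : Formula σ₀ (Γ ▸* (suc m ℕ.* x))
        body = copies {Γ} (suc m) x F ⇒ disj (map (sameTuple {Γ} (suc m) x) (pairs (suc m)))

    Force-CountDef : ∀ {b x F r G} → CountDef {Γ} b x F r G → ∀ (η : Valuation Γ) w →
                     Force G η w ⇔ Count b (λ v xs → Force F (extend* {Γ = Γ} xs η) v) r w
    Force-CountDef {F = F} (≥-positive n) η w = Force-atLeastF F η (suc n) w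
    Force-CountDef (≥-nonpositive r≤0) η w = mk⇔ (λ _ → ([] , [] , r≤0) , λ ()) (λ _ {_} _ → id)
    Force-CountDef (≥-above above)     η w = mk⇔ (λ ()) (λ ((_ , _ , r≤) , _) → above-≰ above _ r≤)
    Force-CountDef {F = F} (≤-nonnegative n) η w = Force-atMostF F η n w
    Force-CountDef (≤-negative r<0) η w = mk⇔ (λ ()) (λ h → h ([] , [] , r<0) ≼-refl λ ())
    Force-CountDef (≤-above above)  η w =
      mk⇔ (λ _ (_ , _ , r<) → ⊥-elim (above-≰ above _ (proj₁ r<))) (λ _ {_} _ → id)

    -- Only predicate symbols tell the two worlds, or two interpretations `J`, apart; without them
    -- an implication reduces to a single world.
    Force-NoPred : ∀ (F : Formula σ₀ Γ) → NoPred F → ∀ {J} {η : Valuation Γ} w →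
                   Force F η w ⇔ Sat J F η
    Force-NoPred (rel c t u) _       w = ⇔-id _
    Force-NoPred (t ≈ u)     _       w = ⇔-id _
    Force-NoPred ⊥ᶠ          _       w = ⇔-id _
    Force-NoPred (F ∧ G)     (p , q) w = Force-NoPred F p w ×-⇔ Force-NoPred G q w
    Force-NoPred (F ∨ G)     (p , q) w = Force-NoPred F p w ⊎-⇔ Force-NoPred G q w
    Force-NoPred (F ⇒ G)     (p , q) w = mk⇔
      (λ h f → to (Force-NoPred G q w) (h ≼-refl (from (Force-NoPred F p w) f)))
      (λ h {v} _ f → from (Force-NoPred G q v) (h (to (Force-NoPred F p v) f)))
    Force-NoPred (all s F)   p       w = Π-⇔ λ d → Force-NoPred F p w
    Force-NoPred (ex s F)    p       w = ∃-⇔ λ d → Force-NoPred F p w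

    Force-count : ∀ {b x v F r G} → CountDef {∅ ▸* v} b x F r G → ∀ ds w →
                  Count b (λ u xs → Force F (tuples ds xs) u) r w ⇔
                  Force (embed G) (extend* {Γ = ∅} ds emptyValuation) w
    Force-count {v = v} {G = G} D ds w =
      ⇔-sym (Force-CountDef D (extend* {Γ = ∅} ds emptyValuation) w ⇔-∘ Force-embed G w)

    Force-Defs : ∀ {F} → Defs F → ∀ w → Force F emptyValuation w
    Force-Defs (def {b} {x} {v} {F} {r} {G} D) w = from (Force-all* v _ _ w) λ ds →
      (λ {u} _ h → to (equivalent ds u) h) , (λ {u} _ h → from (equivalent ds u) h)
      where
      equivalent : ∀ ds u →
                   Force (count b x F (freshVars {∅} v) (preTm r))
                         (extend* {Γ = ∅} ds emptyValuation) u ⇔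
                            Force (embed G) (extend* {Γ = ∅} ds emptyValuation) u
      equivalent ds u = Force-count D ds u ⇔-∘ ≡⇒⇔ (cong₂
        (λ cs c → Count b (λ v (xs : Vec Pre x) → Force F (tuples cs xs) v) c u)
        (freshVars-value {∅} ds emptyValuation) (⟦⟧-preTm r))

    -- Soundness of the calculus

    extend-extendSub : ∀ s {η : Valuation Γ} {t} s′ k →
                       ⟦ extendSub s (λ _ → var) t s′ k ⟧ η ≡ extend s η (⟦ t ⟧ η) s′ k
    extend-extendSub gen gen zero    = refl
    extend-extendSub gen gen (suc k) = refl
    extend-extendSub gen int k       = refl
    extend-extendSub int gen k       = refl
    extend-extendSub int int zero    = refl
    extend-extendSub int int (suc k) = refl

    Force-instance : ∀ {s} (F : Formula σ (Γ ▸ s)) t (η : Valuation Γ) w →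
                     Force (F [ t ]) η w ⇔ Force F (extend s η (⟦ t ⟧ η)) w
    Force-instance {Γ = Γ} {s} F t η w = Force-subst F (extend-extendSub {Γ} s) w

    ⟦⟧-⌈⌉ : ∀ {s} (t u : Tm Γ s) {η : Valuation Γ} → ⟦ ⌈ t ⌉ ⟧ η ≡ ⟦ ⌈ u ⌉ ⟧ η → ⟦ t ⟧ η ≡ ⟦ u ⟧ η
    ⟦⟧-⌈⌉ {s = gen} t u e = e
    ⟦⟧-⌈⌉ {s = int} t u e = numeral-injective e

    Dom-inhabitant : ∀ s → Dom s
    Dom-inhabitant gen = numeral 0ℤ
    Dom-inhabitant int = 0ℤ

    -- If `B` fails at `there`, it fails at every world and is negated. If it holds there and `A`
    -- fails at `w`, the implication is vacuous at `w` and true at `there`.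
    hosoi-valid : ∀ {A B : World → Set} → (∀ {v w} → v ≼ w → A v → A w) →
                  (∀ {v w} → v ≼ w → B v → B w) →
                  ∀ w → A w ⊎ Upwards (λ v → A v → B v) w ⊎ Upwards (λ v → B v → ⊥) w
    hosoi-valid {A} {B} A-mono B-mono w with em {P = A w} | em {P = B there}
    ... | yes a | _     = inj₁ a
    ... | no ¬a | no ¬b = inj₂ (inj₂ λ _ b → ¬b (B-mono ≼-there b))
    hosoi-valid A-mono B-mono here  | no ¬a | yes b =
      inj₂ (inj₁ λ { ≼-refl a → ⊥-elim (¬a a) ; here≼there _ → b })
    hosoi-valid A-mono B-mono there | no ¬a | yes b = inj₂ (inj₁ λ { ≼-refl a → b })

    -- The witness is a counterexample to A at the highest world that has one.
    sqht-valid : ∀ {D : Set} {A : D → World → Set} → D → (∀ {d v w} → v ≼ w → A d v → A d w) →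
                 ∀ w → ∃[ d ] Upwards (λ v → A d v → ∀ d → A d v) w
    sqht-valid {A = A} d₀ A-mono w
      with em {P = ∃[ d ] (A d there → ⊥)} | em {P = ∃[ d ] (A d here → ⊥)}
    ... | yes (d , ¬a) | _ = d , λ _ a → ⊥-elim (¬a (A-mono ≼-there a))
    ... | no ¬∃ | yes (d , ¬a) = d , λ
      { {here}  _ a   → ⊥-elim (¬a a)
      ; {there} _ _ d → decidable-stable em λ ¬a → ¬∃ (d , ¬a) }
    ... | no ¬∃ | no ¬∃′ = d₀ , λ
      { {here}  _ _ d → decidable-stable em λ ¬a → ¬∃′ (d , ¬a)
      ; {there} _ _ d → decidable-stable em λ ¬a → ¬∃ (d , ¬a) }

    weakened : ∀ s {Θ : List (Formula σ₁ Γ)} {η w d} → All (λ G → Force G η w) Θ →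
               All (λ G → Force G (extend s η d) w) (map (ren (wk s)) Θ)
    weakened {Γ} s {w = w} hs =
      All.map⁺ (All.map (λ {G} → from (Force-ren G (extend-wk {Γ} s) w)) hs)

    soundness : ∀ {Θ : List (Formula σ₁ Γ)} {F} → Θ ⊢ F →
                ∀ {η w} → All (λ G → Force G η w) Θ → Force F η w
    soundness (assume F∈Θ) hs = All.lookup hs F∈Θ
    soundness (⊥E d) hs = ⊥-elim (soundness d hs)
    soundness (∧I d e) hs = soundness d hs , soundness e hs
    soundness (∧E₁ d) hs = proj₁ (soundness d hs)
    soundness (∧E₂ d) hs = proj₂ (soundness d hs)
    soundness (∨I₁ d) hs = inj₁ (soundness d hs)
    soundness (∨I₂ d) hs = inj₂ (soundness d hs)
    soundness (∨E d e f) hs with soundness d hs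
    ... | inj₁ h = soundness e (h ∷ hs)
    ... | inj₂ h = soundness f (h ∷ hs)
    soundness (⇒I d) hs w≼v h = soundness d (h ∷ All.map (λ {G} → Force-mono G w≼v) hs)
    soundness (⇒E d e) hs = soundness d hs ≼-refl (soundness e hs)
    soundness (∀I s d) hs x = soundness d (weakened s hs)
    soundness (∀E {F = F} d t) {η} {w} hs = from (Force-instance F t η w) (soundness d hs _)
    soundness (∃I {F = F} t d) {η} {w} hs = _ , to (Force-instance F t η w) (soundness d hs)
    soundness {Γ} (∃E {s = s} {G = G} d e) {w = w} hs with soundness d hs
    ... | x , h = to (Force-ren G (extend-wk {Γ} s) w) (soundness e (h ∷ weakened s hs))
    soundness (≈I t) hs = refl
    soundness {Γ} (≈E {s = s} F {t} {u} d e) {η} {w} hs = from (Force-instance F u η w)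
      (transport (λ x → Force F (extend s η x) w) (⟦⟧-⌈⌉ t u (soundness d hs))
        (to (Force-instance F t η w) (soundness e hs)))
    soundness (hosoi F G) {η} {w} hs = hosoi-valid (Force-mono F {η}) (Force-mono G {η}) w
    soundness {Γ} (sqht s F) {η} {w} hs =
      let d , h = sqht-valid {A = λ d v → Force F (extend s η d) v}
                    (Dom-inhabitant s) (Force-mono F) w
      in d , λ {v} w≼v a → from (Force-ren (all s F) (extend-wk {Γ} s) v) (h w≼v a)
    soundness (std F (p , sat)) {w = w} hs = from (Force-ren (embed F) (λ { gen () ; int () }) w)
      -- `F` is true under every interpretation of the predicate symbols; the empty one is as good
      -- as any, since none of them occurs.
      (from (Force-embed F w) (from (Force-NoPred F p w) (sat (λ _ → ⊥))))
    soundness (defs F D) {w = w} hs = from (Force-ren F (λ { gen () ; int () }) w) (Force-Defs D w)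
    soundness (ω-gen {F = F} d) {η} {w} hs r =
      transport (λ x → Force F (extend gen η x) w) (⟦⟧-preTm r)
        (to (Force-instance F (preTm r) η w) (soundness (d r) hs))
    soundness (ω-int {F = F} d) {η} {w} hs n =
      to (Force-instance F (num n) η w) (soundness (d n) hs)

  -- Division in the translation of terms

  Division : ℤ → ℤ → ℤ → Set → Set → Set
  Division m n k A B =
    (numeral (k ℤ.* + ∣ n ∣) ≤ numeral (+ ∣ m ∣) ×
      numeral (+ ∣ m ∣) < numeral ((k ℤ.+ 1ℤ) ℤ.* + ∣ n ∣)) ×
    ((numeral 0ℤ ≤ numeral (m ℤ.* n) × A) ⊎ (numeral (m ℤ.* n) < numeral 0ℤ × B))

  -- The outcomes `u` and `v` are parameters so that quotient and remainder share one proof.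
  -- `Division` is the forcing condition of `division` spelled out. Its bounds force `n` to be
  -- nonzero and `k` to be the quotient of the absolute values; then the sign of `m * n` selects the
  -- outcome.
  Division-⇔ : ∀ m n {r : Pre} (u v : ℤ → ℤ) (value : .{{ℤ.NonZero n}} → ℤ) →
               (.{{_ : ℤ.NonZero n}} → 0ℤ ℤ.≤ m ℤ.* n → value ≡ u (+ (∣ m ∣ ℕ./ ∣ n ∣))) →
               (.{{_ : ℤ.NonZero n}} → m ℤ.* n ℤ.< 0ℤ → value ≡ v (+ (∣ m ∣ ℕ./ ∣ n ∣))) →
               (∃[ k ] Division m n k (r ≡ numeral (u k)) (r ≡ numeral (v k))) ⇔
               (Σ[ nz ∈ ℤ.NonZero n ] r ≡ numeral (value {{nz}}))
  Division-⇔ m n {r} u v value value-nonNeg value-neg = mk⇔ forward backward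
    where
    forward : (∃[ k ] Division m n k (r ≡ numeral (u k)) (r ≡ numeral (v k))) →
              (Σ[ nz ∈ ℤ.NonZero n ] r ≡ numeral (value {{nz}}))
    forward (k , (lower , upper) , cases)
      with quotient-bounds {∣ m ∣} {∣ n ∣} {k}
             (from (numeral-≤ _ _) lower) (from (numeral-< _ _) upper) | cases
    ... | nz , refl | inj₁ (0≤mn , refl) =
      nz , cong numeral (sym (value-nonNeg {{nz}} (from (numeral-≤ _ _) 0≤mn)))
    ... | nz , refl | inj₂ (mn<0 , refl) =
      nz , cong numeral (sym (value-neg {{nz}} (from (numeral-< _ _) mn<0)))
    backward : (Σ[ nz ∈ ℤ.NonZero n ] r ≡ numeral (value {{nz}})) →
               (∃[ k ] Division m n k (r ≡ numeral (u k)) (r ≡ numeral (v k)))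
    backward (nz , refl) = let instance _ = nz in
      let lower , upper = quotient-bounds⁻ ∣ m ∣ ∣ n ∣ in
      + (∣ m ∣ ℕ./ ∣ n ∣) , (to (numeral-≤ _ _) lower , to (numeral-< _ _) upper) , sides
      where
      sides : let instance _ = nz in
        (numeral 0ℤ ≤ numeral (m ℤ.* n) × numeral value ≡ numeral (u (+ (∣ m ∣ ℕ./ ∣ n ∣)))) ⊎
        (numeral (m ℤ.* n) < numeral 0ℤ × numeral value ≡ numeral (v (+ (∣ m ∣ ℕ./ ∣ n ∣))))
      sides with 0ℤ ℤ.≤? m ℤ.* n
      ... | yes 0≤mn = inj₁ (to (numeral-≤ _ _) 0≤mn , cong numeral (value-nonNeg {{nz}} 0≤mn))
      ... | no  0≰mn =
        inj₂ (to (numeral-< _ _) (ℤ.≰⇒> 0≰mn) , cong numeral (value-neg {{nz}} (ℤ.≰⇒> 0≰mn)))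

  quo-⇔ : ∀ m n {r : Pre} → (∃[ k ] Division m n k (r ≡ numeral k) (r ≡ numeral (0ℤ ℤ.- k))) ⇔
          BinValue (div quo) m n r
  quo-⇔ m n = Division-⇔ m n id (λ k → 0ℤ ℤ.- k) (quotient m n) (quotient-nonNeg m n)
    (λ mn<0 → trans (quotient-neg m n mn<0) (sym (ℤ.+-identityˡ _)))

  rem-⇔ : ∀ m n {r : Pre} →
          (∃[ k ] Division m n k (r ≡ numeral (m ℤ.- k ℤ.* n)) (r ≡ numeral (m ℤ.+ k ℤ.* n))) ⇔
                      BinValue (div rem) m n r
  rem-⇔ m n = Division-⇔ m n (λ k → m ℤ.- k ℤ.* n) (λ k → m ℤ.+ k ℤ.* n) (remainder m n)
    (λ 0≤mn → cong (λ q → m ℤ.- q)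
      (trans (cong (n ℤ.*_) (quotient-nonNeg m n 0≤mn)) (ℤ.*-comm n _)))
    -- When the truncated quotient is `- q`, the remainder `m - n * (- q)` is `m + q * n`.
    (λ mn<0 → cong (λ q → m ℤ.+ q) (trans (cong (λ q → ℤ.- (n ℤ.* q)) (quotient-neg m n mn<0))
                (trans (cong ℤ.-_ (sym (ℤ.neg-distribʳ-* n _)))
                  (trans (ℤ.neg-involutive _) (ℤ.*-comm n _)))))

  -- The translations of terms and conditions

  -- Restricted to `xs`, because `emptyEnv` maps unbound variables to an arbitrary term.
  Agree : List Var → Env Γ → Valuation Γ → Assignment → Set
  Agree xs ρ η θ = ∀ {x} → x ∈ xs → ⟦ ρ x ⟧ η ≡ θ x

  Agree-wk : ∀ {Γ} s {xs} {ρ : Env Γ} {η : Valuation Γ} {θ d} → Agree xs ρ η θ →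
             Agree xs (wkEnv s ρ) (extend s η d) θ
  Agree-wk s {ρ = ρ} h {x} x∈xs = trans (⟦⟧-wk s (ρ x)) (h x∈xs)

  Agree-wk* : ∀ {Γ n xs} {ρ : Env Γ} {η : Valuation Γ} {θ} ds → Agree xs ρ η θ →
              Agree xs (wkEnv* {Γ} n ρ) (extend* {Γ = Γ} ds η) θ
  Agree-wk* {Γ} {n} {ρ = ρ} {η} ds h {x} x∈xs =
    trans (⟦⟧-renTm {ρ = wk* {Γ} n} (extend*-wk* {Γ} ds η) (ρ x)) (h x∈xs)

  -- `bind` and `assign` overwrite the variables of `xs` in the same way, so agreement must be known
  -- only for the others.
  bind-assign : ∀ {Γ xs} {ρ : Env Γ} {η : Valuation Γ} {θ} ds {x} → (x ∉ xs → ⟦ ρ x ⟧ η ≡ θ x) →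
                ⟦ bind {Γ} xs ρ x ⟧ (extend* {Γ = Γ} ds η) ≡ assign xs ds θ x
  bind-assign {Γ} {xs} {ρ} {η} ds {x} h with x ∈? xs
  ... | yes x∈xs = extend*-new {Γ} ds η (index x∈xs)
  ... | no  x∉xs = trans (⟦⟧-renTm {ρ = wk* {Γ} (length xs)} (extend*-wk* {Γ} ds η) (ρ x)) (h x∉xs)

  bind-Agree : ∀ {Γ xs} {ρ : Env Γ} {η : Valuation Γ} {θ} ds →
               (∀ k → Vec.lookup ds k ≡ θ (lookup xs k)) →
               Agree xs (bind {Γ} xs ρ) (extend* {Γ = Γ} ds η) θ
  bind-Agree {Γ} {xs} {η = η} {θ} ds h {x} x∈xs with x ∈? xs
  ... | yes x∈xs′ = trans (extend*-new {Γ} ds η (index x∈xs′))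
                      (trans (h (index x∈xs′)) (cong θ (sym (lookup-index x∈xs′))))
  ... | no  x∉xs  = ⊥-elim (x∉xs x∈xs)

  outer-global : ∀ R {b x} → b ∈ Rule.body R → x ∈ outerVars b → x ∈ globals R
  outer-global (H ← B) b∈B x∈b =
    ∈-deduplicate⁺ ℕ._≟_ (∈-++⁺ʳ (headVars H) (∈-concatMap outerVars b∈B x∈b))

  head-global : ∀ R {x} → x ∈ headVars (Rule.head R) → x ∈ globals R
  head-global (H ← B) x∈H = ∈-deduplicate⁺ ℕ._≟_ (∈-++⁺ˡ x∈H)

  module _ (M : Interpretation) where

    open Interpretation M

    private
      ≡-⇔ : {A : Set} {x y z : A} → x ≡ y → (x ≡ z) ⇔ (y ≡ z)
      ≡-⇔ e = ≡⇒⇔ (cong (_≡ _) e)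

    Force-val : ∀ t (ρ : Env Γ) z {η θ r} → Agree (termVars t) ρ η θ → ⟦ z ⟧ η ≡ r →
                ∀ w → Force {σ} (val t ρ z) η w ⇔ Value t θ r
    Force-val (pre c) ρ z h e w = ≡⇒⇔ (cong₂ _≡_ e (⟦⟧-preTm c))
    Force-val (var x) ρ z h e w = ≡⇒⇔ (cong₂ _≡_ e (h (here refl)))
    Force-val {Γ = Γ} (abs t) ρ z h e w = ∃-⇔ λ m →
      Force-val t (wkEnv int ρ) (int (var zero)) (Agree-wk {Γ} int {ρ = ρ} h) refl w ×-⇔
      ≡-⇔ (trans (⟦⟧-wk int z) e)
    Force-val {Γ = Γ} {σ} (bin op t u) ρ z {η} {θ} {r} h e w = bin-val op
      where
      η² : ℤ → ℤ → Valuation (Γ ▸ int ▸ int)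
      η² i j = extend {Γ ▸ int} int (extend {Γ} int η i) j
      η³ : ℤ → ℤ → ℤ → Valuation (Γ ▸ int ▸ int ▸ int)
      η³ i j k = extend {Γ ▸ int ▸ int} int (η² i j) k
      ρ² : Env (Γ ▸ int ▸ int)
      ρ² = wkEnv {Γ ▸ int} int (wkEnv int ρ)
      ρ³ : Env (Γ ▸ int ▸ int ▸ int)
      ρ³ = wkEnv {Γ ▸ int ▸ int} int ρ²
      z² : Tm (Γ ▸ int ▸ int) gen
      z² = renTm (wk int) (renTm (wk int) z)
      h² : ∀ {i j} → Agree (termVars t ++ termVars u) ρ² (η² i j) θ
      h² = Agree-wk {Γ ▸ int} int {ρ = wkEnv int ρ} (Agree-wk {Γ} int {ρ = ρ} h)
      h³ : ∀ {i j k} → Agree (termVars t ++ termVars u) ρ³ (η³ i j k) θ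
      h³ = Agree-wk {Γ ▸ int ▸ int} int {ρ = ρ²} h²
      e² : ∀ {i j} → ⟦ z² ⟧ (η² i j) ≡ r
      e² = trans (⟦⟧-wk int (renTm (wk int) z)) (trans (⟦⟧-wk int z) e)
      e³ : ∀ {i j k} → ⟦ renTm (wk int) z² ⟧ (η³ i j k) ≡ r
      e³ = trans (⟦⟧-wk int z²) e²

      operands³ : ∀ {i j} {C : ℤ → Set} {C′ : Set} → ∃ C ⇔ C′ →
                  (∃[ k ] Force {σ} (val t ρ³ (int (var (suc (suc zero))))) (η³ i j k) w ×
                          Force {σ} (val u ρ³ (int (var (suc zero)))) (η³ i j k) w × C k) ⇔
                  (Value t θ (numeral i) × Value u θ (numeral j) × C′)
      operands³ = ∃-×-⇔ (λ k → Force-val t ρ³ _ (λ x∈ → h³ (∈-++⁺ˡ x∈)) refl w)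
                        (λ k → Force-val u ρ³ _ (λ x∈ → h³ (∈-++⁺ʳ (termVars t) x∈)) refl w)

      bin-val : ∀ op → Force {σ} (val (bin op t u) ρ z) η w ⇔ Value (bin op t u) θ r
      bin-val (arith op) = ∃-⇔ λ i → ∃-⇔ λ j →
        Force-val t ρ² _ (λ x∈ → h² (∈-++⁺ˡ x∈)) refl w ×-⇔
        Force-val u ρ² _ (λ x∈ → h² (∈-++⁺ʳ (termVars t) x∈)) refl w ×-⇔ ≡-⇔ e²
      bin-val (div quo) = ∃-⇔ λ i → ∃-⇔ λ j → operands³ (quo-⇔ i j ⇔-∘ ∃-⇔ λ k →
        ⇔-id _ ×-⇔ ((⇔-id _ ×-⇔ ≡-⇔ e³) ⊎-⇔ (⇔-id _ ×-⇔ ≡-⇔ e³)))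
      bin-val (div rem) = ∃-⇔ λ i → ∃-⇔ λ j → operands³ (rem-⇔ i j ⇔-∘ ∃-⇔ λ k →
        ⇔-id _ ×-⇔ ((⇔-id _ ×-⇔ ≡-⇔ e³) ⊎-⇔ (⇔-id _ ×-⇔ ≡-⇔ e³)))
      bin-val dots = ∃-⇔ λ i → ∃-⇔ λ j → operands³ (∃-⇔ λ k → mk⇔
        (λ ((i≤k , k≤j) , e) →
          from (numeral-≤ i k) i≤k , from (numeral-≤ k j) k≤j , trans (sym e³) e)
        (λ (i≤k , k≤j , e) → (to (numeral-≤ i k) i≤k , to (numeral-≤ k j) k≤j) , trans e³ e))

    Force-vals : ∀ ts (ρ : Env Γ) {η θ} → Agree (concatMap termVars ts) ρ η θ → ∀ zs w →
                 Force {σ} (vals ts ρ zs) η w ⇔ Values ts θ (toList (Vec.map (λ t → ⟦ t ⟧ η) zs))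
    Force-vals []       ρ h []       w = mk⇔ (λ _ → []) (λ _ {_} _ → id)
    Force-vals (t ∷ ts) ρ h (z ∷ zs) w = mk⇔
      (λ (a , b) → to (Force-val t ρ z (λ x∈ → h (∈-++⁺ˡ x∈)) refl w) a ∷
                   to (Force-vals ts ρ (λ x∈ → h (∈-++⁺ʳ (termVars t) x∈)) zs w) b)
      (λ { (a ∷ b) → from (Force-val t ρ z (λ x∈ → h (∈-++⁺ˡ x∈)) refl w) a ,
                     from (Force-vals ts ρ (λ x∈ → h (∈-++⁺ʳ (termVars t) x∈)) zs w) b })

    -- `Values` ranges over lists, the quantifier block over vectors as long as `ts`; relating the
    -- lists pointwise fixes the length.
    Values-toList : ∀ {ts θ rs} → Values ts θ rs → ∃ λ (ds : Vec Pre (length ts)) → rs ≡ toList ds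
    Values-toList []       = [] , refl
    Values-toList {rs = r ∷ _} (_ ∷ vs) = let ds , e = Values-toList vs in r ∷ ds , cong (r ∷_) e

    Force-freshVals : ∀ ts (ρ : Env Γ) {η θ} → Agree (concatMap termVars ts) ρ η θ → ∀ ds w →
      Force {σ} (vals ts (wkEnv* {Γ} (length ts) ρ) (freshVars {Γ} (length ts)))
                (extend* {Γ = Γ} ds η) w ⇔
      Values ts θ (toList ds)
    Force-freshVals {Γ = Γ} ts ρ {η} {θ} h ds w =
      ≡⇒⇔ (cong (λ ds → Values ts θ (toList ds)) (freshVars-value {Γ} ds η)) ⇔-∘
      Force-vals ts (wkEnv* {Γ} (length ts) ρ) (Agree-wk* {Γ} {ρ = ρ} ds h)
        (freshVars {Γ} (length ts)) w

    Force-withValues : ∀ ts (ρ : Env Γ) {η θ} → Agree (concatMap termVars ts) ρ η θ →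
      ∀ (F : List (Tm (Γ ▸* length ts) gen) → Formula σ (Γ ▸* length ts)) (Q : List Pre → Set) w →
      (∀ ds → Force (F (toList (freshVars {Γ} (length ts)))) (extend* {Γ = Γ} ds η) w ⇔
        Q (toList ds)) →
      Force {σ} (withValues ts ρ F) η w ⇔ (∃ λ ((rs , _) : ∃ (Values ts θ)) → Q rs)
    Force-withValues {Γ = Γ} {σ} ts ρ {η} {θ} h F Q w FQ = mk⇔
      (λ (ds , v , f) → (toList ds , to (Force-freshVals ts ρ h ds w) v) , to (FQ ds) f)
      (λ ((rs , vs) , q) → backward vs q) ⇔-∘ Force-ex* M (length ts) _ η w
      where
      backward : ∀ {rs} → Values ts θ rs → Q rs →
        ∃ λ ds → Force {σ} (vals ts (wkEnv* {Γ} (length ts) ρ) (freshVars {Γ} (length ts)) ∧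
                            F (toList (freshVars {Γ} (length ts)))) (extend* {Γ = Γ} ds η) w
      backward vs q with Values-toList vs
      ... | ds , refl = ds , from (Force-freshVals ts ρ h ds w) vs , from (FQ ds) q

    Force-freshPred : ∀ {Γ n} p (ds : Vec Pre n) (η : Valuation Γ) w →
      Force {σ} (pred p (toList (freshVars {Γ} n))) (extend* {Γ = Γ} ds η) w ⇔ at w (p , toList ds)
    Force-freshPred {σ} {Γ} p ds η w = ≡⇒⇔ (cong (λ rs → at w (p , rs))
      (trans (sym (Vec.toList-map _ _)) (cong toList (freshVars-value {Γ} ds η))))

    Force-comparison : ∀ c (t u : Tm Γ gen) {η} w →
                       Force {σ} (comparison c t u) η w ⇔ compareᶜ c (⟦ t ⟧ η) (⟦ u ⟧ η)
    Force-comparison eq      t u w = ⇔-id _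
    Force-comparison (rel c) t u w = ⇔-id _

    Force-τᴮ : ∀ K (ρ : Env Γ) {η θ} → Agree (conditionVars K) ρ η θ → ∀ w →
               Force {σ} (τᴮ ρ K) η w ⇔ (w ⊩ τ-condition θ K)
    Force-τᴮ {Γ} {σ} (pos (p , ts)) ρ {η} h w =
      Force-withValues ts ρ h (λ zs → pred p zs) (λ rs → at w (p , rs)) w λ ds →
        Force-freshPred {σ} {Γ} p ds η w
    Force-τᴮ {Γ} {σ} (not (p , ts)) ρ {η} h w =
      Force-withValues ts ρ h (λ zs → ¬ pred p zs) (λ rs → w ⊩ ¬ⁱ atomⁱ (p , rs)) w λ ds →
        ⇒-⇔ (Force-freshPred {σ} {Γ} p ds η) (λ _ → ⇔-id _) w
    Force-τᴮ {Γ} {σ} (notnot (p , ts)) ρ {η} h w =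
      Force-withValues ts ρ h (λ zs → ¬ ¬ pred p zs) (λ rs → w ⊩ ¬ⁱ ¬ⁱ atomⁱ (p , rs)) w λ ds →
        ⇒-⇔ (⇒-⇔ (Force-freshPred {σ} {Γ} p ds η) (λ _ → ⇔-id _)) (λ _ → ⇔-id _) w
    Force-τᴮ {Γ = Γ} {σ} (cmp c t u) ρ {η} {θ} h w = mk⇔
      (λ (r , s , a , b , d) →
        (r , s , to (left r s) a , to (right r s) b , to (compared r s) d) , λ ())
      (λ ((r , s , a , b , d) , _) →
        r , s , from (left r s) a , from (right r s) b , from (compared r s) d)
      where
      ρ² : Env (Γ ▸ gen ▸ gen)
      ρ² = wkEnv {Γ ▸ gen} gen (wkEnv gen ρ)
      η² : Pre → Pre → Valuation (Γ ▸ gen ▸ gen)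
      η² r s = extend {Γ ▸ gen} gen (extend {Γ} gen η r) s
      h² : ∀ {r s} → Agree (termVars t ++ termVars u) ρ² (η² r s) θ
      h² = Agree-wk {Γ ▸ gen} gen {ρ = wkEnv gen ρ} (Agree-wk {Γ} gen {ρ = ρ} h)
      left : ∀ r s → Force {σ} (val t ρ² (var (suc zero))) (η² r s) w ⇔ Value t θ r
      left r s = Force-val t ρ² _ (λ x∈ → h² (∈-++⁺ˡ x∈)) refl w
      right : ∀ r s → Force {σ} (val u ρ² (var zero)) (η² r s) w ⇔ Value u θ s
      right r s = Force-val u ρ² _ (λ x∈ → h² (∈-++⁺ʳ (termVars t) x∈)) refl w
      compared : ∀ r s → Force {σ} (comparison c (var (suc zero)) (var zero)) (η² r s) w ⇔
                 compareᶜ c r s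
      compared r s = Force-comparison c (var (suc zero)) (var zero) w

    Force-conj-⋀ᴸ : {A : Set} (f : A → Formula σ Γ) (g : A → InfFormula PreAtom) (xs : List A)
                    {η : Valuation Γ} → ∀ w → (∀ {x} → x ∈ xs → Force (f x) η w ⇔ (w ⊩ g x)) →
                    Force (conj (map f xs)) η w ⇔ (w ⊩ ⋀ᴸ g xs)
    Force-conj-⋀ᴸ f g xs {η} w e = mk⇔
      (λ h k → to (e (∈-lookup k)) (to (Force-conj M f xs η w) h (∈-lookup k)))
      (λ h → from (Force-conj M f xs η w) λ x∈xs →
        from (e x∈xs) (from (∀∈⇔∀lookup {B = λ x → w ⊩ g x}) h x∈xs))

    -- The blocks `V`, `X` and `W` together bind every variable of the element: one that is neither
    -- in `X` nor in `W` must be global, hence in `V`. So the arbitrary terms of `emptyEnv` are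
    -- never read.
    Force-member : ∀ gs E {θ} ds → (∀ k → Vec.lookup ds k ≡ θ (lookup (globalsIn gs E) k)) →
                   ∀ xs w →
      Force {σ₀} (ex* (length (localsIn gs E)) (conj (map
              (τᴮ (bind (localsIn gs E) (bind (Element.X E) (bind (globalsIn gs E) emptyEnv))))
              (Element.L E)))) (tuples ds xs) w ⇔
      (w ⊩ τ-member gs θ E xs)
    Force-member gs E {θ} ds h xs w =
      (∃-⇔ λ ws → Force-conj-⋀ᴸ (τᴮ ρ) (τ-condition (assign W ws (assign X xs θ))) L w λ {K} K∈L →
        Force-τᴮ K ρ (λ x∈K → agree ws (∈-deduplicate⁺ ℕ._≟_ (∈-concatMap conditionVars K∈L x∈K)))
          w)
      ⇔-∘ Force-ex* M (length W) (conj (map (τᴮ ρ) L)) (tuples ds xs) w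
      where
      open Element E
      V = globalsIn gs E
      W = localsIn gs E
      Γ₁ Γ₂ : Ctx
      Γ₁ = ∅ ▸* length V
      Γ₂ = Γ₁ ▸* length X
      ρ : Env (Γ₂ ▸* length W)
      ρ = bind {Γ₂} W (bind {Γ₁} X (bind {∅} V emptyEnv))
      agree : ∀ ws →
              Agree (elementVars E) ρ (extend* {Γ = Γ₂} ws (tuples ds xs))
                    (assign W ws (assign X xs θ))
      agree ws {x} x∈E = bind-assign {Γ₂} {W} ws λ x∉W → bind-assign {Γ₁} {X} xs λ x∉X →
        bind-Agree {∅} {V} ds h (global x∉W x∉X)
        where
        global : x ∉ W → x ∉ X → x ∈ V
        global x∉W x∉X with x ∈? gs
        ... | yes x∈gs = ∈-filter⁺ (_∈? gs) x∈E x∈gs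
        ... | no  x∉gs = ⊥-elim (x∉W
          (∈-filter⁺ (λ x → ¬? (x ∈? gs) ×-dec ¬? (x ∈? X)) x∈E (x∉gs , x∉X)))

    Force-body : ∀ gs B (ρ : Env Γ) {η θ} → Agree gs ρ η θ → (∀ {x} → x ∈ outerVars B → x ∈ gs) →
                 ∀ w →
                 Force (body* gs ρ B) η w ⇔ (w ⊩ τ-body gs θ B)
    Force-body gs (cond K) ρ h outer w = Force-τᴮ K ρ (λ x∈ → h (outer x∈)) w
    Force-body {Γ} gs (count b E t f) ρ {η} {θ} h outer w = shape b ⇔-∘ ∃-⇔ λ c →
      Force-val t (wkEnv gen ρ) _ (Agree-wk {Γ} gen {ρ = ρ} λ x∈ → h (outer x∈)) refl w ×-⇔
      Count-⇔ b (λ v xs → Force-member gs E (ds c) (ds-lookup c) xs v) w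
      where
      V = globalsIn gs E
      η⁺ : Pre → Valuation (Γ ▸ gen)
      η⁺ = extend {Γ} gen η
      -- The arguments of the count symbol stand under the quantifier for `C`, hence the weakened
      -- environment and the dependence on `c`; their values remain those under `θ`.
      ds : Pre → Vec Pre (length V)
      ds c = Vec.map (λ t → ⟦ t ⟧ (η⁺ c)) (Vec.map (wkEnv gen ρ) (fromList V))
      ds-lookup : ∀ c k → Vec.lookup (ds c) k ≡ θ (lookup V k)
      ds-lookup c k = begin
        Vec.lookup (ds c) k
          ≡⟨ Vec.lookup-map k (λ t → ⟦ t ⟧ (η⁺ c)) (Vec.map (wkEnv gen ρ) (fromList V)) ⟩
        ⟦ Vec.lookup (Vec.map (wkEnv gen ρ) (fromList V)) k ⟧ (η⁺ c)
          ≡⟨ cong (λ t → ⟦ t ⟧ (η⁺ c)) (Vec.lookup-map k (wkEnv gen ρ) (fromList V)) ⟩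
        ⟦ wkEnv gen ρ (Vec.lookup (fromList V) k) ⟧ (η⁺ c)
          ≡⟨ cong (λ x → ⟦ wkEnv gen ρ x ⟧ (η⁺ c)) (lookup-fromList V k) ⟩
        ⟦ wkEnv gen ρ (lookup V k) ⟧ (η⁺ c)
          ≡⟨ Agree-wk {Γ} gen {ρ = ρ} h
               (proj₂ (∈-filter⁻ (_∈? gs) {xs = elementVars E} (∈-lookup {xs = V} k))) ⟩
        θ (lookup V k)
          ∎
        where open ≡-Reasoning
      shape : ∀ b → (∃[ c ] Value t θ c × Count b (λ v xs → v ⊩ τ-member gs θ E xs) c w) ⇔
                    (w ⊩ τ-body gs θ (count b E t f))
      shape atLeast = mk⇔ (λ (c , v , n) → (c , v) , n) (λ ((c , v) , n) → c , v , n)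
      shape atMost  = mk⇔ (λ (c , v , n) → (c , v) , n) (λ ((c , v) , n) → c , v , n)

    -- Rules and programs

    module _ (gs : List Var) (B : List BodyElement)
             (outer : ∀ {b x} → b ∈ B → x ∈ outerVars b → x ∈ gs) where

      Force-bodies : ∀ (ρ : Env Γ) {η θ} → Agree gs ρ η θ → ∀ w →
                     Force (conj (map (body* gs ρ) B)) η w ⇔ (w ⊩ ⋀ᴸ (τ-body gs θ) B)
      Force-bodies ρ {η} {θ} h w = Force-conj-⋀ᴸ (body* gs ρ) (τ-body gs θ) B w λ {b} b∈B →
        Force-body gs b ρ h (outer b∈B) w

      -- The formula quantifies the values of the head arguments outside the implication, whereas
      -- the infinitary one takes a conjunction over them in its conclusion. The body does not
      -- mention these values, so the quantifier moves across it.
      Force-headed : ∀ (ρ : Env Γ) {η θ} → Agree gs ρ η θ →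
        ∀ ts → (∀ {x} → x ∈ concatMap termVars ts → x ∈ gs) →
        ∀ (G : List (Tm (Γ ▸* length ts) gen) → Formula σ₁ (Γ ▸* length ts))
          (Q : List Pre → InfFormula PreAtom) →
        (∀ ds w → Force (G (toList (freshVars {Γ} (length ts)))) (extend* {Γ = Γ} ds η) w ⇔
          (w ⊩ Q (toList ds))) →
        ∀ w →
        Force (all* (length ts) (conj (map (body* gs (wkEnv* {Γ} (length ts) ρ)) B) ∧
                vals ts (wkEnv* {Γ} (length ts) ρ) (freshVars {Γ} (length ts)) ⇒
                G (toList (freshVars {Γ} (length ts))))) η w ⇔
        (w ⊩ (⋀ᴸ (τ-body gs θ) B ⇒ⁱ ⋀ {I = ∃ (Values ts θ)} λ (rs , _) → Q rs))
      Force-headed {Γ} ρ {η} {θ} h ts ts-global G Q GQ w = mk⇔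
        (λ f {v} w≼v b (rs , vs) → forward f w≼v b vs)
        (λ f ds {v} w≼v (b , vs) → from (GQ ds v)
          (f w≼v (to (bodies ds v) b) (toList ds , to (values ds v) vs)))
        ⇔-∘ Force-all* M (length ts) _ η w
        where
        ρ* : Env (Γ ▸* length ts)
        ρ* = wkEnv* {Γ} (length ts) ρ
        zs : Vec (Tm (Γ ▸* length ts) gen) (length ts)
        zs = freshVars {Γ} (length ts)
        η* : Vec Pre (length ts) → Valuation (Γ ▸* length ts)
        η* ds = extend* {Γ = Γ} ds η
        bodies : ∀ ds v → Force (conj (map (body* gs ρ*) B)) (η* ds) v ⇔ (v ⊩ ⋀ᴸ (τ-body gs θ) B)
        bodies ds = Force-bodies ρ* (Agree-wk* {Γ} {ρ = ρ} ds h)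
        values : ∀ ds v → Force {σ₁} (vals ts ρ* zs) (η* ds) v ⇔ Values ts θ (toList ds)
        values = Force-freshVals ts ρ (λ x∈ → h (ts-global x∈))
        forward : (∀ ds → Upwards (λ v →
                    Force (conj (map (body* gs ρ*) B)) (η* ds) v ×
                      Force {σ₁} (vals ts ρ* zs) (η* ds) v →
                    Force (G (toList zs)) (η* ds) v) w) →
                  ∀ {v} → w ≼ v → v ⊩ ⋀ᴸ (τ-body gs θ) B → ∀ {rs} → Values ts θ rs → v ⊩ Q rs
        forward f {v} w≼v b vs with Values-toList vs
        ... | ds , refl = to (GQ ds v) (f ds w≼v (from (bodies ds v) b , from (values ds v) vs))

    -- An assignment covers all variables, the quantifier block only `xs`. Given `θ`, the block is
    -- filled with its values on `xs`; given a block, the assignment is the evaluated environment,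
    -- found by unification, and agreement holds by `refl`.
    Force-closure : ∀ xs (F : Formula σ (∅ ▸* length xs)) (Q : Assignment → InfFormula PreAtom) w →
                    (∀ η θ → Agree xs (bind {∅} xs emptyEnv) η θ → Force F η w ⇔ (w ⊩ Q θ)) →
                    Force (all* (length xs) F) emptyValuation w ⇔ (w ⊩ ⋀ Q)
    Force-closure xs F Q w FQ = mk⇔
      (λ f θ → to (FQ (extend* {Γ = ∅} (Vec.map θ (fromList xs)) emptyValuation) θ
        (bind-Agree {∅} {xs} (Vec.map θ (fromList xs)) λ k →
          trans (Vec.lookup-map k θ (fromList xs)) (cong θ (lookup-fromList xs k))))
            (f (Vec.map θ (fromList xs))))
      (λ f ds → from (FQ (extend* {Γ = ∅} ds emptyValuation) _ λ _ → refl) (f _))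
      ⇔-∘ Force-all* M (length xs) F emptyValuation w

    Force-excluded-middle : ∀ {F : Formula σ Γ} {G : InfFormula PreAtom} {η : Valuation Γ} →
                            (∀ w → Force F η w ⇔ (w ⊩ G)) →
                            ∀ w → Force (F ∨ ¬ F) η w ⇔ (w ⊩ (G ∨ⁱ ¬ⁱ G))
    Force-excluded-middle {F = F} {G} {η} e w = mk⇔
      (λ { (inj₁ f) → true , to (e w) f ; (inj₂ f) → false , to (negated w) f })
      (λ { (true , g) → inj₁ (from (e w) g) ; (false , g) → inj₂ (from (negated w) g) })
      where
      negated : ∀ w → Force (¬ F) η w ⇔ (w ⊩ ¬ⁱ G)
      negated = ⇒-⇔ e (λ _ → ⇔-id _)

    Force-rule : ∀ R w → Force (rule* R) emptyValuation w ⇔ (w ⊩ τ-rule R)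
    Force-rule R@(basic (p , ts) ← B) w = Force-closure (globals R) _
      (λ θ → ⋀ᴸ (τ-body (globals R) θ) B ⇒ⁱ τ-head θ (basic (p , ts))) w λ η θ h →
      Force-headed (globals R) B (outer-global R) (bind {∅} (globals R) emptyEnv) h ts
        (head-global R) (λ zs → pred p zs) (λ rs → atomⁱ (p , rs))
        (λ ds v → Force-freshPred {σ₁} {∅ ▸* length (globals R)} p ds η v) w
    Force-rule R@(choice (p , ts) ← B) w = Force-closure (globals R) _
      (λ θ → ⋀ᴸ (τ-body (globals R) θ) B ⇒ⁱ τ-head θ (choice (p , ts))) w λ η θ h →
      Force-headed (globals R) B (outer-global R) (bind {∅} (globals R) emptyEnv) h ts
        (head-global R)
        (λ zs → pred p zs ∨ ¬ pred p zs) (λ rs → atomⁱ (p , rs) ∨ⁱ ¬ⁱ atomⁱ (p , rs))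
        (λ ds → Force-excluded-middle {σ₁} {F = pred p _} {atomⁱ (p , toList ds)}
          (Force-freshPred {σ₁} {∅ ▸* length (globals R)} p ds η)) w
    Force-rule R@(constraint ← B) w = Force-closure (globals R) _
      (λ θ → ⋀ᴸ (τ-body (globals R) θ) B ⇒ⁱ τ-head θ (constraint)) w λ η θ h →
      ⇒-⇔ (Force-bodies (globals R) B (outer-global R) (bind {∅} (globals R) emptyEnv) h)
        (λ _ → ⇔-id _) w

    Force-program : ∀ Π w → Force (τ* Π) emptyValuation w ⇔ (w ⊩ τ Π)
    Force-program Π w = Force-conj-⋀ᴸ (λ R → rule* (proj₁ R)) (λ R → τ-rule (proj₁ R)) Π w
      λ {R} _ → Force-rule (proj₁ R) w

  -- Strong equivalence

  ⊨ⁱ-ext : ∀ {I J : Pred PreAtom 0ℓ} → I ⊆ J → J ⊆ I → ∀ F → (I ⊨ⁱ F) ⇔ (J ⊨ⁱ F)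
  ⊨ⁱ-ext I⊆J J⊆I (atomⁱ a) = mk⇔ I⊆J J⊆I
  ⊨ⁱ-ext I⊆J J⊆I ⊥ⁱ        = ⇔-id _
  ⊨ⁱ-ext I⊆J J⊆I (⋀ F)     = Π-⇔ λ k → ⊨ⁱ-ext I⊆J J⊆I (F k)
  ⊨ⁱ-ext I⊆J J⊆I (⋁ F)     = ∃-⇔ λ k → ⊨ⁱ-ext I⊆J J⊆I (F k)
  ⊨ⁱ-ext I⊆J J⊆I (F ⇒ⁱ G)  = →-⇔ (⊨ⁱ-ext I⊆J J⊆I F) (⊨ⁱ-ext I⊆J J⊆I G)

  module _ (M : Interpretation) where

    open Interpretation M

    there-⊨ : ∀ F → (there ⊩ F) ⇔ (I ⊨ⁱ F)
    there-⊨ (atomⁱ a) = ⇔-id _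
    there-⊨ ⊥ⁱ        = ⇔-id _
    there-⊨ (⋀ F)     = Π-⇔ λ k → there-⊨ (F k)
    there-⊨ (⋁ F)     = ∃-⇔ λ k → there-⊨ (F k)
    there-⊨ (F ⇒ⁱ G)  = mk⇔
      (λ h f → to (there-⊨ G) (h ≼-refl (from (there-⊨ F) f)))
      (λ { h ≼-refl f → from (there-⊨ G) (h (to (there-⊨ F) f)) })

    -- For an implication true in `I` the condition at `there` is met, and the reduct expresses the
    -- one at `w`. For one false in `I` the reduct is absurd, and forcing fails at `there`, hence at
    -- `w`. For `w = there` this covers `I` as a candidate model of its own reduct.
    reduct-⊩ : ∀ w F → (at w ⊨ⁱ reduct em I F) ⇔ (w ⊩ F)
    reduct-⊩ w (atomⁱ a) with em {P = I a}
    ... | yes _  = ⇔-id _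
    ... | no ¬Ia = mk⇔ ⊥-elim (λ wa → ¬Ia (at-mono {w} ≼-there wa))
    reduct-⊩ w ⊥ⁱ        = ⇔-id _
    reduct-⊩ w (⋀ F)     = Π-⇔ λ k → reduct-⊩ w (F k)
    reduct-⊩ w (⋁ F)     = ∃-⇔ λ k → reduct-⊩ w (F k)
    reduct-⊩ w (F ⇒ⁱ G) with em {P = I ⊨ⁱ (F ⇒ⁱ G)}
    ... | no ¬I⊨  =
      mk⇔ ⊥-elim (λ (h : w ⊩ (F ⇒ⁱ G)) → ¬I⊨ (to (there-⊨ (F ⇒ⁱ G)) (⊩-mono (F ⇒ⁱ G) ≼-there h)))
    ... | yes I⊨ = mk⇔
      (λ { h ≼-refl f     → to (reduct-⊩ w G) (h (from (reduct-⊩ w F) f))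
         ; h here≼there f → from (there-⊨ G) (I⊨ (to (there-⊨ F) f)) })
      (λ h f → from (reduct-⊩ w G) (h ≼-refl (to (reduct-⊩ w F) f)))

  interpretation : ∀ (J I : Pred PreAtom 0ℓ) → J ⊆ I → Interpretation
  interpretation J I J⊆I = record { H = J ; I = I ; H⊆I = J⊆I }

  SameForcing : InfFormula PreAtom → InfFormula PreAtom → Set₁
  SameForcing F G = ∀ M w → Interpretation._⊩_ M w F ⇔ Interpretation._⊩_ M w G

  SameStableExtensions : InfFormula PreAtom → InfFormula PreAtom → Set₂
  SameStableExtensions F G = (Φ : Theory {PreAtom}) → SameStableModels em (｛ F ｝ ∪ Φ) (｛ G ｝ ∪ Φ)

  forcing⇒stable : ∀ {F G} → SameForcing F G → ∀ (Φ : Theory {PreAtom}) I →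
                   Stable em (｛ F ｝ ∪ Φ) I → Stable em (｛ G ｝ ∪ Φ) I
  forcing⇒stable {F} {G} e Φ I (model , minimal) =
    transfer e id model , λ J J⊆I model′ →
      minimal J J⊆I (transfer (λ M w → ⇔-sym (e M w)) J⊆I model′)
    where
    transfer : ∀ {F G} → SameForcing F G → ∀ {J} → J ⊆ I →
               ModelsReduct em I (｛ F ｝ ∪ Φ) J → ModelsReduct em I (｛ G ｝ ∪ Φ) J
    transfer {F} e {J} J⊆I model G (inj₁ refl) = from (reduct-⊩ M here G)
      (to (e M here) (to (reduct-⊩ M here F) (model F (inj₁ refl))))
      where M = interpretation J I J⊆I
    transfer e J⊆I model G (inj₂ ΦG) = model G (inj₂ ΦG)

  -- If I does not satisfy G, adding the atoms of I to both sides separates F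
  -- from G.  Otherwise add the atoms of J and all implications from an element
  -- of I ∖ J to an element of I: then J is the only possible witness of the
  -- non-minimality of I.
  stable⇒reduct : ∀ {F G} → SameStableExtensions F G → ∀ {I J} → J ⊆ I →
                  J ⊨ⁱ reduct em I F → J ⊨ⁱ reduct em I G
  stable⇒reduct {F} {G} e {I} {J} J⊆I J⊨F = decidable-stable em separate
    where
    M = interpretation J I J⊆I
    total = interpretation I I id

    I⊨F : I ⊨ⁱ reduct em I F
    I⊨F = from (reduct-⊩ M there F) (Interpretation.⊩-mono M F ≼-there (to (reduct-⊩ M here F) J⊨F))

    atomsOf : Pred PreAtom 0ℓ → Theory {PreAtom}
    atomsOf K F = ∃[ a ] K a × F ≡ atomⁱ a

    implications : Theory {PreAtom}
    implications F = ∃[ a ] ∃[ b ] Not (J a) × I b × F ≡ (atomⁱ a ⇒ⁱ atomⁱ b)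

    separate : Not (Not (J ⊨ⁱ reduct em I G))
    separate ¬J⊨G with em {P = I ⊨ⁱ reduct em I G}
    ... | no ¬I⊨G = ¬I⊨G (proj₁ (to (e (atomsOf I) I) (model , minimal)) G (inj₁ refl))
      where
      model : ModelsReduct em I (｛ F ｝ ∪ atomsOf I) I
      model _ (inj₁ refl)            = I⊨F
      model _ (inj₂ (a , Ia , refl)) = from (reduct-⊩ total here (atomⁱ a)) Ia
      minimal : ∀ K → K ⊆ I → ModelsReduct em I (｛ F ｝ ∪ atomsOf I) K → I ⊆ K
      minimal K K⊆I K⊨ {a} Ia =
        to (reduct-⊩ (interpretation K I K⊆I) here (atomⁱ a)) (K⊨ _ (inj₂ (a , Ia , refl)))
    ... | yes I⊨G =
      -- `I` is stable for `G` with `Φ`, hence for `F` with `Φ`. As `J` models the reduct of the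
      -- latter, minimality gives `I ⊆ J`; so `J` has the same atoms as `I` and satisfies the reduct
      -- of `G` after all.
      ¬J⊨G (to (⊨ⁱ-ext {I} {J} (proj₂ (from (e Φ I) (model , minimal)) J J⊆I J⊨) J⊆I
        (reduct em I G)) I⊨G)
      where
      Φ : Theory {PreAtom}
      Φ = atomsOf J ∪ implications
      model : ModelsReduct em I (｛ G ｝ ∪ Φ) I
      model _ (inj₁ refl) = I⊨G
      model _ (inj₂ (inj₁ (a , Ja , refl))) = from (reduct-⊩ total here (atomⁱ a)) (J⊆I Ja)
      model _ (inj₂ (inj₂ (a , b , _ , Ib , refl))) =
        from (reduct-⊩ total here (atomⁱ a ⇒ⁱ atomⁱ b))
        λ w≼v _ → Interpretation.at-mono total w≼v Ib
      minimal : ∀ K → K ⊆ I → ModelsReduct em I (｛ G ｝ ∪ Φ) K → I ⊆ K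
      minimal K K⊆I K⊨ {b} Ib with em {P = ∃[ a ] K a × Not (J a)}
      ... | yes (a , Ka , ¬Ja) =
        to (reduct-⊩ (interpretation K I K⊆I) here (atomⁱ a ⇒ⁱ atomⁱ b))
          (K⊨ _ (inj₂ (inj₂ (a , b , ¬Ja , Ib , refl)))) ≼-refl Ka
      ... | no K∖J-empty =
        ⊥-elim (¬J⊨G (to (⊨ⁱ-ext {K} {J} K⊆J J⊆K (reduct em I G)) (K⊨ G (inj₁ refl))))
        where
        K⊆J : K ⊆ J
        K⊆J {a} Ka = decidable-stable em λ ¬Ja → K∖J-empty (a , Ka , ¬Ja)
        J⊆K : J ⊆ K
        J⊆K {a} Ja =
          to (reduct-⊩ (interpretation K I K⊆I) here (atomⁱ a)) (K⊨ _ (inj₂ (inj₁ (a , Ja , refl))))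
      J⊨ : ModelsReduct em I (｛ F ｝ ∪ Φ) J
      J⊨ _ (inj₁ refl) = J⊨F
      J⊨ _ (inj₂ (inj₁ (a , Ja , refl))) = from (reduct-⊩ M here (atomⁱ a)) Ja
      J⊨ _ (inj₂ (inj₂ (a , b , ¬Ja , Ib , refl))) = from (reduct-⊩ M here (atomⁱ a ⇒ⁱ atomⁱ b))
        λ { ≼-refl Ja → ⊥-elim (¬Ja Ja) ; here≼there _ → Ib }

  forcing⇔stable : ∀ F G → SameForcing F G ⇔ SameStableExtensions F G
  forcing⇔stable F G = mk⇔
    (λ e Φ I → mk⇔ (forcing⇒stable e Φ I) (forcing⇒stable (λ M w → ⇔-sym (e M w)) Φ I))
    (λ e M w → mk⇔ (half e M w) (half (λ Φ I → ⇔-sym (e Φ I)) M w))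
    where
    half : ∀ {F G} → SameStableExtensions F G →
           ∀ M w → Interpretation._⊩_ M w F → Interpretation._⊩_ M w G
    half {F} {G} e M w h = to (reduct-⊩ M w G)
      (stable⇒reduct e (λ {a} → Interpretation.at-mono M {w} ≼-there {a}) (from (reduct-⊩ M w F) h))

  -- Enumeration of the sentences

  module _ {A B : Set} (f : A → ℕ) (g : A → B) (default : B) where

    -- Countability is given by an injection into the numbers, enumeration needs a map out of them:
    -- excluded middle finds a preimage. The result lies in `B`, which has a default even when `A`
    -- is empty.
    decode : ℕ → B
    decode n with em {P = ∃[ x ] f x ≡ n}
    ... | yes (x , _) = g x
    ... | no  _       = default

    decode-code : (∀ {x y} → f x ≡ f y → x ≡ y) → ∀ x → decode (f x) ≡ g x
    decode-code injective x with em {P = ∃[ y ] f y ≡ f x}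
    ... | yes (y , e) = cong g (injective e)
    ... | no  ¬∃      = ⊥-elim (¬∃ (x , refl))

  module Sym = Injection Symbol-countable
  module Oth = Injection Other-countable

  anyTm : ∀ {Γ} s → Tm Γ s
  anyTm gen = int (num 0ℤ)
  anyTm int = num 0ℤ

  -- The left leaf is a tag for the constructor; the sort is known, so tags are reused across sorts.
  -- Trees that code nothing may decode to anything, as only surjectivity matters.
  decodeTm : ∀ Γ s → Tree → Tm Γ s
  decodeTm Γ s   (leaf 0 ∙ leaf k) = decode Fin.toℕ var (anyTm s) k
  decodeTm Γ gen (leaf 1 ∙ leaf k) = decode Sym.to (con ∘ inj₁) (anyTm gen) k
  decodeTm Γ gen (leaf 2 ∙ leaf k) = decode Oth.to (con ∘ inj₂) (anyTm gen) k
  decodeTm Γ gen (leaf 3 ∙ t)      = int (decodeTm Γ int t)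
  decodeTm Γ int (leaf 1 ∙ leaf n) = num (+ n)
  decodeTm Γ int (leaf 2 ∙ leaf n) = num -[1+ n ]
  decodeTm Γ int (leaf 3 ∙ t)      = abs (decodeTm Γ int t)
  decodeTm Γ int (leaf 4 ∙ (leaf o ∙ (t ∙ u))) =
    arith (decodeOp o) (decodeTm Γ int t) (decodeTm Γ int u)
  decodeTm Γ s   _                 = anyTm s

  decodeTm-surjective : ∀ {Γ s} → StrictlySurjective _≡_ (decodeTm Γ s)
  decodeTm-surjective {s = s} (var k) =
    leaf 0 ∙ leaf (Fin.toℕ k) , decode-code Fin.toℕ var (anyTm s) (Fin.toℕ-injective) k
  decodeTm-surjective (con (inj₁ p)) =
    leaf 1 ∙ leaf (Sym.to p) , decode-code Sym.to _ _ Sym.injective p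
  decodeTm-surjective (con (inj₂ p)) =
    leaf 2 ∙ leaf (Oth.to p) , decode-code Oth.to _ _ Oth.injective p
  decodeTm-surjective (int t) = let u , h = decodeTm-surjective t in leaf 3 ∙ u , cong int h
  decodeTm-surjective (num (+ n)) = leaf 1 ∙ leaf n , refl
  decodeTm-surjective (num -[1+ n ]) = leaf 2 ∙ leaf n , refl
  decodeTm-surjective (abs t) = let u , h = decodeTm-surjective t in leaf 3 ∙ u , cong abs h
  decodeTm-surjective (arith op t u)
    with decodeOp-surjective op | decodeTm-surjective t | decodeTm-surjective u
  ... | o , refl | a , refl | b , refl = leaf 4 ∙ (leaf o ∙ (a ∙ b)) , refl

  -- Recursion is on the tree, with signature and context varying: a count symbol switches to `σ₀`
  -- and to the context given by the stored numbers `x` and `v`.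
  decodeFormula : ∀ σ Γ → Tree → Formula σ Γ
  decodeFormula σ Γ (leaf 0 ∙ (leaf p ∙ ts)) =
    decode Sym.to (λ p → pred p (decodeList (decodeTm Γ gen) ts)) ⊥ᶠ p
  decodeFormula σ Γ (leaf 1 ∙ (leaf c ∙ (t ∙ u))) =
    rel (decodeRelation c) (decodeTm Γ gen t) (decodeTm Γ gen u)
  decodeFormula σ Γ (leaf 2 ∙ (t ∙ u)) = decodeTm Γ gen t ≈ decodeTm Γ gen u
  decodeFormula σ Γ (leaf 3 ∙ (t ∙ u)) = decodeFormula σ Γ t ∧ decodeFormula σ Γ u
  decodeFormula σ Γ (leaf 4 ∙ (t ∙ u)) = decodeFormula σ Γ t ∨ decodeFormula σ Γ u
  decodeFormula σ Γ (leaf 5 ∙ (t ∙ u)) = decodeFormula σ Γ t ⇒ decodeFormula σ Γ u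
  decodeFormula σ Γ (leaf 6 ∙ t) = all gen (decodeFormula σ (Γ ▸ gen) t)
  decodeFormula σ Γ (leaf 7 ∙ t) = all int (decodeFormula σ (Γ ▸ int) t)
  decodeFormula σ Γ (leaf 8 ∙ t) = ex gen (decodeFormula σ (Γ ▸ gen) t)
  decodeFormula σ Γ (leaf 9 ∙ t) = ex int (decodeFormula σ (Γ ▸ int) t)
  decodeFormula σ₁ Γ (leaf 10 ∙ (leaf b ∙ ((leaf x ∙ leaf v) ∙ (t ∙ (vs ∙ r))))) =
    count (decodeBound b) x (decodeFormula σ₀ (∅ ▸* v ▸* x) t)
          (decodeVec (decodeTm Γ gen) v vs) (decodeTm Γ gen r)
  -- The catch-all is also the clause for `⊥ᶠ` itself, coded by `leaf 0`.
  decodeFormula σ Γ _ = ⊥ᶠ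

  decodeFormula-surjective : ∀ {σ Γ} → StrictlySurjective _≡_ (decodeFormula σ Γ)
  decodeFormula-surjective (pred p ts) =
    let t , h = decodeList-surjective decodeTm-surjective ts in
    leaf 0 ∙ (leaf (Sym.to p) ∙ t) ,
      trans (decode-code Sym.to _ _ Sym.injective p) (cong (pred p) h)
  decodeFormula-surjective (rel c t u)
    with decodeRelation-surjective c | decodeTm-surjective t | decodeTm-surjective u
  ... | o , refl | a , refl | b , refl = leaf 1 ∙ (leaf o ∙ (a ∙ b)) , refl
  decodeFormula-surjective (t ≈ u) with decodeTm-surjective t | decodeTm-surjective u
  ... | a , refl | b , refl = leaf 2 ∙ (a ∙ b) , refl
  decodeFormula-surjective (count b x {v} F vs r)
    with decodeBound-surjective b | decodeFormula-surjective F
      | decodeVec-surjective decodeTm-surjective vs | decodeTm-surjective r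
  ... | c , refl | f , refl | us , refl | u , refl =
    leaf 10 ∙ (leaf c ∙ ((leaf x ∙ leaf v) ∙ (f ∙ (us ∙ u)))) , refl
  decodeFormula-surjective ⊥ᶠ = leaf 0 , refl
  decodeFormula-surjective (F ∧ G) with decodeFormula-surjective F | decodeFormula-surjective G
  ... | a , refl | b , refl = leaf 3 ∙ (a ∙ b) , refl
  decodeFormula-surjective (F ∨ G) with decodeFormula-surjective F | decodeFormula-surjective G
  ... | a , refl | b , refl = leaf 4 ∙ (a ∙ b) , refl
  decodeFormula-surjective (F ⇒ G) with decodeFormula-surjective F | decodeFormula-surjective G
  ... | a , refl | b , refl = leaf 5 ∙ (a ∙ b) , refl
  decodeFormula-surjective (all gen F) =
    let t , h = decodeFormula-surjective F in leaf 6 ∙ t , cong (all gen) h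
  decodeFormula-surjective (all int F) =
    let t , h = decodeFormula-surjective F in leaf 7 ∙ t , cong (all int) h
  decodeFormula-surjective (ex gen F) =
    let t , h = decodeFormula-surjective F in leaf 8 ∙ t , cong (ex gen) h
  decodeFormula-surjective (ex int F) =
    let t , h = decodeFormula-surjective F in leaf 9 ∙ t , cong (ex int) h

  sentence : ℕ → Formula σ₁ ∅
  sentence = decodeFormula σ₁ ∅ ∘ tree

  sentence-surjective : StrictlySurjective _≡_ sentence
  sentence-surjective F =
    let t , h = decodeFormula-surjective F ; n , k = tree-surjective t
    in n , trans (cong (decodeFormula σ₁ ∅) k) h

  -- Derived rules

  weaken : Θ ⊆ᴸ Θ′ → Θ ⊢ A → Θ′ ⊢ A
  weaken i (assume A∈Θ)  = assume (i A∈Θ)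
  weaken i (⊥E d)        = ⊥E (weaken i d)
  weaken i (∧I d e)      = ∧I (weaken i d) (weaken i e)
  weaken i (∧E₁ d)       = ∧E₁ (weaken i d)
  weaken i (∧E₂ d)       = ∧E₂ (weaken i d)
  weaken i (∨I₁ d)       = ∨I₁ (weaken i d)
  weaken i (∨I₂ d)       = ∨I₂ (weaken i d)
  weaken i (∨E d e f)    = ∨E (weaken i d) (weaken (∷⁺ʳ _ i) e) (weaken (∷⁺ʳ _ i) f)
  weaken i (⇒I d)        = ⇒I (weaken (∷⁺ʳ _ i) d)
  weaken i (⇒E d e)      = ⇒E (weaken i d) (weaken i e)
  weaken i (∀I s d)      = ∀I s (weaken (map⁺ (ren (wk s)) i) d)
  weaken i (∀E d t)      = ∀E (weaken i d) t
  weaken i (∃I t d)      = ∃I t (weaken i d)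
  weaken i (∃E d e)      = ∃E (weaken i d) (weaken (∷⁺ʳ _ (map⁺ (ren (wk _)) i)) e)
  weaken i (≈I t)        = ≈I t
  weaken i (≈E F d e)    = ≈E F (weaken i d) (weaken i e)
  weaken i (hosoi F G)   = hosoi F G
  weaken i (sqht s F)    = sqht s F
  weaken i (std F S)     = std F S
  weaken i (defs F D)    = defs F D
  weaken i (ω-gen d)     = ω-gen λ r → weaken i (d r)
  weaken i (ω-int d)     = ω-int λ n → weaken i (d n)

  v₀ : A ∷ Θ ⊢ A
  v₀ = assume (here refl)

  v₁ : B ∷ A ∷ Θ ⊢ A
  v₁ = assume (there (here refl))

  v₂ : C ∷ B ∷ A ∷ Θ ⊢ A
  v₂ = assume (there (there (here refl)))

  v₃ : ∀ {D} → D ∷ C ∷ B ∷ A ∷ Θ ⊢ A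
  v₃ = assume (there (there (there (here refl))))

  v₄ : ∀ {D E} → E ∷ D ∷ C ∷ B ∷ A ∷ Θ ⊢ A
  v₄ = assume (there (there (there (there (here refl)))))

  wk¹ : Θ ⊢ B → A ∷ Θ ⊢ B
  wk¹ = weaken there

  tm : ∀ s → Dom s → Tm Γ s
  tm gen = preTm
  tm int = num

  ⟦⟧-tm : ∀ s d {η : Valuation Γ} → ⟦ tm s d ⟧ η ≡ d
  ⟦⟧-tm gen r = ⟦⟧-preTm r
  ⟦⟧-tm int n = refl

  ω : ∀ s {A : Formula σ₁ (Γ ▸ s)} → (∀ d → Θ ⊢ A [ tm s d ]) → Θ ⊢ all s A
  ω gen = ω-gen
  ω int = ω-int

  wk-instance : ∀ s (A : Formula σ Γ) {t} → ren (wk s) A [ t ] ≡ A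
  wk-instance {Γ = Γ} s A {t} = begin
    ren (wk s) A [ t ]
      ≡⟨ cong _[ t ] (ren-as-subst {ρ = wk s} (λ _ _ → refl) A) ⟩
    subst (λ s′ k → var (wk {Γ} s s′ k)) A [ t ]
      ≡⟨ subst-subst {υ = λ _ → var} (extendSub-wk {Γ} s) A ⟩
    subst (λ _ → var) A                            ≡⟨ subst-id (λ _ _ → refl) A ⟩
    A                                              ∎
    where open ≡-Reasoning

  zeroVar-instance : ∀ s (A : Formula σ (Γ ▸ s)) → ren (liftRen s (wk s)) A [ zeroVar s ] ≡ A
  zeroVar-instance {Γ = Γ} s A = begin
    ren (liftRen s (wk s)) A [ zeroVar s ]
      ≡⟨ cong _[ zeroVar s ] (ren-as-subst {ρ = liftRen s (wk s)} (λ _ _ → refl) A) ⟩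
    subst (λ s′ k → var (liftRen s (wk {Γ} s) s′ k)) A [ zeroVar s ]
      ≡⟨ subst-subst {υ = λ _ → var} (variables s) A ⟩
    subst (λ _ → var) A
      ≡⟨ subst-id (λ _ _ → refl) A ⟩
    A                                                                  ∎
    where
    open ≡-Reasoning
    variables : ∀ s s′ k →
                extendSub {Γ ▸ s} s (λ _ → var) (zeroVar s) s′ (liftRen s (wk {Γ} s) s′ k) ≡ var k
    variables gen gen zero    = refl
    variables gen gen (suc k) = refl
    variables gen int k       = refl
    variables int gen k       = refl
    variables int int zero    = refl
    variables int int (suc k) = refl

  -- The ω-rules introduce universal quantifiers only. Applied to `A ⇒ C` with `C` weakened, they
  -- turn into an elimination rule for `ex` with one premise for each element of the domain in place
  -- of a fresh variable.
  ω-∃ : ∀ {s} {A : Formula σ₁ (Γ ▸ s)} → Θ ⊢ ex s A → (∀ d → A [ tm s d ] ∷ Θ ⊢ C) → Θ ⊢ C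
  ω-∃ {Γ} {Θ} {C} {s} {A} e d = ⇒E (⇒I (∃E (wk¹ e) (⇒E case v₀))) generic
    where
    generic : Θ ⊢ all s (A ⇒ ren (wk s) C)
    generic = ω s λ d′ → transport (λ C → Θ ⊢ A [ tm s d′ ] ⇒ C) (sym (wk-instance s C)) (⇒I (d d′))
    case : A ∷ map (ren (wk s)) (all s (A ⇒ ren (wk s) C) ∷ Θ) ⊢ A ⇒ ren (wk s) C
    case = transport (A ∷ map (ren (wk s)) (all s (A ⇒ ren (wk s) C) ∷ Θ) ⊢_)
      (zeroVar-instance s (A ⇒ ren (wk s) C)) (∀E v₁ (zeroVar s))

  -- Replacement of closed terms

  sub* : ∀ {Γ n} → Vec (Tm Γ gen) n → Sub (Γ ▸* n) Γ
  sub*         []       = λ _ → var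
  sub* {Γ = Γ} (t ∷ ts) = extendSub {Γ ▸* _} gen (sub* ts) t

  sub*-new : ∀ {Γ n} (ts : Vec (Tm Γ gen) n) k → sub* ts gen (k ↑ˡ proj₁ Γ) ≡ Vec.lookup ts k
  sub*-new (t ∷ ts) zero    = refl
  sub*-new (t ∷ ts) (suc k) = sub*-new ts k

  module _ {Θ : List (Formula σ₁ ∅)} where

    std-true : ∀ A → NoPred A → (∀ I → Sat I A emptyValuation) → Θ ⊢ embed A
    std-true A p h = transport (Θ ⊢_) (ren-closed (embed A)) (std A (p , h))

    renTm-∅-subTm : {θ : Sub Γ ∅} (t : Tm ∅ s) → subTm θ (renTm ∅-ren t) ≡ t
    renTm-∅-subTm t =
      trans (subTm-renTm {υ = λ _ → var} (λ { gen () ; int () }) t) (subTm-id (λ _ _ → refl) t)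

    -- Closed terms with the same value are provably equal by `Std`, but `≈E` replaces at one
    -- variable at a time. The head is replaced with the tail already substituted; then the new head
    -- is absorbed into the formula, and the tail is treated recursively.
    replace-terms : ∀ {n} (F : Formula σ₁ (∅ ▸* n)) ts us →
                    Vec.map (λ t → ⟦ t ⟧ emptyValuation) ts ≡
                    Vec.map (λ t → ⟦ t ⟧ emptyValuation) us →
                    Θ ⊢ subst (sub* ts) F → Θ ⊢ subst (sub* us) F
    replace-terms F []       []       e d = d
    replace-terms {suc n} F (t ∷ ts) (u ∷ us) e d =
      transport (Θ ⊢_) (first us) (replace-terms (F [ renTm ∅-ren u ]) ts us (Vec.∷-injectiveʳ e)
        (transport (Θ ⊢_) (sym (first ts))
          (transport (Θ ⊢_) (rest u)
            (≈E {s = gen} (subst (liftSub gen (sub* ts)) F)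
              (std-true (t ≈ u) tt (λ _ → Vec.∷-injectiveˡ e))
              (transport (Θ ⊢_) (sym (rest t)) d)))))
      where
      first : ∀ ts → subst (sub* ts) (F [ renTm ∅-ren u ]) ≡ subst (sub* (u ∷ ts)) F
      first ts = subst-subst (extendSub-cong gen (renTm-∅-subTm u) (λ _ _ → refl)) F
      rest : ∀ v → subst (liftSub gen (sub* ts)) F [ v ] ≡ subst (sub* (v ∷ ts)) F
      rest v = instantiate-lift {Γ = ∅ ▸* n} {s = gen} (λ _ _ → refl) F

    replace-pred : ∀ p {n} (ts us : Vec (Tm ∅ gen) n) →
                   Vec.map (λ t → ⟦ t ⟧ emptyValuation) ts ≡
                   Vec.map (λ t → ⟦ t ⟧ emptyValuation) us →
                   Θ ⊢ pred p (toList ts) → Θ ⊢ pred p (toList us)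
    replace-pred p {n} ts us e d = transport (Θ ⊢_) (arguments us)
      (replace-terms (pred p (toList (freshVars {∅} n))) ts us e
        (transport (Θ ⊢_) (sym (arguments ts)) d))
      where
      arguments : ∀ ts →
                  subst {σ₁} (sub* ts) (pred p (toList (freshVars {∅} n))) ≡ pred p (toList ts)
      arguments ts = cong (pred p) (trans (sym (Vec.toList-map (subTm (sub* ts)) (freshVars {∅} n)))
        (cong toList
          (trans (sym (Vec.tabulate-∘ _ _))
            (trans (Vec.tabulate-cong (sub*-new ts)) (Vec.tabulate∘lookup ts)))))

    replace-count : ∀ b x {v} F (ts us : Vec (Tm ∅ gen) v) {r q} →
                    Vec.map (λ t → ⟦ t ⟧ emptyValuation) ts ≡
                    Vec.map (λ t → ⟦ t ⟧ emptyValuation) us →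
                    ⟦ r ⟧ emptyValuation ≡ ⟦ q ⟧ emptyValuation →
                    Θ ⊢ count b x F ts r → Θ ⊢ count b x F us q
    replace-count b x {v} F ts us {r} {q} e e′ d = transport (Θ ⊢_) (arguments us q)
      (replace-terms counted (r ∷ ts) (q ∷ us) (cong₂ _∷_ e′ e)
        (transport (Θ ⊢_) (sym (arguments ts r)) d))
      where
      counted : Formula σ₁ (∅ ▸* suc v)
      counted = count b x F (Vec.tabulate λ k → var (suc (k ↑ˡ 0))) (var zero)
      arguments : ∀ ts r → subst (sub* (r ∷ ts)) counted ≡ count b x F ts r
      arguments ts r = cong (λ ts → count b x F ts r)
        (trans (sym (Vec.tabulate-∘ _ _))
          (trans (Vec.tabulate-cong (sub*-new ts)) (Vec.tabulate∘lookup ts)))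

  ⌜_⌝ : Valuation Γ → Sub Γ Δ
  ⌜ η ⌝ s k = tm s (η s k)

  ⌜⌝-instance : ∀ s {η : Valuation Γ} d (A : Formula σ (Γ ▸ s)) →
                subst (liftSub s ⌜ η ⌝) A [ tm s d ] ≡ subst (⌜_⌝ {Δ = Δ} (extend s η d)) A
  ⌜⌝-instance {Γ = Γ} {Δ = Δ} s {η} d = instantiate-lift (variables s d)
    where
    variables : ∀ s d s′ k → extendSub {Γ} {Δ} s ⌜ η ⌝ (tm s d) s′ k ≡ tm s′ (extend {Γ} s η d s′ k)
    variables gen d gen zero    = refl
    variables gen d gen (suc k) = refl
    variables gen d int k       = refl
    variables int d gen k       = refl
    variables int d int zero    = refl
    variables int d int (suc k) = refl

  all*-instance : ∀ n {A} (ds : Vec Pre n) → Θ ⊢ all* n A →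
                  Θ ⊢ subst (⌜_⌝ {Δ = ∅} (extend* {Γ = ∅} ds emptyValuation)) A
  all*-instance zero    {A} []       d =
    transport (_ ⊢_) (sym (subst-id (λ { gen () ; int () }) A)) d
  all*-instance (suc n) {A} (r ∷ ds) d =
    transport (_ ⊢_) (⌜⌝-instance {Γ = ∅ ▸* n} gen r A) (∀E (all*-instance n ds d) (preTm r))

  -- Completeness

  module Completeness (F₀ : Formula σ₁ ∅) (unprovable : Not (Provable F₀)) where

    Consistent : List (Formula σ₁ ∅) → Set₁
    Consistent Θ = Not (Θ ⊢ F₀)

    -- F₀ plays the role of ⊥: a sentence is rejected by proving that it implies F₀.
    Settled : List (Formula σ₁ ∅) → Formula σ₁ ∅ → Set₁
    Settled Θ G = (Θ ⊢ G × (∀ {s A} → G ≡ ex s A → ∃[ d ] Θ ⊢ A [ tm s d ])) ⊎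
                  (Θ ⊢ G ⇒ F₀ × (∀ {s A} → G ≡ all s A → ∃[ d ] Θ ⊢ A [ tm s d ] ⇒ F₀))

    settle : ∀ Θ G → Consistent Θ → ∃[ Θ′ ] Θ ⊆ᴸ Θ′ × Consistent Θ′ × Settled Θ′ G
    settle Θ G consistent with em {P = G ∷ Θ ⊢ F₀}
    settle Θ G consistent | no con′
      with em {P = Σ[ s ∈ Sort ] Σ[ A ∈ Formula σ₁ (∅ ▸ s) ] G ≡ ex s A}
    ... | no ¬ex = G ∷ Θ , there , con′ , inj₁ (v₀ , λ e → ⊥-elim (¬ex (_ , _ , e)))
    ... | yes (s , A , refl) with em {P = ∃[ d ] Consistent (A [ tm s d ] ∷ ex s A ∷ Θ)}
    ...   | yes (d , con″) =
      A [ tm s d ] ∷ ex s A ∷ Θ , (λ i → there (there i)) , con″ , inj₁ (v₁ , λ { refl → d , v₀ })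
    -- If every instance led to `F₀`, so would the existential sentence itself.
    ...   | no ¬∃ = ⊥-elim (con′ (ω-∃ v₀ λ d → decidable-stable em λ con″ → ¬∃ (d , con″)))
    settle Θ G consistent | yes refuted
      with em {P = Σ[ s ∈ Sort ] Σ[ A ∈ Formula σ₁ (∅ ▸ s) ] G ≡ all s A}
    ... | no ¬all = Θ , id , consistent , inj₂ (⇒I refuted , λ e → ⊥-elim (¬all (_ , _ , e)))
    ... | yes (s , A , refl) with em {P = ∃[ d ] Consistent ((A [ tm s d ] ⇒ F₀) ∷ Θ)}
    ...   | yes (d , con′) = _ , there , con′ , inj₂ (wk¹ (⇒I refuted) , λ { refl → d , v₀ })
    -- Otherwise `A(d) → F₀` entails `F₀` for every `d`. The axiom `sqht` provides some `d` with
    -- `A(d) → ∀x A`, and `∀x A` entails `F₀`; so `A(d) → F₀`, and with it `F₀`, becomes derivable.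
    ...   | no ¬∃ = ⊥-elim (consistent (ω-∃ (sqht s A) λ d →
              ⇒E (wk¹ (⇒I (decidable-stable em λ con′ → ¬∃ (d , con′))))
                 (⇒I (⇒E (wk¹ (wk¹ (⇒I refuted)))
                         (transport (A [ tm s d ] ∷ (A ⇒ ren (wk s) (all s A)) [ tm s d ] ∷ Θ ⊢_)
                           (wk-instance s (all s A)) (⇒E v₁ v₀))))))

    stage : ℕ → Σ (List (Formula σ₁ ∅)) Consistent

    next-stage : ∀ n → ∃[ Θ ] proj₁ (stage n) ⊆ᴸ Θ × Consistent Θ × Settled Θ (sentence n)
    next-stage n = settle (proj₁ (stage n)) (sentence n) (proj₂ (stage n))

    stage zero    = [] , unprovable
    stage (suc n) = let Θ , _ , consistent , _ = next-stage n in Θ , consistent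

    axioms : ℕ → List (Formula σ₁ ∅)
    axioms n = proj₁ (stage n)

    axioms-mono : ∀ k n → axioms n ⊆ᴸ axioms (k ℕ.+ n)
    axioms-mono zero    n = id
    axioms-mono (suc k) n = proj₁ (proj₂ (next-stage (k ℕ.+ n))) ∘ axioms-mono k n

    -- Closure under the ω-rules is not automatic, as their premises may stem from unboundedly many
    -- stages. The witnesses in `Settled` provide it in `Th-all`.
    T : Formula σ₁ ∅ → Set₁
    T A = ∃[ n ] axioms n ⊢ A

    T-consistent : Not (T F₀)
    T-consistent (n , d) = proj₂ (stage n) d

    T-provable : Provable A → T A
    T-provable d = 0 , d

    T-⇒E : T (A ⇒ B) → T A → T B
    T-⇒E (m , d) (n , e) = n ℕ.+ m , ⇒E (weaken (axioms-mono n m) d)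
      (weaken (transport (λ k → axioms n ⊆ᴸ axioms k) (ℕ.+-comm m n) (axioms-mono m n)) e)

    infixl 4 _·_

    _·_ : Provable (A ⇒ B) → T A → T B
    d · a = T-⇒E (T-provable d) a

    T-¬⊥ : Not (T ⊥ᶠ)
    T-¬⊥ h = T-consistent (⇒I (⊥E v₀) · h)

    T-settled : ∀ G → (T G × (∀ {s A} → G ≡ ex s A → ∃[ d ] T (A [ tm s d ]))) ⊎
                      (T (G ⇒ F₀) × (∀ {s A} → G ≡ all s A → ∃[ d ] T (A [ tm s d ] ⇒ F₀)))
    T-settled G with sentence-surjective G
    ... | n , refl with proj₂ (proj₂ (proj₂ (next-stage n)))
    ...   | inj₁ (h , w) = inj₁ ((suc n , h) , λ e → let d , k = w e in d , suc n , k)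
    ...   | inj₂ (h , w) = inj₂ ((suc n , h) , λ e → let d , k = w e in d , suc n , k)

    -- Rejection through `F₀` makes this work: if `A → F₀` and `B → F₀` are both in `T`, then
    -- `A ∨ B` puts `F₀` into `T`.
    T-prime : T (A ∨ B) → T A ⊎ T B
    T-prime {A} {B} h with T-settled A | T-settled B
    ... | inj₁ (a , _) | _            = inj₁ a
    ... | inj₂ _       | inj₁ (b , _) = inj₂ b
    ... | inj₂ (a , _) | inj₂ (b , _) = ⊥-elim (T-consistent
      (T-⇒E (T-⇒E (⇒I (⇒I (⇒I (∨E v₀ (⇒E (wk¹ v₂) v₀) (⇒E v₂ v₀)))) · a) b) h))

    -- The sentences that `T` does not refute. By weak excluded middle they are those whose double
    -- negation is in `T`, and so they behave classically.
    There : Formula σ₁ ∅ → Set₁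
    There A = Not (T (¬ A))

    ¬There : Not (There A) → T (¬ A)
    ¬There = decidable-stable em

    -- Weak excluded middle, from the Hosoi axiom for A and ¬ A
    There⇒T¬¬ : There A → T (¬ ¬ A)
    There⇒T¬¬ {A} h with T-prime (T-provable (hosoi A (¬ A)))
    ... | inj₁ a = ⇒I (⇒I (⇒E v₀ v₁)) · a
    ... | inj₂ k with T-prime k
    ...   | inj₁ i = ⊥-elim (h (⇒I (⇒I (⇒E (⇒E v₁ v₀) v₀)) · i))
    ...   | inj₂ n = n

    -- Connectives and quantifiers at the two worlds

    Th : World → Formula σ₁ ∅ → Set₁
    Th here  = T
    Th there = There

    T⇒There : T A → There A
    T⇒There a n = T-¬⊥ (T-⇒E n a)

    Th-apply : ∀ w → Provable (A ⇒ B) → Th w A → Th w B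
    Th-apply here  d a   = d · a
    Th-apply there d a n = a (⇒I (⇒I (⇒E v₁ (⇒E (wk¹ (wk¹ d)) v₀))) · n)

    Th-true : Provable A → ∀ w → Th w A
    Th-true d here  = T-provable d
    Th-true d there = T⇒There (T-provable d)

    Th-false : Provable (¬ A) → ∀ w → Not (Th w A)
    Th-false d here  a = T-¬⊥ (d · a)
    Th-false d there a = a (T-provable d)

    Th-∧ : ∀ w → Th w (A ∧ B) ⇔ (Th w A × Th w B)
    Th-∧ {A} {B} w = mk⇔ (λ h → Th-apply w (⇒I (∧E₁ v₀)) h , Th-apply w (⇒I (∧E₂ v₀)) h) (pair w)
      where
      pair : ∀ w → Th w A × Th w B → Th w (A ∧ B)
      pair here  (a , b)   = T-⇒E (⇒I (⇒I (∧I v₁ v₀)) · a) b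
      pair there (a , b) n = T-¬⊥ (T-⇒E (T-⇒E
        (⇒I (⇒I (⇒I (⇒E v₁ (⇒I (⇒E v₁ (⇒I (⇒E v₄ (∧I v₁ v₀)))))))) · n) (There⇒T¬¬ a))
          (There⇒T¬¬ b))

    Th-∨ : ∀ w → Th w (A ∨ B) ⇔ (Th w A ⊎ Th w B)
    Th-∨ {A} {B} w = mk⇔ (cases w) λ { (inj₁ a) → Th-apply w (⇒I (∨I₁ v₀)) a
                                     ; (inj₂ b) → Th-apply w (⇒I (∨I₂ v₀)) b }
      where
      cases : ∀ w → Th w (A ∨ B) → Th w A ⊎ Th w B
      cases here  h = T-prime h
      cases there h with em {P = There A} | em {P = There B}
      ... | yes a | _     = inj₁ a
      ... | no _  | yes b = inj₂ b
      ... | no ¬a | no ¬b = ⊥-elim (h (T-⇒E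
        (⇒I (⇒I (⇒I (∨E v₀ (⇒E v₃ v₀) (⇒E v₂ v₀)))) · ¬There ¬a) (¬There ¬b)))

    There-⇒ : There (A ⇒ B) ⇔ (There A → There B)
    There-⇒ = mk⇔
      (λ h a n → h (T-⇒E (⇒I (⇒I (⇒I (⇒E v₂ (⇒I (⇒E v₂ (⇒E v₁ v₀)))))) · There⇒T¬¬ a) n))
      (λ f n → T-¬⊥ (T-⇒E n (⇒I (⇒I (⊥E (⇒E v₁ v₀))) ·
        ¬There λ a → f a (⇒I (⇒I (⇒E v₁ (⇒I v₁))) · n))))

    -- From right to left at `here`, the Hosoi axiom for `A` and `B` leaves three cases: `A` yields
    -- `B` by hypothesis, `A → B` is the goal, and `¬ B` yields `¬ A`, since `A` at `there` would
    -- give `B` at `there`.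
    Th-⇒ : ∀ w → Th w (A ⇒ B) ⇔ Upwards (λ v → Th v A → Th v B) w
    Th-⇒ there = mk⇔ (λ { h {_} ≼-refl → to There-⇒ h }) (λ f → from There-⇒ (f ≼-refl))
    Th-⇒ {A} {B} here = mk⇔
      (λ { h {_} ≼-refl a → T-⇒E h a ; h {_} here≼there a → to There-⇒ (T⇒There h) a })
      backward
      where
      backward : Upwards (λ v → Th v A → Th v B) here → T (A ⇒ B)
      backward f with em {P = T B}
      ... | yes b = ⇒I (⇒I v₁) · b
      ... | no ¬b with T-prime (T-provable (hosoi A B))
      ...   | inj₁ a = ⊥-elim (¬b (f ≼-refl a))
      ...   | inj₂ h with T-prime h
      ...     | inj₁ i = i
      ...     | inj₂ n = ⇒I (⇒I (⊥E (⇒E v₁ v₀))) · ¬There λ a → f here≼there a n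

    -- At `here`, a rejected `∀x A` comes with some `A(d) → F₀` in `T`, against `A(d)`. At `there`,
    -- the axiom `sqht` has a witness `d` with `A(d) → ∀x A` in `T`; so refuting `∀x A` would refute
    -- `A(d)`.
    Th-all : ∀ w {s} {A : Formula σ₁ (∅ ▸ s)} → Th w (all s A) ⇔ (∀ d → Th w (A [ tm s d ]))
    Th-all w {s} {A} = mk⇔ (λ h d → Th-apply w (⇒I (∀E v₀ (tm s d))) h) (generalize w)
      where
      generalize : ∀ w → (∀ d → Th w (A [ tm s d ])) → Th w (all s A)
      generalize here h with T-settled (all s A)
      ... | inj₁ (k , _) = k
      ... | inj₂ (_ , k) = let d , l = k refl in ⊥-elim (T-consistent (T-⇒E l (h d)))
      generalize there h n with T-settled (ex s (A ⇒ ren (wk s) (all s A)))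
      ... | inj₂ (k , _) = T-consistent (T-⇒E k (T-provable (sqht s A)))
      ... | inj₁ (_ , k) =
        let d , l = k refl
            i = transport (λ B → T (A [ tm s d ] ⇒ B)) (wk-instance s (all s A)) l
        in h d (T-⇒E (⇒I (⇒I (⇒I (⇒E v₁ (⇒E v₂ v₀)))) · i) n)

    Th-ex : ∀ w {s} {A : Formula σ₁ (∅ ▸ s)} → Th w (ex s A) ⇔ (∃[ d ] Th w (A [ tm s d ]))
    Th-ex w {s} {A} = mk⇔ (witness w) (λ (d , h) → Th-apply w (⇒I (∃I (tm s d) v₀)) h)
      where
      witness : ∀ w → Th w (ex s A) → ∃[ d ] Th w (A [ tm s d ])
      witness here h with T-settled (ex s A)
      ... | inj₁ (_ , k) = k refl
      ... | inj₂ (k , _) = ⊥-elim (T-consistent (T-⇒E k h))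
      -- If every instance were refuted, `∀x ¬ A` would be in `T` by the case of `all` at `here`,
      -- and `∃x A` would be refuted.
      witness there h = decidable-stable em λ ¬∃ →
        h (⇒I (⇒I (ω-∃ v₀ λ d → ⇒E (∀E v₂ (tm s d)) v₀)) ·
           from (Th-all here) λ d → ¬There λ a → ¬∃ (d , a))

    -- Canonical model and truth lemma

    atom : PreAtom → Formula σ₁ ∅
    atom (p , rs) = pred p (map preTm rs)

    -- Membership in `T` lives in `Set₁`, whereas an interpretation consists of predicates in `Set`;
    -- excluded middle and `True` bring it down.
    model : Interpretation
    model = record
      { H   = λ a → True (em {P = T (atom a)})
      ; I   = λ a → True (em {P = There (atom a)})
      ; H⊆I = λ h → fromWitness (T⇒There (toWitness h))
      }

    open Interpretation model

    at-Th : ∀ w a → at w a ⇔ Th w (atom a)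
    at-Th here  a = mk⇔ toWitness fromWitness
    at-Th there a = mk⇔ toWitness fromWitness

    Truth : Formula σ₁ Γ → Set₁
    Truth {Γ} A = ∀ (η : Valuation Γ) w → Force A η w ⇔ Th w (subst ⌜ η ⌝ A)

    -- The truth of a count formula rests on that of its definition, which is not
    -- a subformula.  So it is a hypothesis of truth, void for embedded formulas.
    CountTruth : Formula σ₁ Γ → Set₁
    CountTruth (pred p ts)          = Polymorphic.⊤
    CountTruth (rel c t u)          = Polymorphic.⊤
    CountTruth (t ≈ u)              = Polymorphic.⊤
    CountTruth A@(count b x F vs r) = Truth A
    CountTruth ⊥ᶠ                   = Polymorphic.⊤
    CountTruth (A ∧ B)              = CountTruth A × CountTruth B
    CountTruth (A ∨ B)              = CountTruth A × CountTruth B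
    CountTruth (A ⇒ B)              = CountTruth A × CountTruth B
    CountTruth (all s A)            = CountTruth A
    CountTruth (ex s A)             = CountTruth A

    ⟦⟧-⌜⌝ : ∀ {η : Valuation Γ} {s} (t : Tm Γ s) →
            ⟦ subTm {Δ = ∅} ⌜ η ⌝ t ⟧ emptyValuation ≡ ⟦ t ⟧ η
    ⟦⟧-⌜⌝ {η = η} = ⟦⟧-subTm λ s k → ⟦⟧-tm s (η s k)

    -- Such a sentence is decided by `Std`: its truth does not vary with `I`, so either it or its
    -- negation is an axiom.
    Th-std : ∀ (A : Formula σ₀ ∅) → NoPred A → ∀ {X : Set} → (∀ I → Sat I A emptyValuation ≡ X) →
             ∀ w → X ⇔ Th w (embed A)
    Th-std A p {X} e w with em {P = X}
    ... | yes x = mk⇔ (λ _ → Th-true (std-true A p λ I → transport id (sym (e I)) x) w) (λ _ → x)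
    ... | no ¬x = mk⇔ (⊥-elim ∘ ¬x) (⊥-elim ∘
      Th-false (std-true (¬ A) (p , tt) λ I a → ¬x (transport id (e I) a)) w)

    map-fromList : ∀ {A B : Set} (f : A → B) xs → toList (Vec.map f (fromList xs)) ≡ map f xs
    map-fromList f xs =
      trans (Vec.toList-map f (fromList xs)) (cong (map f) (Vec.toList∘fromList xs))

    replace-arguments : ∀ p {A : Set} (f g : A → Tm ∅ gen) →
                        (∀ x → ⟦ f x ⟧ emptyValuation ≡ ⟦ g x ⟧ emptyValuation) →
                        ∀ xs → Provable (pred p (map f xs) ⇒ pred p (map g xs))
    replace-arguments p f g same xs = ⇒I (transport (assumption ⊢_)
      (cong (pred p) (map-fromList g xs))
      (replace-pred p (Vec.map f (fromList xs)) (Vec.map g (fromList xs))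
        (trans (sym (Vec.map-∘ _ f (fromList xs)))
               (trans (Vec.map-cong same (fromList xs)) (Vec.map-∘ _ g (fromList xs))))
        (transport (assumption ⊢_) (sym (cong (pred p) (map-fromList f xs))) v₀)))
      where
      assumption : List (Formula σ₁ ∅)
      assumption = pred p (map f xs) ∷ []

    -- The model is defined on evaluated arguments, while the substituted formula contains the
    -- unevaluated closed terms; replacing terms by terms of equal value bridges the gap.
    truth-pred : ∀ p ts → Truth {Γ} (pred p ts)
    truth-pred {Γ} p ts η w = mk⇔
      (Th-apply w (replace-arguments p value (subTm ⌜ η ⌝) same ts) ∘
        transport (Th w) (cong (pred p) (sym (List.map-∘ ts))))
      (transport (Th w) (cong (pred p) (List.map-∘ ts)) ∘
        Th-apply w (replace-arguments p (subTm ⌜ η ⌝) value (sym ∘ same) ts))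
      ⇔-∘ at-Th w (p , map (λ t → ⟦ t ⟧ η) ts)
      where
      value : Tm Γ gen → Tm ∅ gen
      value t = preTm (⟦ t ⟧ η)
      same : ∀ t → ⟦ value t ⟧ emptyValuation ≡ ⟦ subTm ⌜ η ⌝ t ⟧ emptyValuation
      same t = trans (⟦⟧-preTm (⟦ t ⟧ η)) (sym (⟦⟧-⌜⌝ t))

    truth : ∀ (A : Formula σ₁ Γ) → CountTruth A → Truth A
    truth (pred p ts) c η w = truth-pred p ts η w
    truth (rel q t u) c η w = Th-std (rel q (subTm ⌜ η ⌝ t) (subTm ⌜ η ⌝ u)) tt
      (λ _ → cong₂ (compare q) (⟦⟧-⌜⌝ t) (⟦⟧-⌜⌝ u)) w
    truth (t ≈ u) c η w =
      Th-std (subTm ⌜ η ⌝ t ≈ subTm ⌜ η ⌝ u) tt (λ _ → cong₂ _≡_ (⟦⟧-⌜⌝ t) (⟦⟧-⌜⌝ u)) w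
    truth (count b x F vs r) c = c
    truth ⊥ᶠ c η w = mk⇔ (λ ()) (λ h → ⊥-elim (Th-false (⇒I v₀) w h))
    truth (A ∧ B) (c , c′) η w = ⇔-sym (Th-∧ w) ⇔-∘ (truth A c η w ×-⇔ truth B c′ η w)
    truth (A ∨ B) (c , c′) η w = ⇔-sym (Th-∨ w) ⇔-∘ (truth A c η w ⊎-⇔ truth B c′ η w)
    truth (A ⇒ B) (c , c′) η w = ⇔-sym (Th-⇒ w) ⇔-∘ ⇒-⇔ (truth A c η) (truth B c′ η) w
    truth (all s A) c η w = ⇔-sym (Th-all w) ⇔-∘ Π-⇔ λ d →
      ≡⇒⇔ (cong (Th w) (sym (⌜⌝-instance s d A))) ⇔-∘ truth A c (extend s η d) w
    truth (ex s A) c η w = ⇔-sym (Th-ex w) ⇔-∘ ∃-⇔ λ d →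
      ≡⇒⇔ (cong (Th w) (sym (⌜⌝-instance s d A))) ⇔-∘ truth A c (extend s η d) w

    countTruth-embed : ∀ (A : Formula σ₀ Γ) → CountTruth (embed A)
    countTruth-embed (pred p ts) = _
    countTruth-embed (rel c t u) = _
    countTruth-embed (t ≈ u)     = _
    countTruth-embed ⊥ᶠ          = _
    countTruth-embed (A ∧ B)     = countTruth-embed A , countTruth-embed B
    countTruth-embed (A ∨ B)     = countTruth-embed A , countTruth-embed B
    countTruth-embed (A ⇒ B)     = countTruth-embed A , countTruth-embed B
    countTruth-embed (all s A)   = countTruth-embed A
    countTruth-embed (ex s A)    = countTruth-embed A

    truth-count : ∀ b x {v} F (vs : Vec (Tm Γ gen) v) r → Truth (count b x F vs r)
    truth-count {Γ} b x {v} F vs r η w =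
      mk⇔ (Th-apply w backward) (Th-apply w forward) ⇔-∘
      (truth (embed G) (countTruth-embed G) η′ w ⇔-∘ Force-count model D ds w)
      where
      c : Pre
      c = ⟦ r ⟧ η
      ds : Vec Pre v
      ds = Vec.map (λ t → ⟦ t ⟧ η) vs
      η′ : Valuation (∅ ▸* v)
      η′ = extend* {Γ = ∅} ds emptyValuation
      G : Formula σ₀ (∅ ▸* v)
      G = proj₁ (countDef b x F c)
      D : CountDef {∅ ▸* v} b x F c G
      D = proj₂ (countDef b x F c)
      zs : Vec (Tm (∅ ▸* v) gen) v
      zs = freshVars {∅} v

      definition : Provable (subst ⌜ η′ ⌝ (count b x F zs (preTm c) ⟺ embed G))
      definition = all*-instance v ds
        (transport ([] ⊢_) (ren-closed (all* v (count b x F zs (preTm c) ⟺ embed G)))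
          (defs _ (def D)))

      values : ∀ {Δ n} {η : Valuation Δ} (ts : Vec (Tm Δ gen) n) →
               Vec.map (λ t → ⟦ t ⟧ emptyValuation) (Vec.map (subTm ⌜ η ⌝) ts) ≡
               Vec.map (λ t → ⟦ t ⟧ η) ts
      values ts = trans (sym (Vec.map-∘ _ _ ts)) (Vec.map-cong ⟦⟧-⌜⌝ ts)

      same : Vec.map (λ t → ⟦ t ⟧ emptyValuation) (Vec.map (subTm ⌜ η ⌝) vs) ≡
             Vec.map (λ t → ⟦ t ⟧ emptyValuation) (Vec.map (subTm ⌜ η′ ⌝) zs)
      same = trans (values vs) (sym (trans (values zs) (freshVars-value {∅} ds emptyValuation)))

      same-bound : ⟦ subTm ⌜ η ⌝ r ⟧ emptyValuation ≡ ⟦ subTm ⌜ η′ ⌝ (preTm c) ⟧ emptyValuation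
      same-bound = trans (⟦⟧-⌜⌝ r) (sym (trans (⟦⟧-⌜⌝ (preTm c)) (⟦⟧-preTm c)))

      forward : Provable (subst ⌜ η ⌝ (count b x F vs r) ⇒ subst ⌜ η′ ⌝ (embed G))
      forward = ⇒I (⇒E (∧E₁ (wk¹ definition)) (replace-count b x F _ _ same same-bound v₀))

      backward : Provable (subst ⌜ η′ ⌝ (embed G) ⇒ subst ⌜ η ⌝ (count b x F vs r))
      backward =
        ⇒I (replace-count b x F _ _ (sym same) (sym same-bound) (⇒E (∧E₂ (wk¹ definition)) v₀))

    countTruth : ∀ (A : Formula σ₁ Γ) → CountTruth A
    countTruth (pred p ts)        = _
    countTruth (rel c t u)        = _
    countTruth (t ≈ u)            = _
    countTruth (count b x F vs r) = truth-count b x F vs r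
    countTruth ⊥ᶠ                 = _
    countTruth (A ∧ B)            = countTruth A , countTruth B
    countTruth (A ∨ B)            = countTruth A , countTruth B
    countTruth (A ⇒ B)            = countTruth A , countTruth B
    countTruth (all s A)          = countTruth A
    countTruth (ex s A)           = countTruth A

    refuted : Not (Force F₀ emptyValuation here)
    refuted h = T-consistent (transport T (subst-id (λ { gen () ; int () }) F₀)
      (to (truth F₀ (countTruth F₀) emptyValuation here) h))

  -- Completeness and the combination of the two equivalences

  completeness : (F : Formula σ₁ ∅) → (∀ M → Interpretation.Force M F emptyValuation here) →
                 Provable F
  completeness F valid = decidable-stable em λ unprovable →
    let open Completeness F unprovable in refuted (valid model)

  provable⇔sameForcing : ∀ Π₁ Π₂ → Provable (τ* Π₁ ⟺ τ* Π₂) ⇔ SameForcing (τ Π₁) (τ Π₂)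
  provable⇔sameForcing Π₁ Π₂ = mk⇔
    (λ d M w →
      let forward , backward = soundness M {F = τ* Π₁ ⟺ τ* Π₂} d {emptyValuation} {w} [] in mk⇔
      (λ h → to (Force-program M Π₂ w) (forward ≼-refl (from (Force-program M Π₁ w) h)))
      (λ h → to (Force-program M Π₁ w) (backward ≼-refl (from (Force-program M Π₂ w) h))))
    (λ e → completeness (τ* Π₁ ⟺ τ* Π₂) λ M →
      (λ {w} _ h → from (Force-program M Π₂ w) (to (e M w) (to (Force-program M Π₁ w) h))) ,
      (λ {w} _ h → from (Force-program M Π₁ w) (from (e M w) (to (Force-program M Π₂ w) h))))

theorem4 : (em : ∀ {ℓ} → ExcludedMiddle ℓ) (P : PrecomputedTerms) →
    let open Language P in
    (Π₁ Π₂ : Program) →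
    Provable (τ* Π₁ ⟺ τ* Π₂) ⇔ StronglyEquivalent em Π₁ Π₂
theorem4 em P Π₁ Π₂ =
  forcing⇔stable em P (τ Π₁) (τ Π₂) ⇔-∘ provable⇔sameForcing em P Π₁ Π₂
  where open Language P
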